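{- Let $C\subseteq\mathbb{F}_2^n$ be a binary linear $[n,k,d]$ code with $\mathbf{1}_n\in C$, whose dual $C^\perp$ has minimum distance $d^\perp$, and suppose that $t$ is a positive integer with $$d^\perp-t=\#\{u \mid C_u\neq\emptyset,\ 0<u\le n-t\}$$ and $(d^\perp,t)=(8,5)$. Then $C$ is the extended binary Golay code $\mathcal{G}_{24}$ (the unique binary $[24,12,8]$ code, up to equivalence).
   Context: $\mathbf{1}_n$ is the all-ones vector; $C^\perp$ is the dual code with respect to the standard inner product; $d^\perp$ is the minimum weight of a nonzero codeword of $C^\perp$; $C_u=\{c\in C:\mathrm{wt}(c)=u\}$ where $\mathrm{wt}$ is Hamming weight. -}

module Defs where

open import Data.Fin.Permutation using (Permutation; _⟨$⟩ˡ_)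
open import Data.List.Base using (List; length)
open import Data.List.Membership.Propositional using () renaming (_∈_ to _∈ᴸ_)
open import Data.List.Relation.Unary.Unique.Propositional using (Unique)
open import Data.Nat.Base using (ℕ; _≤_)
open import Data.Parity.Base using (Parity; 0ℙ; 1ℙ; _+_; _*_)
import Data.Parity.Properties as ℙ
open import Data.Product.Base using (Σ; ∃; _×_; _,_)
open import Data.Vec.Base
  using (Vec; []; _∷_; zipWith; replicate; map; foldr′; count; lookup; tabulate)
open import Data.Vec.Properties
  using (zipWith-assoc; zipWith-comm; zipWith-identityˡ; map-const)
open import Function.Bundles using (_⇔_)
open import Level using (0ℓ)
open import Relation.Binary.PropositionalEquality
  using (_≡_; _≢_; refl; sym; trans; cong; cong₂; module ≡-Reasoning)
open import Relation.Unary using (Pred)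

𝔽₂ : Set
𝔽₂ = Parity

Word : ℕ → Set
Word n = Vec 𝔽₂ n

private variable
  k n m : ℕ

infixl 6 _⊕_
infixr 7 _·_

𝟎 𝟏 : Word n
𝟎 = replicate _ 0ℙ
𝟏 = replicate _ 1ℙ

_⊕_ : Word n → Word n → Word n
_⊕_ = zipWith _+_

_·_ : 𝔽₂ → Word n → Word n
a · v = map (a *_) v

⟨_,_⟩ : Word n → Word n → 𝔽₂
⟨ v , w ⟩ = foldr′ _+_ 0ℙ (zipWith _*_ v w)

wt : Word n → ℕ
wt = count (ℙ._≟ 1ℙ)

-- Closure under scalar multiplication is automatic over 𝔽₂.
record LinearCode (n : ℕ) : Set₁ where
  field
    Codeword   : Pred (Word n) 0ℓ
    𝟎-codeword : Codeword 𝟎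
    ⊕-codeword : ∀ {v w} → Codeword v → Codeword w → Codeword (v ⊕ w)

open LinearCode public

infix 4 _∈_ _≅_

_∈_ : Word n → LinearCode n → Set
v ∈ C = Codeword C v

private
  interchange : (a b c d : Word n) → (a ⊕ b) ⊕ (c ⊕ d) ≡ (a ⊕ c) ⊕ (b ⊕ d)
  interchange a b c d = begin
    (a ⊕ b) ⊕ (c ⊕ d)  ≡⟨ assoc a b (c ⊕ d) ⟩
    a ⊕ (b ⊕ (c ⊕ d))  ≡⟨ cong (a ⊕_) (assoc b c d) ⟨
    a ⊕ ((b ⊕ c) ⊕ d)  ≡⟨ cong (λ e → a ⊕ (e ⊕ d)) (zipWith-comm ℙ.+-comm b c) ⟩
    a ⊕ ((c ⊕ b) ⊕ d)  ≡⟨ cong (a ⊕_) (assoc c b d) ⟩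
    a ⊕ (c ⊕ (b ⊕ d))  ≡⟨ assoc a c (b ⊕ d) ⟨
    (a ⊕ c) ⊕ (b ⊕ d)  ∎
    where
    open ≡-Reasoning
    assoc : (u v w : Word _) → (u ⊕ v) ⊕ w ≡ u ⊕ (v ⊕ w)
    assoc = zipWith-assoc ℙ.+-assoc

  ⊕-identityˡ : (v : Word n) → 𝟎 ⊕ v ≡ v
  ⊕-identityˡ = zipWith-identityˡ ℙ.+-identityˡ

  0·_ : (v : Word n) → 0ℙ · v ≡ 𝟎
  0· v = map-const v 0ℙ

  ·-distribʳ : ∀ a b (v : Word n) → (a + b) · v ≡ a · v ⊕ b · v
  ·-distribʳ a b []      = refl
  ·-distribʳ a b (x ∷ v) = cong₂ _∷_ (ℙ.*-distribʳ-+ x a b) (·-distribʳ a b v)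

  ⟨,⟩-𝟎 : (v : Word n) → ⟨ v , 𝟎 ⟩ ≡ 0ℙ
  ⟨,⟩-𝟎 []      = refl
  ⟨,⟩-𝟎 (x ∷ v) = cong₂ _+_ (ℙ.*-zeroʳ x) (⟨,⟩-𝟎 v)

  ⟨,⟩-⊕ : (v u w : Word n) → ⟨ v , u ⊕ w ⟩ ≡ ⟨ v , u ⟩ + ⟨ v , w ⟩
  ⟨,⟩-⊕ []      []      []      = refl
  ⟨,⟩-⊕ (x ∷ v) (y ∷ u) (z ∷ w) = begin
    (x * (y + z)) + ⟨ v , u ⊕ w ⟩                 ≡⟨ cong₂ _+_ (ℙ.*-distribˡ-+ x y z) (⟨,⟩-⊕ v u w) ⟩
    ((x * y) + (x * z)) + (⟨ v , u ⟩ + ⟨ v , w ⟩) ≡⟨ medial (x * y) (x * z) ⟨ v , u ⟩ ⟨ v , w ⟩ ⟩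
    ((x * y) + ⟨ v , u ⟩) + ((x * z) + ⟨ v , w ⟩) ∎
    where
    open ≡-Reasoning
    open import Algebra.Properties.CommutativeSemigroup ℙ.+-commutativeSemigroup
      using () renaming (interchange to medial)

_⊥ : LinearCode n → LinearCode n
C ⊥ = record
  { Codeword   = λ v → ∀ {c} → c ∈ C → ⟨ c , v ⟩ ≡ 0ℙ
  ; 𝟎-codeword = λ {c} _ → ⟨,⟩-𝟎 c
  ; ⊕-codeword = λ {v} {w} p q {c} c∈C →
      trans (⟨,⟩-⊕ c v w) (cong₂ _+_ (p c∈C) (q c∈C))
  }

linComb : Vec 𝔽₂ k → Vec (Word n) k → Word n
linComb []      []      = 𝟎
linComb (a ∷ x) (g ∷ G) = a · g ⊕ linComb x G

private
  linComb-𝟎 : (G : Vec (Word n) k) → linComb 𝟎 G ≡ 𝟎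
  linComb-𝟎 []      = refl
  linComb-𝟎 (g ∷ G) = trans (cong₂ _⊕_ (0· g) (linComb-𝟎 G)) (⊕-identityˡ 𝟎)

  linComb-⊕ : (x y : Vec 𝔽₂ k) (G : Vec (Word n) k) →
              linComb (x ⊕ y) G ≡ linComb x G ⊕ linComb y G
  linComb-⊕ []      []      []      = sym (⊕-identityˡ 𝟎)
  linComb-⊕ (a ∷ x) (b ∷ y) (g ∷ G) =
    trans (cong₂ _⊕_ (·-distribʳ a b g) (linComb-⊕ x y G))
          (interchange (a · g) (b · g) (linComb x G) (linComb y G))

rowSpace : Vec (Word n) k → LinearCode n
rowSpace G = record
  { Codeword   = λ v → ∃ λ x → linComb x G ≡ v
  ; 𝟎-codeword = 𝟎 , linComb-𝟎 G
  ; ⊕-codeword = λ { (x , p) (y , q) → x ⊕ y , trans (linComb-⊕ x y G) (cong₂ _⊕_ p q) }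
  }

LinearlyIndependent : Vec (Word n) k → Set
LinearlyIndependent G = ∀ x → linComb x G ≡ 𝟎 → x ≡ 𝟎

HasDimension : LinearCode n → ℕ → Set
HasDimension {n} C k =
  Σ (Vec (Word n) k) λ G → LinearlyIndependent G × (∀ v → v ∈ C ⇔ v ∈ rowSpace G)

-- For linear codes this is the minimum weight of a nonzero codeword; it has no
-- value for the zero code.
HasMinimumDistance : LinearCode n → ℕ → Set
HasMinimumDistance C d =
  (∃ λ c → c ∈ C × c ≢ 𝟎 × wt c ≡ d) × (∀ {c} → c ∈ C → c ≢ 𝟎 → d ≤ wt c)

-- C is an [n,k,d] code.
record IsCode {n : ℕ} (C : LinearCode n) (k d : ℕ) : Set where
  field
    dimension       : HasDimension C k
    minimumDistance : HasMinimumDistance C d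

-- The set C_u of codewords of weight u.
_ofWeight_ : LinearCode n → ℕ → Pred (Word n) 0ℓ
(C ofWeight u) c = c ∈ C × wt c ≡ u

infix 4 #_≡_

-- P has exactly m elements: they are listed, without repetition, by xs.
#_≡_ : Pred ℕ 0ℓ → ℕ → Set
# P ≡ m = Σ (List ℕ) λ xs → Unique xs × length xs ≡ m × (∀ u → u ∈ᴸ xs ⇔ P u)

-- The i-th coordinate of v becomes the π(i)-th coordinate of permute π v.
permute : Permutation m n → Word m → Word n
permute π v = tabulate λ j → lookup v (π ⟨$⟩ˡ j)

-- Equivalence of binary codes up to a permutation of the coordinates.  The
-- lengths need not be equal definitionally; Permutation m n forces m ≡ n.
_≅_ : LinearCode m → LinearCode n → Set
_≅_ {m} {n} C D = Σ (Permutation m n) λ π → ∀ v → v ∈ C ⇔ permute π v ∈ D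

private
  pattern O = 0ℙ
  pattern I = 1ℙ

-- The generator matrix [ I₁₂ | B ], where B is the bordered circulant whose
-- first row is the indicator of the squares {0,1,3,4,5,9} modulo 11 followed
-- by 1, whose next rows are its successive left shifts, and whose last row
-- is 1¹¹ 0.  Its row space is the extended binary Golay code.
golayMatrix : Vec (Word 24) 12
golayMatrix =
    (I ∷ O ∷ O ∷ O ∷ O ∷ O ∷ O ∷ O ∷ O ∷ O ∷ O ∷ O  ∷  I ∷ I ∷ O ∷ I ∷ I ∷ I ∷ O ∷ O ∷ O ∷ I ∷ O ∷ I ∷ [])
  ∷ (O ∷ I ∷ O ∷ O ∷ O ∷ O ∷ O ∷ O ∷ O ∷ O ∷ O ∷ O  ∷  I ∷ O ∷ I ∷ I ∷ I ∷ O ∷ O ∷ O ∷ I ∷ O ∷ I ∷ I ∷ [])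
  ∷ (O ∷ O ∷ I ∷ O ∷ O ∷ O ∷ O ∷ O ∷ O ∷ O ∷ O ∷ O  ∷  O ∷ I ∷ I ∷ I ∷ O ∷ O ∷ O ∷ I ∷ O ∷ I ∷ I ∷ I ∷ [])
  ∷ (O ∷ O ∷ O ∷ I ∷ O ∷ O ∷ O ∷ O ∷ O ∷ O ∷ O ∷ O  ∷  I ∷ I ∷ I ∷ O ∷ O ∷ O ∷ I ∷ O ∷ I ∷ I ∷ O ∷ I ∷ [])
  ∷ (O ∷ O ∷ O ∷ O ∷ I ∷ O ∷ O ∷ O ∷ O ∷ O ∷ O ∷ O  ∷  I ∷ I ∷ O ∷ O ∷ O ∷ I ∷ O ∷ I ∷ I ∷ O ∷ I ∷ I ∷ [])
  ∷ (O ∷ O ∷ O ∷ O ∷ O ∷ I ∷ O ∷ O ∷ O ∷ O ∷ O ∷ O  ∷  I ∷ O ∷ O ∷ O ∷ I ∷ O ∷ I ∷ I ∷ O ∷ I ∷ I ∷ I ∷ [])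
  ∷ (O ∷ O ∷ O ∷ O ∷ O ∷ O ∷ I ∷ O ∷ O ∷ O ∷ O ∷ O  ∷  O ∷ O ∷ O ∷ I ∷ O ∷ I ∷ I ∷ O ∷ I ∷ I ∷ I ∷ I ∷ [])
  ∷ (O ∷ O ∷ O ∷ O ∷ O ∷ O ∷ O ∷ I ∷ O ∷ O ∷ O ∷ O  ∷  O ∷ O ∷ I ∷ O ∷ I ∷ I ∷ O ∷ I ∷ I ∷ I ∷ O ∷ I ∷ [])
  ∷ (O ∷ O ∷ O ∷ O ∷ O ∷ O ∷ O ∷ O ∷ I ∷ O ∷ O ∷ O  ∷  O ∷ I ∷ O ∷ I ∷ I ∷ O ∷ I ∷ I ∷ I ∷ O ∷ O ∷ I ∷ [])
  ∷ (O ∷ O ∷ O ∷ O ∷ O ∷ O ∷ O ∷ O ∷ O ∷ I ∷ O ∷ O  ∷  I ∷ O ∷ I ∷ I ∷ O ∷ I ∷ I ∷ I ∷ O ∷ O ∷ O ∷ I ∷ [])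
  ∷ (O ∷ O ∷ O ∷ O ∷ O ∷ O ∷ O ∷ O ∷ O ∷ O ∷ I ∷ O  ∷  O ∷ I ∷ I ∷ O ∷ I ∷ I ∷ I ∷ O ∷ O ∷ O ∷ I ∷ I ∷ [])
  ∷ (O ∷ O ∷ O ∷ O ∷ O ∷ O ∷ O ∷ O ∷ O ∷ O ∷ O ∷ I  ∷  I ∷ I ∷ I ∷ I ∷ I ∷ I ∷ I ∷ I ∷ I ∷ I ∷ I ∷ O ∷ [])
  ∷ []

𝒢₂₄ : LinearCode 24
𝒢₂₄ = rowSpace golayMatrix

-- Averages over C of polynomials of degree at most 7 in the signs (−1)^cᵢ agree with averages over all
-- words, since C ⊥ has no nonzero word of weight at most 7. If C had a word v of minimal weight at most 4,
-- one could multiply the two other listed weights and the complements of the small ones into a polynomial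
-- of degree 7 that vanishes on all of C except v but has average 0. So the three listed weights are all
-- the weights strictly between 0 and n; they are n/2, p and n − p. Two polynomials vanishing at the
-- nonzero weights give (n − 2p)² = 3n − 8 and n (n² − 3n + 8) = 3 · 2ᵏ, whence n = 24 and the weights
-- are 8, 12, 16. In particular C is self-orthogonal.
--
-- For uniqueness, fix a dodecad D ∈ C, a point in it and a point outside. As a word of C ⊥ supported on D
-- and one more point is 0 or D, every even subset of D is cut out by a codeword, whose other entries are
-- constrained by the weights of its sums with earlier codewords. Up to the order of the coordinates this
-- determines ten codewords one after the other, the same for C and the Golay code; together with D and 𝟏
-- they span the Golay code, which is self-dual.

module Submission where

open import Defs
open import Data.Bool.Base using (Bool; true; false; T; not) renaming (_∧_ to _&&_; _∨_ to _||_)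
open import Data.Bool.ListAction using (all)
open import Data.Bool.Properties using (T-∧; T-∨)
open import Data.Empty using (⊥-elim) renaming (⊥ to False)
open import Data.Fin.Base using (Fin; zero; suc; toℕ; fromℕ<; cast; _↑ˡ_)
open import Data.Fin.Permutation using (Permutation; cast-id; _∘ₚ_; _⟨$⟩ʳ_; _⟨$⟩ˡ_; inverseʳ; inverseˡ) renaming (flip to inverse)
import Data.Fin.Properties as Fin
open import Data.Integer.Base as ℤ using (ℤ; +_; 0ℤ; 1ℤ; -1ℤ)
import Data.Integer.Properties as ℤ
open import Data.Integer.Tactic.RingSolver using () renaming (solve-∀ to ℤ-solve-∀)
open import Data.List.Base using (List; []; _∷_; length; _++_; upTo; replicate) renaming (map to mapᴸ; lookup to lookupᴸ)
open import Data.List.Membership.Propositional using () renaming (_∈_ to _∈ᴸ_; _∉_ to _∉ᴸ_)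
open import Data.List.Membership.Propositional.Properties using (∈-++⁺ˡ; ∈-++⁺ʳ; ∈-++⁻; ∈-map⁺; ∈-map⁻; ∈-upTo⁺; ∈-upTo⁻)
open import Data.List.Properties using (length-++; length-map; length-upTo; map-++; map-replicate; ++-assoc; map-∘; ∷-injectiveˡ; ∷-injectiveʳ) renaming (≡-dec to ≡-decᴸ)
open import Data.List.Relation.Binary.Permutation.Homogeneous using (onIndices)
open import Data.List.Relation.Binary.Permutation.Propositional using (_↭_; ↭-refl; ↭-sym; ↭-trans; ↭-prep; ↭-reflexive; ↭-swap; ↭⇒↭ₛ)
open import Data.List.Relation.Binary.Permutation.Propositional.Properties using (map⁺; ↭-map-inv; ++⁺; All-resp-↭) renaming (shift to ↭-shift)
open import Data.List.Relation.Binary.Permutation.Setoid.Properties using (onIndices-lookup)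
open import Data.List.Relation.Binary.Pointwise.Base using (Pointwise; []; _∷_)
open import Data.List.Relation.Unary.All as All using (All; []; _∷_)
open import Data.List.Relation.Unary.All.Properties using (all⁺; ++⁻; all⁻) renaming (++⁺ to All-++⁺; map⁺ to All-map⁺)
open import Data.List.Relation.Unary.AllPairs using ([]; _∷_)
open import Data.List.Relation.Unary.Any using (here; there)
open import Data.List.Relation.Unary.Unique.Propositional using (Unique)
open import Data.Maybe.Base using (Maybe; just; nothing; from-just)
open import Data.Nat.Base as ℕ using (ℕ; zero; suc; _+_; _*_; _∸_; _<_; _≤_; z≤n; s≤s; parity; _^_)
open import Data.Nat.Divisibility using (_∣_; divides; ∣m+n∣m⇒∣n; m∣m*n; *-cancelˡ-∣; _∣?_; ∣-trans; ∣⇒≤; n∣m*n; *-monoʳ-∣; ∣m⇒∣m*n; ∣m∣n⇒∣m+n; ∣n⇒∣m*n)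
open import Data.Nat.ListAction using (sum)
open import Data.Nat.ListAction.Properties using (sum-++; sum-↭)
open import Data.Nat.Primality using (prime[2]; euclidsLemma)
import Data.Nat.Properties as ℕ
open import Data.Nat.Tactic.RingSolver using (solve-∀)
open import Data.Parity.Base as ℙ using (0ℙ; 1ℙ)
import Data.Parity.Properties as ℙₚ
open import Data.Product.Base using (∃; _×_; _,_; proj₁; proj₂; ∃₂; map₁)
open import Data.Sum.Base using (_⊎_; inj₁; inj₂)
open import Data.Unit.Base using (tt)
open import Data.Vec.Base using (Vec; []; _∷_; zipWith; map; tail; lookup; toList; head; tabulate; drop) renaming (_++_ to _++ⱽ_)
open import Data.Vec.Properties using (zipWith-assoc; zipWith-comm; zipWith-identityˡ; zipWith-identityʳ; ≡-dec; lookup-zipWith; lookup-replicate; toList-map; length-toList; lookup-map; lookup∘tabulate; tabulate∘lookup; tabulate-cong; tabulate-∘) renaming (map-++ to mapⱽ-++)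
open import Function.Base using (_∘_)
open import Function.Bundles using (_⇔_; Equivalence; mk⇔)
open import Relation.Binary.PropositionalEquality using (_≡_; _≢_; refl; sym; trans; cong; cong₂; subst; subst₂; module ≡-Reasoning; setoid)
open import Relation.Nullary using (¬_; Dec; yes; no; contradiction)
open import Relation.Nullary.Decidable using (toWitness; toWitnessFalse; _→-dec_; _⊎-dec_; ⌊_⌋; fromWitness)
open import Relation.Unary using (Satisfiable)
open import Algebra.Properties.AbelianGroup ℤ.+-0-abelianGroup using () renaming (∙-cancelˡ to ℤ-+-cancelˡ)
open import Data.List.Membership.DecPropositional ℕ._≟_ using (_∈?_)
open import Algebra.Properties.CommutativeMonoid.Sum ℙₚ.+-0-commutativeMonoid using (sum-permute; sum-cong-≋) renaming (sum to ∑ℙ)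

-- Averages are integer sums scaled by 2^n and 2^k, so nothing is divided. For a light word v the
-- delicate point is the average 0: the indicator of the words covering v has no reason to give it.
-- So one coordinate i of v is traded for the difference of the signs at i and at some j, where v is
-- 1 and 0. The result changes sign when i and j are exchanged. The price is a possible second
-- survivor, v with i moved to j; a dual word of weight 8 that tells i from j rules it out.
--
-- The numerical equation also holds at n = 8, and the even-weight code of length 8 has dual
-- distance 8, so this length is excluded separately, by counting weights.
--
-- For uniqueness, words are not enumerated. Up to the order of coordinates only the multiset of
-- columns matters, so the search runs over the number of ones that a new row has in each class of
-- equal columns. The dimension of C is never compared with 12: the codewords found put a copy of
-- the Golay code inside C, and equality follows because C is self-orthogonal and the Golay code
-- contains its dual.

private variable
  k m n : ℕ

-- Words, weights and linear algebra over the field with two elements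

infixr 7 _∧_

_∧_ : Word n → Word n → Word n
_∧_ = zipWith ℙ._*_

bit : 𝔽₂ → ℕ
bit 0ℙ = 0
bit 1ℙ = 1

_≟ʷ_ : (v w : Word n) → Dec (v ≡ w)
_≟ʷ_ = ≡-dec ℙₚ._≟_

wt-∷ : ∀ a (v : Word n) → wt (a ∷ v) ≡ bit a + wt v
wt-∷ 0ℙ v = refl
wt-∷ 1ℙ v = refl

⊕-comm : (v w : Word n) → v ⊕ w ≡ w ⊕ v
⊕-comm = zipWith-comm ℙₚ.+-comm

⊕-assoc : (u v w : Word n) → (u ⊕ v) ⊕ w ≡ u ⊕ (v ⊕ w)
⊕-assoc = zipWith-assoc ℙₚ.+-assoc

⊕-identityˡ : (v : Word n) → 𝟎 ⊕ v ≡ v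
⊕-identityˡ = zipWith-identityˡ ℙₚ.+-identityˡ

⊕-identityʳ : (v : Word n) → v ⊕ 𝟎 ≡ v
⊕-identityʳ = zipWith-identityʳ ℙₚ.+-identityʳ

⊕-self : (v : Word n) → v ⊕ v ≡ 𝟎
⊕-self []       = refl
⊕-self (0ℙ ∷ v) = cong (0ℙ ∷_) (⊕-self v)
⊕-self (1ℙ ∷ v) = cong (0ℙ ∷_) (⊕-self v)

⊕-cancelˡ : (v w : Word n) → v ⊕ (v ⊕ w) ≡ w
⊕-cancelˡ v w = trans (sym (⊕-assoc v v w)) (trans (cong (_⊕ w) (⊕-self v)) (⊕-identityˡ w))

⊕≡𝟎⇒≡ : (v w : Word n) → v ⊕ w ≡ 𝟎 → v ≡ w
⊕≡𝟎⇒≡ v w e = trans (sym (⊕-identityʳ v)) (trans (cong (v ⊕_) (sym e)) (⊕-cancelˡ v w))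

⊕-interchange : (a b c d : Word n) → (a ⊕ b) ⊕ (c ⊕ d) ≡ (a ⊕ c) ⊕ (b ⊕ d)
⊕-interchange a b c d = begin
  (a ⊕ b) ⊕ (c ⊕ d)  ≡⟨ ⊕-assoc a b (c ⊕ d) ⟩
  a ⊕ (b ⊕ (c ⊕ d))  ≡⟨ cong (a ⊕_) (sym (⊕-assoc b c d)) ⟩
  a ⊕ ((b ⊕ c) ⊕ d)  ≡⟨ cong (λ e → a ⊕ (e ⊕ d)) (⊕-comm b c) ⟩
  a ⊕ ((c ⊕ b) ⊕ d)  ≡⟨ cong (a ⊕_) (⊕-assoc c b d) ⟩
  a ⊕ (c ⊕ (b ⊕ d))  ≡⟨ sym (⊕-assoc a c (b ⊕ d)) ⟩
  (a ⊕ c) ⊕ (b ⊕ d)  ∎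
  where open ≡-Reasoning

0· : (v : Word n) → 0ℙ · v ≡ 𝟎
0· []      = refl
0· (x ∷ v) = cong (0ℙ ∷_) (0· v)

1· : (v : Word n) → 1ℙ · v ≡ v
1· []      = refl
1· (x ∷ v) = cong (x ∷_) (1· v)

⟨,⟩-comm : (v w : Word n) → ⟨ v , w ⟩ ≡ ⟨ w , v ⟩
⟨,⟩-comm []      []      = refl
⟨,⟩-comm (a ∷ v) (b ∷ w) = cong₂ ℙ._+_ (ℙₚ.*-comm a b) (⟨,⟩-comm v w)

⟨,⟩-𝟎ʳ : (v : Word n) → ⟨ v , 𝟎 ⟩ ≡ 0ℙ
⟨,⟩-𝟎ʳ []      = refl
⟨,⟩-𝟎ʳ (x ∷ v) = cong₂ ℙ._+_ (ℙₚ.*-zeroʳ x) (⟨,⟩-𝟎ʳ v)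

⟨,⟩-𝟎ˡ : (v : Word n) → ⟨ 𝟎 , v ⟩ ≡ 0ℙ
⟨,⟩-𝟎ˡ v = trans (⟨,⟩-comm 𝟎 v) (⟨,⟩-𝟎ʳ v)

private
  ℙ-medial : ∀ a b c d → (a ℙ.+ b) ℙ.+ (c ℙ.+ d) ≡ (a ℙ.+ c) ℙ.+ (b ℙ.+ d)
  ℙ-medial = interchange
    where open import Algebra.Properties.CommutativeSemigroup ℙₚ.+-commutativeSemigroup

⟨,⟩-⊕ˡ : (u v w : Word n) → ⟨ u ⊕ v , w ⟩ ≡ ⟨ u , w ⟩ ℙ.+ ⟨ v , w ⟩
⟨,⟩-⊕ˡ []      []      []      = refl
⟨,⟩-⊕ˡ (a ∷ u) (b ∷ v) (c ∷ w) =
  trans (cong₂ ℙ._+_ (ℙₚ.*-distribʳ-+ c a b) (⟨,⟩-⊕ˡ u v w))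
        (ℙ-medial (a ℙ.* c) (b ℙ.* c) ⟨ u , w ⟩ ⟨ v , w ⟩)

⟨,⟩-⊕ʳ : (u v w : Word n) → ⟨ u , v ⊕ w ⟩ ≡ ⟨ u , v ⟩ ℙ.+ ⟨ u , w ⟩
⟨,⟩-⊕ʳ u v w = trans (⟨,⟩-comm u (v ⊕ w))
  (trans (⟨,⟩-⊕ˡ v w u) (cong₂ ℙ._+_ (⟨,⟩-comm v u) (⟨,⟩-comm w u)))

⟨,⟩-·ˡ : ∀ a (v w : Word n) → ⟨ a · v , w ⟩ ≡ a ℙ.* ⟨ v , w ⟩
⟨,⟩-·ˡ 0ℙ v w = trans (cong ⟨_, w ⟩ (0· v)) (⟨,⟩-𝟎ˡ w)
⟨,⟩-·ˡ 1ℙ v w = cong ⟨_, w ⟩ (1· v)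

⟨,⟩-∧ : (u v w : Word n) → ⟨ u ∧ v , w ⟩ ≡ ⟨ v , u ∧ w ⟩
⟨,⟩-∧ []      []      []      = refl
⟨,⟩-∧ (a ∷ u) (b ∷ v) (c ∷ w) = cong₂ ℙ._+_
  (trans (cong (ℙ._* c) (ℙₚ.*-comm a b)) (ℙₚ.*-assoc b a c)) (⟨,⟩-∧ u v w)

wt-𝟎 : ∀ n → wt (𝟎 {n}) ≡ 0
wt-𝟎 zero    = refl
wt-𝟎 (suc n) = wt-𝟎 n

wt-𝟏 : ∀ n → wt (𝟏 {n}) ≡ n
wt-𝟏 zero    = refl
wt-𝟏 (suc n) = cong suc (wt-𝟏 n)

wt≡0⇒≡𝟎 : (v : Word n) → wt v ≡ 0 → v ≡ 𝟎
wt≡0⇒≡𝟎 []       e = refl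
wt≡0⇒≡𝟎 (0ℙ ∷ v) e = cong (0ℙ ∷_) (wt≡0⇒≡𝟎 v e)

wt-complement : (v : Word n) → wt (𝟏 ⊕ v) + wt v ≡ n
wt-complement []       = refl
wt-complement (0ℙ ∷ v) = cong suc (wt-complement v)
wt-complement (1ℙ ∷ v) = trans (ℕ.+-suc _ _) (cong suc (wt-complement v))

wt≤ : (v : Word n) → wt v ≤ n
wt≤ v = subst (wt v ≤_) (wt-complement v) (ℕ.m≤n+m (wt v) (wt (𝟏 ⊕ v)))

wt-⊕ : (u v : Word n) → wt u + wt v ≡ wt (u ⊕ v) + 2 * wt (u ∧ v)
wt-⊕ []      []      = refl
wt-⊕ (a ∷ u) (b ∷ v) = begin
  wt (a ∷ u) + wt (b ∷ v)             ≡⟨ cong₂ _+_ (wt-∷ a u) (wt-∷ b v) ⟩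
  (bit a + wt u) + (bit b + wt v)     ≡⟨ medial (bit a) (wt u) (bit b) (wt v) ⟩
  (bit a + bit b) + (wt u + wt v)     ≡⟨ cong₂ _+_ (bits a b) (wt-⊕ u v) ⟩
  (bit (a ℙ.+ b) + 2 * bit (a ℙ.* b)) + (wt (u ⊕ v) + 2 * wt (u ∧ v))
    ≡⟨ shuffle (bit (a ℙ.+ b)) (bit (a ℙ.* b)) (wt (u ⊕ v)) (wt (u ∧ v)) ⟩
  (bit (a ℙ.+ b) + wt (u ⊕ v)) + 2 * (bit (a ℙ.* b) + wt (u ∧ v))
    ≡⟨ cong₂ (λ s t → s + 2 * t) (sym (wt-∷ (a ℙ.+ b) (u ⊕ v))) (sym (wt-∷ (a ℙ.* b) (u ∧ v))) ⟩
  wt ((a ∷ u) ⊕ (b ∷ v)) + 2 * wt ((a ∷ u) ∧ (b ∷ v)) ∎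
  where
  open ≡-Reasoning
  bits : ∀ a b → bit a + bit b ≡ bit (a ℙ.+ b) + 2 * bit (a ℙ.* b)
  bits 0ℙ 0ℙ = refl
  bits 0ℙ 1ℙ = refl
  bits 1ℙ 0ℙ = refl
  bits 1ℙ 1ℙ = refl
  medial : ∀ p q r s → (p + q) + (r + s) ≡ (p + r) + (q + s)
  medial = solve-∀
  shuffle : ∀ p q r s → (p + 2 * q) + (r + 2 * s) ≡ (p + r) + 2 * (q + s)
  shuffle = solve-∀

wt-⊕-≤ : (u v : Word n) → wt (u ⊕ v) ≤ wt u + wt v
wt-⊕-≤ u v = subst (wt (u ⊕ v) ≤_) (sym (wt-⊕ u v)) (ℕ.m≤m+n _ _)

⟨,⟩≡parity : (u v : Word n) → ⟨ u , v ⟩ ≡ parity (wt (u ∧ v))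
⟨,⟩≡parity []      []      = refl
⟨,⟩≡parity (a ∷ u) (b ∷ v) = begin
  a ℙ.* b ℙ.+ ⟨ u , v ⟩                      ≡⟨ cong₂ ℙ._+_ (bit-parity (a ℙ.* b)) (⟨,⟩≡parity u v) ⟩
  parity (bit (a ℙ.* b)) ℙ.+ parity (wt (u ∧ v)) ≡⟨ sym (ℙₚ.+-homo-+ (bit (a ℙ.* b)) (wt (u ∧ v))) ⟩
  parity (bit (a ℙ.* b) + wt (u ∧ v))        ≡⟨ cong parity (sym (wt-∷ (a ℙ.* b) (u ∧ v))) ⟩
  parity (wt ((a ∷ u) ∧ (b ∷ v)))            ∎
  where
  open ≡-Reasoning
  bit-parity : ∀ a → a ≡ parity (bit a)
  bit-parity 0ℙ = refl
  bit-parity 1ℙ = refl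

-- The left side is 4 wt (u ⊕ v) + 2 wt (u ∧ v).
4∣⇒⟨,⟩≡0ℙ : (u v : Word n) → 4 ∣ wt u + wt v + 3 * wt (u ⊕ v) → ⟨ u , v ⟩ ≡ 0ℙ
4∣⇒⟨,⟩≡0ℙ u v 4∣s = trans (⟨,⟩≡parity u v) (even 2∣o)
  where
  o = wt (u ∧ v)
  regroup : ∀ s o → (s + 2 * o) + 3 * s ≡ 4 * s + 2 * o
  regroup = solve-∀
  2∣o : 2 ∣ o
  2∣o = *-cancelˡ-∣ 2 (∣m+n∣m⇒∣n
    (subst (4 ∣_) (trans (cong (_+ 3 * wt (u ⊕ v)) (wt-⊕ u v)) (regroup (wt (u ⊕ v)) o)) 4∣s)
    (m∣m*n (wt (u ⊕ v))))
  even : ∀ {o} → 2 ∣ o → parity o ≡ 0ℙ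
  even (divides q refl) = trans (ℙₚ.*-homo-* q 2) (ℙₚ.*-zeroʳ (parity q))

linComb-𝟎 : (G : Vec (Word n) k) → linComb 𝟎 G ≡ 𝟎
linComb-𝟎 []      = refl
linComb-𝟎 (g ∷ G) = trans (cong₂ _⊕_ (0· g) (linComb-𝟎 G)) (⊕-identityˡ 𝟎)

linComb-0∷ : ∀ x (g : Word n) (G : Vec (Word n) k) → linComb (0ℙ ∷ x) (g ∷ G) ≡ linComb x G
linComb-0∷ x g G = trans (cong (_⊕ linComb x G) (0· g)) (⊕-identityˡ _)

linComb-1∷ : ∀ x (g : Word n) (G : Vec (Word n) k) → linComb (1ℙ ∷ x) (g ∷ G) ≡ g ⊕ linComb x G
linComb-1∷ x g G = cong (_⊕ linComb x G) (1· g)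

linComb-∈ : (C : LinearCode n) (x : Vec 𝔽₂ k) {G : Vec (Word n) k} →
            (∀ y → linComb y G ∈ C) → ∀ {g} → g ∈ C → ∀ a → linComb (a ∷ x) (g ∷ G) ∈ C
linComb-∈ C x {G} h {g} g∈ 0ℙ = subst (_∈ C) (sym (linComb-0∷ x g G)) (h x)
linComb-∈ C x {G} h {g} g∈ 1ℙ = subst (_∈ C) (sym (linComb-1∷ x g G)) (⊕-codeword C g∈ (h x))

products : Vec (Word n) k → Word n → Vec 𝔽₂ k
products G v = map ⟨_, v ⟩ G

⟨linComb,⟩ : ∀ x (G : Vec (Word n) k) v → ⟨ linComb x G , v ⟩ ≡ ⟨ x , products G v ⟩
⟨linComb,⟩ []      []      v = ⟨,⟩-𝟎ˡ v
⟨linComb,⟩ (a ∷ x) (g ∷ G) v = trans (⟨,⟩-⊕ˡ (a · g) (linComb x G) v)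
  (cong₂ ℙ._+_ (⟨,⟩-·ˡ a g v) (⟨linComb,⟩ x G v))

products-⊕ : (G : Vec (Word n) k) (v w : Word n) → products G (v ⊕ w) ≡ products G v ⊕ products G w
products-⊕ []      v w = refl
products-⊕ (g ∷ G) v w = cong₂ _∷_ (⟨,⟩-⊕ʳ g v w) (products-⊕ G v w)

nonzero-product : (v : Word n) → v ≢ 𝟎 → ∃ λ w → ⟨ v , w ⟩ ≡ 1ℙ
nonzero-product []       v≢𝟎 = contradiction refl v≢𝟎
nonzero-product (1ℙ ∷ v) _   = 1ℙ ∷ 𝟎 , cong ℙ._⁻¹ (⟨,⟩-𝟎ʳ v)
nonzero-product (0ℙ ∷ v) v≢𝟎 with w , e ← nonzero-product v (λ e → v≢𝟎 (cong (0ℙ ∷_) e)) = 0ℙ ∷ w , e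

-- Duality without rank arguments, by induction on the rows. If neither `p` nor `g ⊕ p` lies in the
-- span of `G`, there are witnesses `v` and `w`; one of them is orthogonal to `g` as well, or else
-- `v ⊕ w` is.
fredholm : (G : Vec (Word n) k) (p : Word n) →
           (∃ λ x → linComb x G ≡ p) ⊎ (∃ λ v → products G v ≡ 𝟎 × ⟨ p , v ⟩ ≡ 1ℙ)
fredholm [] p with p ≟ʷ 𝟎
... | yes p≡𝟎 = inj₁ ([] , sym p≡𝟎)
... | no  p≢𝟎 with w , e ← nonzero-product p p≢𝟎 = inj₂ (w , refl , e)
fredholm (g ∷ G) p with fredholm G p | fredholm G (g ⊕ p)
... | inj₁ (x , e) | _ = inj₁ (0ℙ ∷ x , trans (linComb-0∷ x g G) e)
... | inj₂ _ | inj₁ (x , e) = inj₁ (1ℙ ∷ x , trans (linComb-1∷ x g G) (trans (cong (g ⊕_) e) (⊕-cancelˡ g p)))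
... | inj₂ (v , Gv , pv) | inj₂ (w , Gw , gpw) with ⟨ g , v ⟩ in gv | ⟨ g , w ⟩ in gw
... | 0ℙ | _  = inj₂ (v , cong₂ _∷_ gv Gv , pv)
... | 1ℙ | 0ℙ = inj₂ (w , cong₂ _∷_ gw Gw ,
  trans (cong (ℙ._+ ⟨ p , w ⟩) (sym gw)) (trans (sym (⟨,⟩-⊕ˡ g p w)) gpw))
... | 1ℙ | 1ℙ = inj₂ (v ⊕ w ,
  cong₂ _∷_ (trans (⟨,⟩-⊕ʳ g v w) (cong₂ ℙ._+_ gv gw))
    (trans (products-⊕ G v w) (trans (cong₂ _⊕_ Gv Gw) (⊕-self 𝟎))) ,
  trans (⟨,⟩-⊕ʳ p v w) (cong₂ ℙ._+_ pv pw))
  where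
  cancel : ∀ a → 1ℙ ℙ.+ a ≡ 1ℙ → a ≡ 0ℙ
  cancel 0ℙ _ = refl
  pw : ⟨ p , w ⟩ ≡ 0ℙ
  pw = cancel _ (trans (cong (ℙ._+ ⟨ p , w ⟩) (sym gw)) (trans (sym (⟨,⟩-⊕ˡ g p w)) gpw))

·-distribʳ : ∀ a b (v : Word n) → (a ℙ.+ b) · v ≡ a · v ⊕ b · v
·-distribʳ a b []      = refl
·-distribʳ a b (x ∷ v) = cong₂ _∷_ (ℙₚ.*-distribʳ-+ x a b) (·-distribʳ a b v)

linComb-⊕ : ∀ x y (G : Vec (Word n) k) → linComb (x ⊕ y) G ≡ linComb x G ⊕ linComb y G
linComb-⊕ []      []      []      = sym (⊕-identityˡ 𝟎)
linComb-⊕ (a ∷ x) (b ∷ y) (g ∷ G) =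
  trans (cong₂ _⊕_ (·-distribʳ a b g) (linComb-⊕ x y G))
        (⊕-interchange (a · g) (b · g) (linComb x G) (linComb y G))

-- Signs and sums over all words

sgn : 𝔽₂ → ℤ
sgn 0ℙ = 1ℤ
sgn 1ℙ = -1ℤ

sgn-+ : ∀ a b → sgn (a ℙ.+ b) ≡ sgn a ℤ.* sgn b
sgn-+ 0ℙ b  = sym (ℤ.*-identityˡ (sgn b))
sgn-+ 1ℙ 0ℙ = refl
sgn-+ 1ℙ 1ℙ = refl

sgn-⁻¹ : ∀ a → sgn (a ℙ.⁻¹) ≡ ℤ.- sgn a
sgn-⁻¹ 0ℙ = refl
sgn-⁻¹ 1ℙ = refl

∑ : (Word n → ℤ) → ℤ
∑ {zero}  f = f []
∑ {suc n} f = ∑ (λ w → f (0ℙ ∷ w)) ℤ.+ ∑ (λ w → f (1ℙ ∷ w))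

∑-cong : {f g : Word n → ℤ} → (∀ w → f w ≡ g w) → ∑ f ≡ ∑ g
∑-cong {zero}  e = e []
∑-cong {suc n} e = cong₂ ℤ._+_ (∑-cong (λ w → e (0ℙ ∷ w))) (∑-cong (λ w → e (1ℙ ∷ w)))

∑-+ : (f g : Word n → ℤ) → ∑ (λ w → f w ℤ.+ g w) ≡ ∑ f ℤ.+ ∑ g
∑-+ {zero}  f g = refl
∑-+ {suc n} f g = trans (cong₂ ℤ._+_ (∑-+ (λ w → f (0ℙ ∷ w)) _) (∑-+ (λ w → f (1ℙ ∷ w)) _))
  (medial (∑ (λ w → f (0ℙ ∷ w))) (∑ (λ w → g (0ℙ ∷ w))) (∑ (λ w → f (1ℙ ∷ w))) (∑ (λ w → g (1ℙ ∷ w))))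
  where
  medial : ∀ p q r s → (p ℤ.+ q) ℤ.+ (r ℤ.+ s) ≡ (p ℤ.+ r) ℤ.+ (q ℤ.+ s)
  medial = ℤ-solve-∀

∑-* : ∀ a (f : Word n → ℤ) → ∑ (λ w → a ℤ.* f w) ≡ a ℤ.* ∑ f
∑-* {zero}  a f = refl
∑-* {suc n} a f = trans (cong₂ ℤ._+_ (∑-* a (λ w → f (0ℙ ∷ w))) (∑-* a (λ w → f (1ℙ ∷ w))))
  (sym (ℤ.*-distribˡ-+ a _ _))

∑-neg : (f : Word n → ℤ) → ∑ (λ w → ℤ.- f w) ≡ ℤ.- ∑ f
∑-neg f = trans (∑-cong (λ w → sym (ℤ.-1*i≡-i (f w)))) (trans (∑-* -1ℤ f) (ℤ.-1*i≡-i (∑ f)))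

∑-zero : {f : Word n → ℤ} → (∀ w → f w ≡ 0ℤ) → ∑ f ≡ 0ℤ
∑-zero {zero}  e = e []
∑-zero {suc n} e = cong₂ ℤ._+_ (∑-zero (λ w → e (0ℙ ∷ w))) (∑-zero (λ w → e (1ℙ ∷ w)))

∑-single : (f : Word n → ℤ) (w : Word n) → (∀ v → v ≢ w → f v ≡ 0ℤ) → ∑ f ≡ f w
∑-single f []       _ = refl
∑-single f (0ℙ ∷ w) e = trans
  (cong₂ ℤ._+_ (∑-single (λ v → f (0ℙ ∷ v)) w (λ v v≢w → e (0ℙ ∷ v) (λ { refl → v≢w refl })))
               (∑-zero (λ v → e (1ℙ ∷ v) (λ ()))))
  (ℤ.+-identityʳ _)
∑-single f (1ℙ ∷ w) e = trans
  (cong₂ ℤ._+_ (∑-zero (λ v → e (0ℙ ∷ v) (λ ())))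
               (∑-single (λ v → f (1ℙ ∷ v)) w (λ v v≢w → e (1ℙ ∷ v) (λ { refl → v≢w refl }))))
  (ℤ.+-identityˡ _)

∑-translate : (f : Word n → ℤ) (u : Word n) → ∑ (λ w → f (u ⊕ w)) ≡ ∑ f
∑-translate f []       = refl
∑-translate f (0ℙ ∷ u) = cong₂ ℤ._+_ (∑-translate (λ w → f (0ℙ ∷ w)) u) (∑-translate (λ w → f (1ℙ ∷ w)) u)
∑-translate f (1ℙ ∷ u) = trans
  (cong₂ ℤ._+_ (∑-translate (λ w → f (1ℙ ∷ w)) u) (∑-translate (λ w → f (0ℙ ∷ w)) u))
  (ℤ.+-comm (∑ (λ w → f (1ℙ ∷ w))) _)

x≡-x⇒x≡0 : ∀ {x} → x ≡ ℤ.- x → x ≡ 0ℤ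
x≡-x⇒x≡0 {+ zero} _ = refl

-- Translation by `u` permutes the words, so the sum equals its own negative.
∑-odd : (f : Word n → ℤ) (u : Word n) → (∀ w → f (u ⊕ w) ≡ ℤ.- f w) → ∑ f ≡ 0ℤ
∑-odd f u e = x≡-x⇒x≡0 (trans (sym (∑-translate f u)) (trans (∑-cong e) (∑-neg f)))

2^suc : ∀ k → + (2 ^ k) ℤ.+ + (2 ^ k) ≡ + (2 ^ suc k)
2^suc k = cong +_ (cong (_+_ (2 ^ k)) (sym (ℕ.+-identityʳ (2 ^ k))))

∑-1 : ∀ n → ∑ {n} (λ _ → 1ℤ) ≡ + (2 ^ n)
∑-1 zero    = refl
∑-1 (suc n) = trans (cong₂ ℤ._+_ (∑-1 n) (∑-1 n)) (2^suc n)

χ : Word n → Word n → ℤ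
χ v w = sgn ⟨ w , v ⟩

χ-𝟎 : (w : Word n) → χ 𝟎 w ≡ 1ℤ
χ-𝟎 w = cong sgn (⟨,⟩-𝟎ʳ w)

χ-⊕ : (u v w : Word n) → χ (u ⊕ v) w ≡ χ u w ℤ.* χ v w
χ-⊕ u v w = trans (cong sgn (⟨,⟩-⊕ʳ w u v)) (sgn-+ ⟨ w , u ⟩ ⟨ w , v ⟩)

∑-χ : (v : Word n) → v ≢ 𝟎 → ∑ (χ v) ≡ 0ℤ
∑-χ []       v≢𝟎 = contradiction refl v≢𝟎
∑-χ (0ℙ ∷ v) v≢𝟎 = cong₂ ℤ._+_ ih ih
  where ih = ∑-χ v (λ e → v≢𝟎 (cong (0ℙ ∷_) e))
∑-χ (1ℙ ∷ v) v≢𝟎 = trans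
  (cong (ℤ._+_ (∑ (χ v))) (trans (∑-cong (λ w → sgn-⁻¹ ⟨ w , v ⟩)) (∑-neg (χ v))))
  (ℤ.+-inverseʳ (∑ (χ v)))

-- Polynomials of bounded degree in the signs of the coordinates

data Deg {n} (d : ℕ) : (Word n → ℤ) → Set where
  -- The product of the signs at the support of `v`, a monomial of degree `wt v`.
  char  : ∀ v → wt v ≤ d → Deg d (χ v)
  scale : ∀ a {f} → Deg d f → Deg d (λ w → a ℤ.* f w)
  plus  : ∀ {f g} → Deg d f → Deg d g → Deg d (λ w → f w ℤ.+ g w)
  ext   : ∀ {f g} → (∀ w → f w ≡ g w) → Deg d f → Deg d g

deg-≤ : ∀ {d e} {f : Word n → ℤ} → d ≤ e → Deg d f → Deg e f
deg-≤ d≤e (char v l)  = char v (ℕ.≤-trans l d≤e)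
deg-≤ d≤e (scale a p) = scale a (deg-≤ d≤e p)
deg-≤ d≤e (plus p q)  = plus (deg-≤ d≤e p) (deg-≤ d≤e q)
deg-≤ d≤e (ext e p)   = ext e (deg-≤ d≤e p)

deg-const : ∀ {d} a → Deg {n} d (λ _ → a)
deg-const {n} a = ext (λ w → trans (cong (a ℤ.*_) (χ-𝟎 w)) (ℤ.*-identityʳ a))
  (scale a (char 𝟎 (ℕ.≤-trans (ℕ.≤-reflexive (wt-𝟎 n)) z≤n)))

-- Signs square to 1, so the product of two monomials is the monomial of the symmetric difference of
-- their supports.
deg-χ* : ∀ {d e} (v : Word n) → wt v ≤ d → {g : Word n → ℤ} → Deg e g → Deg (d + e) (λ w → χ v w ℤ.* g w)
deg-χ* v l (char u l′) = ext (χ-⊕ v u) (char (v ⊕ u) (ℕ.≤-trans (wt-⊕-≤ v u) (ℕ.+-mono-≤ l l′)))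
deg-χ* v l (scale a {g} q) = ext (λ w → swap a (χ v w) (g w)) (scale a (deg-χ* v l q))
  where
  swap : ∀ a b c → a ℤ.* (b ℤ.* c) ≡ b ℤ.* (a ℤ.* c)
  swap = ℤ-solve-∀
deg-χ* v l (plus {g} {h} q r) = ext (λ w → sym (ℤ.*-distribˡ-+ (χ v w) (g w) (h w)))
  (plus (deg-χ* v l q) (deg-χ* v l r))
deg-χ* v l (ext e q) = ext (λ w → cong (χ v w ℤ.*_) (e w)) (deg-χ* v l q)

deg-* : ∀ {d e} {f g : Word n → ℤ} → Deg d f → Deg e g → Deg (d + e) (λ w → f w ℤ.* g w)
deg-* (char v l) q = deg-χ* v l q
deg-* {g = g} (scale a {f} p) q = ext (λ w → sym (ℤ.*-assoc a (f w) (g w))) (scale a (deg-* p q))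
deg-* {g = g} (plus {f} {f′} p p′) q = ext (λ w → sym (ℤ.*-distribʳ-+ (g w) (f w) (f′ w)))
  (plus (deg-* p q) (deg-* p′ q))
deg-* {g = g} (ext e p) q = ext (λ w → cong (ℤ._* g w) (e w)) (deg-* p q)

deg-- : ∀ {d} {f g : Word n → ℤ} → Deg d f → Deg d g → Deg d (λ w → f w ℤ.- g w)
deg-- {f = f} {g} p q = ext (λ w → cong (ℤ._+_ (f w)) (ℤ.-1*i≡-i (g w))) (plus p (scale -1ℤ q))

deg-tail : ∀ {d} {f : Word n → ℤ} → Deg d f → Deg d (λ w → f (tail w))
deg-tail (char v l)  = ext (λ { (0ℙ ∷ w) → refl ; (1ℙ ∷ w) → refl }) (char (0ℙ ∷ v) l)
deg-tail (scale a p) = scale a (deg-tail p)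
deg-tail (plus p q)  = plus (deg-tail p) (deg-tail q)
deg-tail (ext e p)   = ext (λ w → e (tail w)) (deg-tail p)

-- By linearity one character suffices. The trivial one counts words on either side. Any other of
-- weight at most `d` sums to 0 over all words, and also over the code, where it becomes the
-- character of the nonzero vector `products G v` on the coefficients.
transfer : (G : Vec (Word n) k) {d : ℕ} → (∀ v → wt v ≤ d → v ≢ 𝟎 → products G v ≢ 𝟎) →
           {f : Word n → ℤ} → Deg d f →
           + (2 ^ n) ℤ.* ∑ (λ x → f (linComb x G)) ≡ + (2 ^ k) ℤ.* ∑ f
transfer {n} {k} G h (char v l) with v ≟ʷ 𝟎
... | yes refl = trans
  (cong (+ (2 ^ n) ℤ.*_) (trans (∑-cong (λ x → χ-𝟎 (linComb x G))) (∑-1 k)))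
  (trans (ℤ.*-comm (+ (2 ^ n)) (+ (2 ^ k)))
    (cong (+ (2 ^ k) ℤ.*_) (sym (trans (∑-cong {n} {χ 𝟎} χ-𝟎) (∑-1 n)))))
... | no v≢𝟎 = trans
  (cong (+ (2 ^ n) ℤ.*_) (trans (∑-cong (λ x → cong sgn (⟨linComb,⟩ x G v)))
                                (∑-χ (products G v) (h v l v≢𝟎))))
  (trans (ℤ.*-zeroʳ (+ (2 ^ n))) (sym (trans (cong (+ (2 ^ k) ℤ.*_) (∑-χ v v≢𝟎)) (ℤ.*-zeroʳ (+ (2 ^ k))))))
transfer {n} {k} G h (scale a {f} p) = trans
  (cong (+ (2 ^ n) ℤ.*_) (∑-* a (λ x → f (linComb x G))))
  (trans (swap (+ (2 ^ n)) a _) (trans (cong (a ℤ.*_) (transfer G h p))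
    (trans (swap a (+ (2 ^ k)) (∑ f)) (cong (+ (2 ^ k) ℤ.*_) (sym (∑-* a f))))))
  where
  swap : ∀ a b c → a ℤ.* (b ℤ.* c) ≡ b ℤ.* (a ℤ.* c)
  swap = ℤ-solve-∀
transfer {n} {k} G h (plus {f} {g} p q) = trans
  (cong (+ (2 ^ n) ℤ.*_) (∑-+ (λ x → f (linComb x G)) (λ x → g (linComb x G))))
  (trans (ℤ.*-distribˡ-+ (+ (2 ^ n)) _ _) (trans (cong₂ ℤ._+_ (transfer G h p) (transfer G h q))
    (trans (sym (ℤ.*-distribˡ-+ (+ (2 ^ k)) _ _)) (cong (+ (2 ^ k) ℤ.*_) (sym (∑-+ f g))))))
transfer {n} {k} G h (ext {f} e p) = trans
  (cong (+ (2 ^ n) ℤ.*_) (∑-cong (λ x → sym (e (linComb x G)))))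
  (trans (transfer G h p) (cong (+ (2 ^ k) ℤ.*_) (∑-cong e)))

-- The weight as a polynomial of degree one, and codes of strength 7

X : Word n → ℤ
X []      = 0ℤ
X (a ∷ w) = sgn a ℤ.+ X w

δ₀ : Word (suc n)
δ₀ = 1ℙ ∷ 𝟎

χ-δ₀ : ∀ a (w : Word n) → χ δ₀ (a ∷ w) ≡ sgn a
χ-δ₀ a w = cong sgn (trans (cong₂ ℙ._+_ (ℙₚ.*-identityʳ a) (⟨,⟩-𝟎ʳ w)) (ℙₚ.+-identityʳ a))

deg-X : Deg {n} 1 X
deg-X {zero}  = ext (λ { [] → refl }) (deg-const 0ℤ)
deg-X {suc n} = ext (λ { (a ∷ w) → cong (ℤ._+ X w) (χ-δ₀ a w) })
  (plus (char δ₀ (s≤s (ℕ.≤-reflexive (wt-𝟎 n)))) (deg-tail deg-X))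

X≡ : (w : Word n) → X w ≡ + n ℤ.- + (2 * wt w)
X≡ []       = refl
X≡ {suc n} (0ℙ ∷ w) = trans (cong (ℤ._+_ 1ℤ) (X≡ w)) (sym (ℤ.+-assoc 1ℤ (+ n) (ℤ.- + (2 * wt w))))
X≡ {suc n} (1ℙ ∷ w) = trans (cong (ℤ._+_ -1ℤ) (X≡ w)) (trans (shift (+ n) (+ (2 * wt w)))
  (cong (λ t → + suc n ℤ.- + t) (sym (ℕ.*-suc 2 (wt w)))))
  where
  shift : ∀ a b → -1ℤ ℤ.+ (a ℤ.- b) ≡ (1ℤ ℤ.+ a) ℤ.- (+ 2 ℤ.+ b)
  shift = ℤ-solve-∀

-- Dual distance at least 8 makes the code an orthogonal array of strength 7: on any seven
-- coordinates all values occur equally often.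
record OA₇ (C : LinearCode n) (k : ℕ) : Set where
  field
    G      : Vec (Word n) k
    indep  : LinearlyIndependent G
    span   : ∀ v → v ∈ C ⇔ v ∈ rowSpace G
    dual≥8 : ∀ {v} → v ∈ C ⊥ → v ≢ 𝟎 → 8 ≤ wt v

  linComb-codeword : ∀ x → linComb x G ∈ C
  linComb-codeword x = Equivalence.from (span _) (x , refl)

  dual : ∀ v → products G v ≡ 𝟎 → v ∈ C ⊥
  dual v e c∈C with x , refl ← Equivalence.to (span _) c∈C =
    trans (⟨linComb,⟩ x G v) (trans (cong ⟨ x ,_⟩ e) (⟨,⟩-𝟎ʳ x))

  nonorthogonal : ∀ v → wt v ≤ 7 → v ≢ 𝟎 → products G v ≢ 𝟎
  nonorthogonal v l v≢𝟎 e = ℕ.<-irrefl refl (ℕ.≤-trans (dual≥8 (dual v e) v≢𝟎) l)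

  linComb-injective : ∀ x y → linComb x G ≡ linComb y G → x ≡ y
  linComb-injective x y e = ⊕≡𝟎⇒≡ x y (indep (x ⊕ y)
    (trans (linComb-⊕ x y G) (trans (cong (_⊕ linComb y G) e) (⊕-self _))))

  -- This is how strength 7 is exploited: for a polynomial that singles out one codeword, its value
  -- there determines its average over all words.
  sum-single : ∀ {f v} → Deg 7 f → v ∈ C → (∀ {c} → c ∈ C → c ≢ v → f c ≡ 0ℤ) →
               + (2 ^ n) ℤ.* f v ≡ + (2 ^ k) ℤ.* ∑ f
  sum-single {f} p v∈C z with y , refl ← Equivalence.to (span _) v∈C =
    trans (cong (+ (2 ^ n) ℤ.*_) (sym (∑-single (λ x → f (linComb x G)) y
      (λ x x≢y → z (linComb-codeword x) (x≢y ∘ linComb-injective x y)))))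
      (transfer G nonorthogonal p)

2^≢0 : ∀ n → + (2 ^ n) ≢ 0ℤ
2^≢0 n e = ℕ.≢-nonZero⁻¹ (2 ^ n) {{ℕ.m^n≢0 2 n}} (ℤ.+-injective e)

*-≢0 : ∀ {a b} → a ≢ 0ℤ → b ≢ 0ℤ → a ℤ.* b ≢ 0ℤ
*-≢0 {a} a≢0 b≢0 e with ℤ.i*j≡0⇒i≡0∨j≡0 a e
... | inj₁ a≡0 = a≢0 a≡0
... | inj₂ b≡0 = b≢0 b≡0

-- Unit words and indicators of covering words

δ : Fin n → Word n
δ zero    = δ₀
δ (suc i) = 0ℙ ∷ δ i

wt-δ : (i : Fin n) → wt (δ i) ≡ 1
wt-δ {suc n} zero    = cong suc (wt-𝟎 n)
wt-δ (suc i) = wt-δ i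

wt≡1⇒≡δ : (v : Word n) → wt v ≡ 1 → ∃ λ i → v ≡ δ i
wt≡1⇒≡δ (1ℙ ∷ v) e = zero , cong (1ℙ ∷_) (wt≡0⇒≡𝟎 v (ℕ.suc-injective e))
wt≡1⇒≡δ (0ℙ ∷ v) e with i , v≡δ ← wt≡1⇒≡δ v e = suc i , cong (0ℙ ∷_) v≡δ

⟨,δ⟩ : (w : Word n) (i : Fin n) → ⟨ w , δ i ⟩ ≡ lookup w i
⟨,δ⟩ (a ∷ w) zero    = trans (cong₂ ℙ._+_ (ℙₚ.*-identityʳ a) (⟨,⟩-𝟎ʳ w)) (ℙₚ.+-identityʳ a)
⟨,δ⟩ (a ∷ w) (suc i) = cong₂ ℙ._+_ (ℙₚ.*-zeroʳ a) (⟨,δ⟩ w i)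

lookup-⊕ : (v w : Word n) (i : Fin n) → lookup (v ⊕ w) i ≡ lookup v i ℙ.+ lookup w i
lookup-⊕ v w i = lookup-zipWith ℙ._+_ i v w

lookup-𝟎 : (i : Fin n) → lookup 𝟎 i ≡ 0ℙ
lookup-𝟎 i = lookup-replicate i 0ℙ

lookup-δ : (i : Fin n) → lookup (δ i) i ≡ 1ℙ
lookup-δ zero    = refl
lookup-δ (suc i) = lookup-δ i

lookup-δ≡1 : (i j : Fin n) → lookup (δ i) j ≡ 1ℙ → i ≡ j
lookup-δ≡1 zero    zero    e = refl
lookup-δ≡1 zero    (suc j) e with () ← trans (sym (lookup-𝟎 j)) e
lookup-δ≡1 (suc i) (suc j) e = cong suc (lookup-δ≡1 i j e)

lookup-δ-≢ : (i j : Fin n) → i ≢ j → lookup (δ i) j ≡ 0ℙ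
lookup-δ-≢ i j i≢j with lookup (δ i) j in e
... | 0ℙ = refl
... | 1ℙ = contradiction (lookup-δ≡1 i j e) i≢j

X-δ⊕ : (i : Fin n) (w : Word n) → X (δ i ⊕ w) ≡ X w ℤ.- + 2 ℤ.* sgn (lookup w i)
X-δ⊕ zero (a ∷ w) = trans (cong₂ ℤ._+_ (sgn-⁻¹ a) (cong X (⊕-identityˡ w))) (flip (sgn a) (X w))
  where
  flip : ∀ a x → ℤ.- a ℤ.+ x ≡ (a ℤ.+ x) ℤ.- + 2 ℤ.* a
  flip = ℤ-solve-∀
X-δ⊕ (suc i) (a ∷ w) = trans (cong (ℤ._+_ (sgn a)) (X-δ⊕ i w))
  (sym (ℤ.+-assoc (sgn a) (X w) (ℤ.- (+ 2 ℤ.* sgn (lookup w i)))))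

deg-sgn : (i : Fin n) → Deg 1 (λ w → sgn (lookup w i))
deg-sgn i = ext (λ w → cong sgn (⟨,δ⟩ w i)) (char (δ i) (ℕ.≤-reflexive (wt-δ i)))

-- Up to the factor 2^(wt s), the indicator of the words whose support contains that of `s`.
mono : Word n → Word n → ℤ
mono []       []      = 1ℤ
mono (0ℙ ∷ s) (a ∷ w) = mono s w
mono (1ℙ ∷ s) (a ∷ w) = (1ℤ ℤ.- sgn a) ℤ.* mono s w

deg-mono : (s : Word n) → Deg (wt s) (mono s)
deg-mono []       = ext (λ { [] → refl }) (deg-const 1ℤ)
deg-mono (0ℙ ∷ s) = ext (λ { (a ∷ w) → refl }) (deg-tail (deg-mono s))
deg-mono (1ℙ ∷ s) = ext (λ { (a ∷ w) → refl })
  (deg-* (deg-- (deg-const 1ℤ) (deg-sgn zero)) (deg-tail (deg-mono s)))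

mono-vanishes : (s w : Word n) → s ∧ w ≢ s → mono s w ≡ 0ℤ
mono-vanishes []       []       e = contradiction refl e
mono-vanishes (0ℙ ∷ s) (a ∷ w)  e = mono-vanishes s w (e ∘ cong (0ℙ ∷_))
mono-vanishes (1ℙ ∷ s) (0ℙ ∷ w) e = refl
mono-vanishes (1ℙ ∷ s) (1ℙ ∷ w) e =
  trans (cong (+ 2 ℤ.*_) (mono-vanishes s w (e ∘ cong (1ℙ ∷_)))) refl

mono≢0 : (s w : Word n) → s ∧ w ≡ s → mono s w ≢ 0ℤ
mono≢0 []       []       e = λ ()
mono≢0 (0ℙ ∷ s) (a ∷ w)  e = mono≢0 s w (cong tail e)
mono≢0 (1ℙ ∷ s) (0ℙ ∷ w) ()
mono≢0 (1ℙ ∷ s) (1ℙ ∷ w) e = *-≢0 {+ 2} (λ ()) (mono≢0 s w (cong tail e))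

mono-⊕ : (s u w : Word n) → s ∧ u ≡ 𝟎 → mono s (u ⊕ w) ≡ mono s w
mono-⊕ []       []       []      e = refl
mono-⊕ (0ℙ ∷ s) (a ∷ u)  (b ∷ w) e = mono-⊕ s u w (cong tail e)
mono-⊕ (1ℙ ∷ s) (0ℙ ∷ u) (b ∷ w) e = cong ((1ℤ ℤ.- sgn b) ℤ.*_) (mono-⊕ s u w (cong tail e))

∧δ≡𝟎 : (s : Word n) (i : Fin n) → lookup s i ≡ 0ℙ → s ∧ δ i ≡ 𝟎
∧δ≡𝟎 (0ℙ ∷ s) zero    e = cong (0ℙ ∷_) (∧𝟎 s)
  where
  ∧𝟎 : (s : Word n) → s ∧ 𝟎 ≡ 𝟎
  ∧𝟎 []      = refl
  ∧𝟎 (a ∷ s) = cong₂ _∷_ (ℙₚ.*-zeroʳ a) (∧𝟎 s)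
∧δ≡𝟎 (a ∷ s)  (suc i) e = cong₂ _∷_ (ℙₚ.*-zeroʳ a) (∧δ≡𝟎 s i e)





-- Polynomials annihilating given weights

X-value : ℕ → ℕ → ℤ
X-value n u = + n ℤ.- + (2 * u)

killer : List ℕ → Word n → ℤ
killer []       w = 1ℤ
killer {n} (u ∷ us) w = (X w ℤ.- X-value n u) ℤ.* killer us w

deg-killer : ∀ us → Deg {n} (length us) (killer us)
deg-killer []       = deg-const 1ℤ
deg-killer (u ∷ us) = deg-* (deg-- deg-X (deg-const _)) (deg-killer us)

killer-cong : ∀ us (v w : Word n) → X v ≡ X w → killer us v ≡ killer us w
killer-cong []       v w e = refl
killer-cong (u ∷ us) v w e = cong₂ (λ x y → (x ℤ.- _) ℤ.* y) e (killer-cong us v w e)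

killer-vanishes : ∀ {us} (w : Word n) → wt w ∈ᴸ us → killer us w ≡ 0ℤ
killer-vanishes {us = u ∷ us} w (here refl) =
  cong (ℤ._* killer us w) (ℤ.i≡j⇒i-j≡0 (X≡ w))
killer-vanishes {us = u ∷ us} w (there p) =
  trans (cong ((X w ℤ.- X-value _ u) ℤ.*_) (killer-vanishes w p)) (ℤ.*-zeroʳ (X w ℤ.- X-value _ u))

X-value-injective : ∀ n {u v} → X-value n u ≡ X-value n v → u ≡ v
X-value-injective n e = ℕ.*-cancelˡ-≡ _ _ 2
  (ℤ.+-injective (ℤ.neg-injective (ℤ-+-cancelˡ (+ n) _ _ e)))

killer≢0 : ∀ us (w : Word n) → wt w ∉ᴸ us → killer us w ≢ 0ℤ
killer≢0 []       w u∉ ()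
killer≢0 {n} (u ∷ us) w u∉ = *-≢0
  (λ e → u∉ (here (X-value-injective n (trans (sym (X≡ w)) (ℤ.i-j≡0⇒i≡j (X w) _ e)))))
  (killer≢0 us w (u∉ ∘ there))

-- Codewords of weight at most 4

𝟏-or : (c : Word n) → wt c ≡ n → c ≡ 𝟏
𝟏-or {n} c e = sym (⊕≡𝟎⇒≡ 𝟏 c (wt≡0⇒≡𝟎 (𝟏 ⊕ c)
  (ℕ.m+n≡0⇒m≡0 _ {0} (trans (ℕ.+-identityʳ _) (ℕ.+-cancelʳ-≡ n (wt (𝟏 ⊕ c)) 0
    (trans (cong (_+_ (wt (𝟏 ⊕ c))) (sym e)) (wt-complement c)))))))

-- The factors of `h` below force a word to differ at `i` and `j`, to cover `v` outside `i`, and to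
-- avoid the weights in `us`. Among codewords only `v` does all three, yet `h` has degree at most 7
-- and sums to 0. The word `b` excludes the codeword that would arise from `v` by moving its one at
-- `i` to `j`.
module _ {C : LinearCode n} (A : OA₇ C k) {v b : Word n} (v∈C : v ∈ C) (b∈C⊥ : b ∈ C ⊥)
         {i j : Fin n} (vᵢ : lookup v i ≡ 1ℙ) (vⱼ : lookup v j ≡ 0ℙ) (bᵢ≢bⱼ : lookup b i ≢ lookup b j)
         (us : List ℕ) (degree : wt v + length us ≤ 7) (wtv∉us : wt v ∉ᴸ us)
         (others : ∀ {c} → c ∈ C → wt c ≢ 0 → wt c ≢ n → wt c ≢ wt v → wt c ∈ᴸ us) where

  private
    open OA₇ A

    s : Word n
    s = v ⊕ δ i

    i≢j : i ≢ j
    i≢j refl with () ← trans (sym vᵢ) vⱼ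

    sᵢ : lookup s i ≡ 0ℙ
    sᵢ = trans (lookup-⊕ v (δ i) i) (cong₂ ℙ._+_ vᵢ (lookup-δ i))

    sⱼ : lookup s j ≡ 0ℙ
    sⱼ = trans (lookup-⊕ v (δ i) j) (cong₂ ℙ._+_ vⱼ (lookup-δ-≢ i j i≢j))

    s⊕δ : s ⊕ δ i ≡ v
    s⊕δ = trans (⊕-assoc v (δ i) (δ i)) (trans (cong (v ⊕_) (⊕-self (δ i))) (⊕-identityʳ v))

    wt-v : wt v ≡ suc (wt s)
    wt-v = begin
      wt v                                ≡⟨ cong wt (sym s⊕δ) ⟩
      wt (s ⊕ δ i)                        ≡⟨ sym (ℕ.+-identityʳ _) ⟩
      wt (s ⊕ δ i) + 2 * 0                ≡⟨ cong (λ t → wt (s ⊕ δ i) + 2 * t)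
                                               (sym (trans (cong wt (∧δ≡𝟎 s i sᵢ)) (wt-𝟎 n))) ⟩
      wt (s ⊕ δ i) + 2 * wt (s ∧ δ i)     ≡⟨ sym (wt-⊕ s (δ i)) ⟩
      wt s + wt (δ i)                     ≡⟨ cong (_+_ (wt s)) (wt-δ i) ⟩
      wt s + 1                            ≡⟨ ℕ.+-comm (wt s) 1 ⟩
      suc (wt s)                          ∎
      where open ≡-Reasoning

    -- Exchanging the coordinates i and j where they differ negates h.
    h : Word n → ℤ
    h w = (sgn (lookup w j) ℤ.- sgn (lookup w i)) ℤ.* (mono s w ℤ.* killer us w)

    deg-h : Deg 7 h
    deg-h = deg-≤ (subst (λ t → t + length us ≤ 7) wt-v degree)
      (deg-* (deg-- (deg-sgn j) (deg-sgn i)) (deg-* (deg-mono s) (deg-killer us)))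

    -- If the entries at `i` and `j` agree, both sides are 0; otherwise flipping both exchanges them
    -- and preserves the weight.
    odd : ∀ w → h (δ i ⊕ (δ j ⊕ w)) ≡ ℤ.- h w
    odd w = by-cases (lookup w i) (lookup w j) refl refl
      where
      u = δ i ⊕ (δ j ⊕ w)
      uᵢ : lookup u i ≡ lookup w i ℙ.⁻¹
      uᵢ = trans (lookup-⊕ (δ i) _ i) (cong₂ ℙ._+_ (lookup-δ i)
        (trans (lookup-⊕ (δ j) w i) (cong (ℙ._+ lookup w i) (lookup-δ-≢ j i (i≢j ∘ sym)))))
      uⱼ : lookup u j ≡ lookup w j ℙ.⁻¹
      uⱼ = trans (lookup-⊕ (δ i) _ j) (cong₂ ℙ._+_ (lookup-δ-≢ i j i≢j)
        (trans (lookup-⊕ (δ j) w j) (cong (ℙ._+ lookup w j) (lookup-δ j))))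
      mono-u : mono s u ≡ mono s w
      mono-u = trans (mono-⊕ s (δ i) _ (∧δ≡𝟎 s i sᵢ)) (mono-⊕ s (δ j) w (∧δ≡𝟎 s j sⱼ))
      X-u : X u ≡ X w ℤ.- + 2 ℤ.* sgn (lookup w j) ℤ.- + 2 ℤ.* sgn (lookup w i)
      X-u = trans (X-δ⊕ i _) (cong₂ (λ x a → x ℤ.- + 2 ℤ.* sgn a) (X-δ⊕ j w)
        (trans (lookup-⊕ (δ j) w i) (cong (ℙ._+ lookup w i) (lookup-δ-≢ j i (i≢j ∘ sym)))))
      flip : ∀ a b {p q} → p ≡ q → (a ℤ.- b) ℤ.* p ≡ ℤ.- ((b ℤ.- a) ℤ.* q)
      flip a b {p} refl = lemma a b p
        where
        lemma : ∀ a b p → (a ℤ.- b) ℤ.* p ≡ ℤ.- ((b ℤ.- a) ℤ.* p)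
        lemma = ℤ-solve-∀
      same : X w ℤ.- + 2 ℤ.* sgn (lookup w j) ℤ.- + 2 ℤ.* sgn (lookup w i) ≡ X w →
             mono s u ℤ.* killer us u ≡ mono s w ℤ.* killer us w
      same e = cong₂ ℤ._*_ mono-u (killer-cong us u w (trans X-u e))
      by-cases : ∀ a b → lookup w i ≡ a → lookup w j ≡ b → h u ≡ ℤ.- h w
      by-cases 0ℙ 0ℙ eᵢ eⱼ rewrite uᵢ | uⱼ | eᵢ | eⱼ = refl
      by-cases 1ℙ 1ℙ eᵢ eⱼ rewrite uᵢ | uⱼ | eᵢ | eⱼ = refl
      by-cases 0ℙ 1ℙ eᵢ eⱼ = trans
        (cong₂ (λ a b → (sgn b ℤ.- sgn a) ℤ.* (mono s u ℤ.* killer us u)) (trans uᵢ (cong ℙ._⁻¹ eᵢ)) (trans uⱼ (cong ℙ._⁻¹ eⱼ)))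
        (trans (flip 1ℤ -1ℤ (same (trans (cong₂ (λ a b → X w ℤ.- + 2 ℤ.* sgn b ℤ.- + 2 ℤ.* sgn a) eᵢ eⱼ) (lemma (X w)))))
          (sym (cong₂ (λ a b → ℤ.- ((sgn b ℤ.- sgn a) ℤ.* (mono s w ℤ.* killer us w))) eᵢ eⱼ)))
        where
        lemma : ∀ x → x ℤ.- + 2 ℤ.* -1ℤ ℤ.- + 2 ℤ.* 1ℤ ≡ x
        lemma = ℤ-solve-∀
      by-cases 1ℙ 0ℙ eᵢ eⱼ = trans
        (cong₂ (λ a b → (sgn b ℤ.- sgn a) ℤ.* (mono s u ℤ.* killer us u)) (trans uᵢ (cong ℙ._⁻¹ eᵢ)) (trans uⱼ (cong ℙ._⁻¹ eⱼ)))
        (trans (flip -1ℤ 1ℤ (same (trans (cong₂ (λ a b → X w ℤ.- + 2 ℤ.* sgn b ℤ.- + 2 ℤ.* sgn a) eᵢ eⱼ) (lemma (X w)))))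
          (sym (cong₂ (λ a b → ℤ.- ((sgn b ℤ.- sgn a) ℤ.* (mono s w ℤ.* killer us w))) eᵢ eⱼ)))
        where
        lemma : ∀ x → x ℤ.- + 2 ℤ.* 1ℤ ℤ.- + 2 ℤ.* -1ℤ ≡ x
        lemma = ℤ-solve-∀

    ∑h≡0 : ∑ h ≡ 0ℤ
    ∑h≡0 = ∑-odd h (δ i ⊕ δ j) (λ w → trans (cong h (⊕-assoc (δ i) (δ j) w)) (odd w))

    ends-agree : ∀ {c : Word n} a → c ≡ Data.Vec.Base.replicate n a → lookup c i ≡ lookup c j
    ends-agree a refl = trans (lookup-replicate i a) (sym (lookup-replicate j a))

    -- A word of weight `suc (wt s)` covering `s` is `s` with one more point `l`. The point `i`
    -- gives `v`; the point `j` would put `δ i ⊕ δ j` into the code, against `b`; any other leaves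
    -- the entries at `i` and `j` both 0.
    only-v : ∀ {c} → c ∈ C → lookup c i ≢ lookup c j → s ∧ c ≡ s → wt c ≡ wt v → c ≡ v
    only-v {c} c∈C cᵢ≢cⱼ s∧c≡s e = at-δ (wt≡1⇒≡δ (s ⊕ c) (ℕ.+-cancelʳ-≡ (2 * wt s) _ _ (begin
      wt (s ⊕ c) + 2 * wt s        ≡⟨ cong (λ t → wt (s ⊕ c) + 2 * wt t) (sym s∧c≡s) ⟩
      wt (s ⊕ c) + 2 * wt (s ∧ c)  ≡⟨ sym (wt-⊕ s c) ⟩
      wt s + wt c                  ≡⟨ cong (_+_ (wt s)) (trans e wt-v) ⟩
      wt s + suc (wt s)            ≡⟨ ℕ.+-suc (wt s) (wt s) ⟩
      1 + (wt s + wt s)            ≡⟨ cong (λ t → 1 + (wt s + t)) (sym (ℕ.+-identityʳ (wt s))) ⟩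
      1 + 2 * wt s                 ∎)))
      where
      open ≡-Reasoning
      at-δ : (∃ λ l → s ⊕ c ≡ δ l) → c ≡ v
      at-δ (l , e) with l Fin.≟ i | l Fin.≟ j
      ... | yes refl | _ = trans c≡ s⊕δ
        where
        c≡ : c ≡ s ⊕ δ l
        c≡ = trans (sym (⊕-cancelˡ s c)) (cong (s ⊕_) e)
      ... | no _ | yes refl = contradiction b-sum bᵢ≢bⱼ
        where
        δδ∈C : δ i ⊕ δ l ∈ C
        δδ∈C = subst (_∈ C) (begin
          v ⊕ c                    ≡⟨ cong₂ _⊕_ (sym s⊕δ) (trans (sym (⊕-cancelˡ s c)) (cong (s ⊕_) e)) ⟩
          (s ⊕ δ i) ⊕ (s ⊕ δ l)    ≡⟨ ⊕-interchange s (δ i) s (δ l) ⟩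
          (s ⊕ s) ⊕ (δ i ⊕ δ l)    ≡⟨ cong (_⊕ (δ i ⊕ δ l)) (⊕-self s) ⟩
          𝟎 ⊕ (δ i ⊕ δ l)          ≡⟨ ⊕-identityˡ _ ⟩
          δ i ⊕ δ l                ∎) (⊕-codeword C v∈C c∈C)
        eq : ∀ a b → a ℙ.+ b ≡ 0ℙ → a ≡ b
        eq 0ℙ b e = sym e
        eq 1ℙ 1ℙ e = refl
        b-sum : lookup b i ≡ lookup b l
        b-sum = eq _ _ (begin
          lookup b i ℙ.+ lookup b l            ≡⟨ cong₂ ℙ._+_ (sym (⟨,δ⟩ b i)) (sym (⟨,δ⟩ b l)) ⟩
          ⟨ b , δ i ⟩ ℙ.+ ⟨ b , δ l ⟩          ≡⟨ sym (⟨,⟩-⊕ʳ b (δ i) (δ l)) ⟩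
          ⟨ b , δ i ⊕ δ l ⟩                    ≡⟨ ⟨,⟩-comm b _ ⟩
          ⟨ δ i ⊕ δ l , b ⟩                    ≡⟨ b∈C⊥ δδ∈C ⟩
          0ℙ                                   ∎)
      ... | no l≢i | no l≢j = contradiction (trans (agree i sᵢ l≢i) (sym (agree j sⱼ l≢j))) cᵢ≢cⱼ
        where
        agree : ∀ m → lookup s m ≡ 0ℙ → l ≢ m → lookup c m ≡ 0ℙ
        agree m sₘ l≢m = begin
          lookup c m                    ≡⟨ cong (ℙ._+ lookup c m) (sym sₘ) ⟩
          lookup s m ℙ.+ lookup c m     ≡⟨ sym (lookup-⊕ s c m) ⟩
          lookup (s ⊕ c) m              ≡⟨ cong (λ t → lookup t m) e ⟩
          lookup (δ l) m                ≡⟨ lookup-δ-≢ l m l≢m ⟩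
          0ℙ                            ∎

    h-vanishes : ∀ {c} → c ∈ C → c ≢ v → h c ≡ 0ℤ
    h-vanishes {c} c∈C c≢v with lookup c i ℙₚ.≟ lookup c j
    ... | yes e = cong (ℤ._* (mono s c ℤ.* killer us c))
                    (ℤ.i≡j⇒i-j≡0 (cong sgn (sym e)))
    ... | no cᵢ≢cⱼ = trans (cong ((sgn (lookup c j) ℤ.- sgn (lookup c i)) ℤ.*_) product≡0) (ℤ.*-zeroʳ (sgn (lookup c j) ℤ.- sgn (lookup c i)))
      where
      product≡0 : mono s c ℤ.* killer us c ≡ 0ℤ
      product≡0 with (s ∧ c) ≟ʷ s
      ... | no  s∧c≢s = cong (ℤ._* killer us c) (mono-vanishes s c s∧c≢s)
      ... | yes s∧c≡s = trans (cong (mono s c ℤ.*_) (killer-vanishes c (others c∈C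
              (λ e → cᵢ≢cⱼ (ends-agree 0ℙ (wt≡0⇒≡𝟎 c e)))
              (λ e → cᵢ≢cⱼ (ends-agree 1ℙ (𝟏-or c e)))
              (λ e → c≢v (only-v c∈C cᵢ≢cⱼ s∧c≡s e)))))
            (ℤ.*-zeroʳ (mono s c))

    s∧v : s ∧ v ≡ s
    s∧v = trans (cong (s ∧_) (sym s⊕δ)) (absorb s (δ i) (∧δ≡𝟎 s i sᵢ))
      where
      absorb : ∀ {n} (s d : Word n) → s ∧ d ≡ 𝟎 → s ∧ (s ⊕ d) ≡ s
      absorb []       []       e = refl
      absorb (0ℙ ∷ s) (a ∷ d)  e = cong (0ℙ ∷_) (absorb s d (cong tail e))
      absorb (1ℙ ∷ s) (0ℙ ∷ d) e = cong (1ℙ ∷_) (absorb s d (cong tail e))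

    h≢0 : h v ≢ 0ℤ
    h≢0 rewrite vᵢ | vⱼ = *-≢0 {+ 2} (λ ()) (*-≢0 (mono≢0 s v s∧v) (killer≢0 us v wtv∉us))

  low-weight-absurd : False
  low-weight-absurd = *-≢0 (2^≢0 n) h≢0
    (trans (sum-single deg-h v∈C h-vanishes) (trans (cong (+ (2 ^ k) ℤ.*_) ∑h≡0) (ℤ.*-zeroʳ (+ (2 ^ k)))))

-- Moments of the sum of the signs

∑X : ∀ n → (ℤ → ℤ) → ℤ
∑X n f = ∑ {n} (λ w → f (X w))

∑X-cong : ∀ n {f g : ℤ → ℤ} → (∀ x → f x ≡ g x) → ∑X n f ≡ ∑X n g
∑X-cong n e = ∑-cong {n} (λ w → e (X w))

∑X-suc : ∀ n f → ∑X (suc n) f ≡ ∑X n (λ x → f (1ℤ ℤ.+ x) ℤ.+ f (-1ℤ ℤ.+ x))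
∑X-suc n f = sym (∑-+ {n} (λ w → f (1ℤ ℤ.+ X w)) (λ w → f (-1ℤ ℤ.+ X w)))

∑X-linear : ∀ n a f g → ∑X n (λ x → a ℤ.* f x ℤ.+ g x) ≡ a ℤ.* ∑X n f ℤ.+ ∑X n g
∑X-linear n a f g = trans (∑-+ {n} (λ w → a ℤ.* f (X w)) (λ w → g (X w)))
  (cong (ℤ._+ ∑X n g) (∑-* {n} a (λ w → f (X w))))

square fourth sixth : ℤ → ℤ
square x = x ℤ.* x
fourth x = (x ℤ.* x) ℤ.* (x ℤ.* x)
sixth  x = ((x ℤ.* x) ℤ.* (x ℤ.* x)) ℤ.* (x ℤ.* x)

∑X-const : ∀ n a → ∑X n (λ _ → a) ≡ a ℤ.* + (2 ^ n)
∑X-const n a = trans (∑X-cong n (λ _ → sym (ℤ.*-identityʳ a)))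
  (trans (∑-* {n} a (λ _ → 1ℤ)) (cong (a ℤ.*_) (∑-1 n)))

∑-X² : ∀ n → ∑X n square ≡ + n ℤ.* + (2 ^ n)
∑-X² zero    = refl
∑-X² (suc n) = begin
  ∑X (suc n) square                            ≡⟨ ∑X-suc n square ⟩
  ∑X n (λ x → square (1ℤ ℤ.+ x) ℤ.+ square (-1ℤ ℤ.+ x)) ≡⟨ ∑X-cong n expand ⟩
  ∑X n (λ x → + 2 ℤ.* square x ℤ.+ + 2)        ≡⟨ ∑X-linear n (+ 2) square (λ _ → + 2) ⟩
  + 2 ℤ.* ∑X n square ℤ.+ ∑X n (λ _ → + 2)
    ≡⟨ cong₂ (λ a b → + 2 ℤ.* a ℤ.+ b) (∑-X² n) (∑X-const n (+ 2)) ⟩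
  + 2 ℤ.* (+ n ℤ.* + (2 ^ n)) ℤ.+ + 2 ℤ.* + (2 ^ n)
    ≡⟨ collect (+ n) (+ (2 ^ n)) ⟩
  + suc n ℤ.* (+ (2 ^ n) ℤ.+ + (2 ^ n))        ≡⟨ cong (+ suc n ℤ.*_) (2^suc n) ⟩
  + suc n ℤ.* + (2 ^ suc n)                    ∎
  where
  open ≡-Reasoning
  expand : ∀ x → (1ℤ ℤ.+ x) ℤ.* (1ℤ ℤ.+ x) ℤ.+ (-1ℤ ℤ.+ x) ℤ.* (-1ℤ ℤ.+ x) ≡ + 2 ℤ.* (x ℤ.* x) ℤ.+ + 2
  expand = ℤ-solve-∀
  collect : ∀ a N → + 2 ℤ.* (a ℤ.* N) ℤ.+ + 2 ℤ.* N ≡ (1ℤ ℤ.+ a) ℤ.* (N ℤ.+ N)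
  collect = ℤ-solve-∀

-- The fourth and sixth moments of a sum of independent uniform signs; the proofs below condition on
-- the first sign.
m₄ m₆ : ℤ → ℤ
m₄ a = + 3 ℤ.* (a ℤ.* a) ℤ.- + 2 ℤ.* a
m₆ a = + 15 ℤ.* (a ℤ.* (a ℤ.* a)) ℤ.- + 30 ℤ.* (a ℤ.* a) ℤ.+ + 16 ℤ.* a

∑-X⁴ : ∀ n → ∑X n fourth ≡ m₄ (+ n) ℤ.* + (2 ^ n)
∑-X⁴ zero    = refl
∑-X⁴ (suc n) = begin
  ∑X (suc n) fourth                            ≡⟨ ∑X-suc n fourth ⟩
  ∑X n (λ x → fourth (1ℤ ℤ.+ x) ℤ.+ fourth (-1ℤ ℤ.+ x)) ≡⟨ ∑X-cong n expand ⟩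
  ∑X n (λ x → + 2 ℤ.* fourth x ℤ.+ (+ 12 ℤ.* square x ℤ.+ + 2))
    ≡⟨ ∑X-linear n (+ 2) fourth (λ x → + 12 ℤ.* square x ℤ.+ + 2) ⟩
  + 2 ℤ.* ∑X n fourth ℤ.+ ∑X n (λ x → + 12 ℤ.* square x ℤ.+ + 2)
    ≡⟨ cong (ℤ._+_ (+ 2 ℤ.* ∑X n fourth)) (∑X-linear n (+ 12) square (λ _ → + 2)) ⟩
  + 2 ℤ.* ∑X n fourth ℤ.+ (+ 12 ℤ.* ∑X n square ℤ.+ ∑X n (λ _ → + 2))
    ≡⟨ cong₂ (λ a b → + 2 ℤ.* a ℤ.+ b) (∑-X⁴ n)
        (cong₂ (λ a b → + 12 ℤ.* a ℤ.+ b) (∑-X² n) (∑X-const n (+ 2))) ⟩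
  + 2 ℤ.* (m₄ (+ n) ℤ.* + (2 ^ n)) ℤ.+ (+ 12 ℤ.* (+ n ℤ.* + (2 ^ n)) ℤ.+ + 2 ℤ.* + (2 ^ n))
    ≡⟨ collect (+ n) (+ (2 ^ n)) ⟩
  m₄ (+ suc n) ℤ.* (+ (2 ^ n) ℤ.+ + (2 ^ n))   ≡⟨ cong (m₄ (+ suc n) ℤ.*_) (2^suc n) ⟩
  m₄ (+ suc n) ℤ.* + (2 ^ suc n)               ∎
  where
  open ≡-Reasoning
  expand : ∀ x → ((1ℤ ℤ.+ x) ℤ.* (1ℤ ℤ.+ x)) ℤ.* ((1ℤ ℤ.+ x) ℤ.* (1ℤ ℤ.+ x))
           ℤ.+ ((-1ℤ ℤ.+ x) ℤ.* (-1ℤ ℤ.+ x)) ℤ.* ((-1ℤ ℤ.+ x) ℤ.* (-1ℤ ℤ.+ x))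
         ≡ + 2 ℤ.* ((x ℤ.* x) ℤ.* (x ℤ.* x)) ℤ.+ (+ 12 ℤ.* (x ℤ.* x) ℤ.+ + 2)
  expand = ℤ-solve-∀
  collect : ∀ a N → + 2 ℤ.* ((+ 3 ℤ.* (a ℤ.* a) ℤ.- + 2 ℤ.* a) ℤ.* N) ℤ.+ (+ 12 ℤ.* (a ℤ.* N) ℤ.+ + 2 ℤ.* N)
          ≡ (+ 3 ℤ.* ((1ℤ ℤ.+ a) ℤ.* (1ℤ ℤ.+ a)) ℤ.- + 2 ℤ.* (1ℤ ℤ.+ a)) ℤ.* (N ℤ.+ N)
  collect = ℤ-solve-∀

∑-X⁶ : ∀ n → ∑X n sixth ≡ m₆ (+ n) ℤ.* + (2 ^ n)
∑-X⁶ zero    = refl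
∑-X⁶ (suc n) = begin
  ∑X (suc n) sixth                             ≡⟨ ∑X-suc n sixth ⟩
  ∑X n (λ x → sixth (1ℤ ℤ.+ x) ℤ.+ sixth (-1ℤ ℤ.+ x)) ≡⟨ ∑X-cong n expand ⟩
  ∑X n (λ x → + 2 ℤ.* sixth x ℤ.+ (+ 30 ℤ.* fourth x ℤ.+ (+ 30 ℤ.* square x ℤ.+ + 2)))
    ≡⟨ ∑X-linear n (+ 2) sixth (λ x → + 30 ℤ.* fourth x ℤ.+ (+ 30 ℤ.* square x ℤ.+ + 2)) ⟩
  + 2 ℤ.* ∑X n sixth ℤ.+ ∑X n (λ x → + 30 ℤ.* fourth x ℤ.+ (+ 30 ℤ.* square x ℤ.+ + 2))
    ≡⟨ cong (ℤ._+_ (+ 2 ℤ.* ∑X n sixth)) (trans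
        (∑X-linear n (+ 30) fourth (λ x → + 30 ℤ.* square x ℤ.+ + 2))
        (cong (ℤ._+_ (+ 30 ℤ.* ∑X n fourth)) (∑X-linear n (+ 30) square (λ _ → + 2)))) ⟩
  + 2 ℤ.* ∑X n sixth ℤ.+ (+ 30 ℤ.* ∑X n fourth ℤ.+ (+ 30 ℤ.* ∑X n square ℤ.+ ∑X n (λ _ → + 2)))
    ≡⟨ cong₂ (λ a b → + 2 ℤ.* a ℤ.+ b) (∑-X⁶ n) (cong₂ (λ a b → + 30 ℤ.* a ℤ.+ b) (∑-X⁴ n)
        (cong₂ (λ a b → + 30 ℤ.* a ℤ.+ b) (∑-X² n) (∑X-const n (+ 2)))) ⟩
  + 2 ℤ.* (m₆ (+ n) ℤ.* + (2 ^ n)) ℤ.+ (+ 30 ℤ.* (m₄ (+ n) ℤ.* + (2 ^ n))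
    ℤ.+ (+ 30 ℤ.* (+ n ℤ.* + (2 ^ n)) ℤ.+ + 2 ℤ.* + (2 ^ n)))
    ≡⟨ collect (+ n) (+ (2 ^ n)) ⟩
  m₆ (+ suc n) ℤ.* (+ (2 ^ n) ℤ.+ + (2 ^ n))   ≡⟨ cong (m₆ (+ suc n) ℤ.*_) (2^suc n) ⟩
  m₆ (+ suc n) ℤ.* + (2 ^ suc n)               ∎
  where
  open ≡-Reasoning
  expand : ∀ x → (((1ℤ ℤ.+ x) ℤ.* (1ℤ ℤ.+ x)) ℤ.* ((1ℤ ℤ.+ x) ℤ.* (1ℤ ℤ.+ x))) ℤ.* ((1ℤ ℤ.+ x) ℤ.* (1ℤ ℤ.+ x))
           ℤ.+ (((-1ℤ ℤ.+ x) ℤ.* (-1ℤ ℤ.+ x)) ℤ.* ((-1ℤ ℤ.+ x) ℤ.* (-1ℤ ℤ.+ x))) ℤ.* ((-1ℤ ℤ.+ x) ℤ.* (-1ℤ ℤ.+ x))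
         ≡ + 2 ℤ.* (((x ℤ.* x) ℤ.* (x ℤ.* x)) ℤ.* (x ℤ.* x))
           ℤ.+ (+ 30 ℤ.* ((x ℤ.* x) ℤ.* (x ℤ.* x)) ℤ.+ (+ 30 ℤ.* (x ℤ.* x) ℤ.+ + 2))
  expand = ℤ-solve-∀
  collect : ∀ a N →
    + 2 ℤ.* ((+ 15 ℤ.* (a ℤ.* (a ℤ.* a)) ℤ.- + 30 ℤ.* (a ℤ.* a) ℤ.+ + 16 ℤ.* a) ℤ.* N) ℤ.+
      (+ 30 ℤ.* ((+ 3 ℤ.* (a ℤ.* a) ℤ.- + 2 ℤ.* a) ℤ.* N) ℤ.+ (+ 30 ℤ.* (a ℤ.* N) ℤ.+ + 2 ℤ.* N))
    ≡ (+ 15 ℤ.* ((1ℤ ℤ.+ a) ℤ.* ((1ℤ ℤ.+ a) ℤ.* (1ℤ ℤ.+ a))) ℤ.- + 30 ℤ.* ((1ℤ ℤ.+ a) ℤ.* (1ℤ ℤ.+ a))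
        ℤ.+ + 16 ℤ.* (1ℤ ℤ.+ a)) ℤ.* (N ℤ.+ N)
  collect = ℤ-solve-∀

X-complement : (w : Word n) → X (𝟏 ⊕ w) ≡ ℤ.- X w
X-complement []      = refl
X-complement (a ∷ w) = trans (cong₂ ℤ._+_ (sgn-⁻¹ a) (X-complement w)) (sym (ℤ.neg-distrib-+ (sgn a) (X w)))

-- The weights of C are 0, n, n/2, p and n − p, and a = n − 2p.

module _ {C : LinearCode n} (A : OA₇ C k) (a : ℤ)
         (values : ∀ {c} → c ∈ C → c ≢ 𝟎 → (X c ≡ ℤ.- + n) ⊎ X c ≡ 0ℤ ⊎ X c ≡ a ⊎ X c ≡ ℤ.- a) where

  private
    open OA₇ A
    N = + (2 ^ n)
    ν = + n

    X-𝟎 : X (𝟎 {n}) ≡ ν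
    X-𝟎 = trans (X≡ {n} 𝟎) (trans (cong (λ t → ν ℤ.- + (2 * t)) (wt-𝟎 n)) (ℤ.+-identityʳ ν))

    -- Both vanish at every nonzero codeword. `F` omits the factor for 𝟎, so its average brings in
    -- the size of the code. `G′` includes it, so its average over all words is 0; being even, it
    -- needs only even moments.
    F G′ : ℤ → ℤ
    F x  = ((x ℤ.+ ν) ℤ.* x) ℤ.* (x ℤ.* x ℤ.- a ℤ.* a)
    G′ x = ((x ℤ.* x ℤ.- ν ℤ.* ν) ℤ.* (x ℤ.* x)) ℤ.* (x ℤ.* x ℤ.- a ℤ.* a)

    F-vanishes : ∀ x → (x ≡ ℤ.- ν) ⊎ x ≡ 0ℤ ⊎ x ≡ a ⊎ x ≡ ℤ.- a → F x ≡ 0ℤ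
    F-vanishes _ (inj₁ refl) = z₁ ν a
      where
      z₁ : ∀ ν a → ((ℤ.- ν ℤ.+ ν) ℤ.* (ℤ.- ν)) ℤ.* ((ℤ.- ν) ℤ.* (ℤ.- ν) ℤ.- a ℤ.* a) ≡ 0ℤ
      z₁ = ℤ-solve-∀
    F-vanishes _ (inj₂ (inj₁ refl)) = z₂ ν a
      where
      z₂ : ∀ ν a → ((0ℤ ℤ.+ ν) ℤ.* 0ℤ) ℤ.* (0ℤ ℤ.* 0ℤ ℤ.- a ℤ.* a) ≡ 0ℤ
      z₂ = ℤ-solve-∀
    F-vanishes _ (inj₂ (inj₂ (inj₁ refl))) = z₃ ν a
      where
      z₃ : ∀ ν a → ((a ℤ.+ ν) ℤ.* a) ℤ.* (a ℤ.* a ℤ.- a ℤ.* a) ≡ 0ℤ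
      z₃ = ℤ-solve-∀
    F-vanishes _ (inj₂ (inj₂ (inj₂ refl))) = z₄ ν a
      where
      z₄ : ∀ ν a → ((ℤ.- a ℤ.+ ν) ℤ.* (ℤ.- a)) ℤ.* ((ℤ.- a) ℤ.* (ℤ.- a) ℤ.- a ℤ.* a) ≡ 0ℤ
      z₄ = ℤ-solve-∀

    factor : ∀ x → G′ x ≡ (F x ℤ.* x) ℤ.* (x ℤ.- ν)
    factor x = lemma x ν a
      where
      lemma : ∀ x ν a → ((x ℤ.* x ℤ.- ν ℤ.* ν) ℤ.* (x ℤ.* x)) ℤ.* (x ℤ.* x ℤ.- a ℤ.* a)
        ≡ ((((x ℤ.+ ν) ℤ.* x) ℤ.* (x ℤ.* x ℤ.- a ℤ.* a)) ℤ.* x) ℤ.* (x ℤ.- ν)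
      lemma = ℤ-solve-∀

    G′-vanishes : ∀ x → F x ≡ 0ℤ → G′ x ≡ 0ℤ
    G′-vanishes x e = trans (factor x) (cong (λ t → (t ℤ.* x) ℤ.* (x ℤ.- ν)) e)

    G′-ν : G′ ν ≡ 0ℤ
    G′-ν = lemma ν a
      where
      lemma : ∀ ν a → ((ν ℤ.* ν ℤ.- ν ℤ.* ν) ℤ.* (ν ℤ.* ν)) ℤ.* (ν ℤ.* ν ℤ.- a ℤ.* a) ≡ 0ℤ
      lemma = ℤ-solve-∀

    deg-X² : Deg {n} 2 (λ w → X w ℤ.* X w)
    deg-X² = deg-* deg-X deg-X

    deg-F : Deg {n} 7 (λ w → F (X w))
    deg-F = deg-≤ (ℕ.m≤m+n 4 3)
      (deg-* (deg-* (plus deg-X (deg-const ν)) deg-X) (deg-- deg-X² (deg-const (a ℤ.* a))))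

    deg-G′ : Deg {n} 7 (λ w → G′ (X w))
    deg-G′ = deg-≤ (ℕ.m≤m+n 6 1)
      (deg-* (deg-* (deg-- deg-X² (deg-const (ν ℤ.* ν))) deg-X²) (deg-- deg-X² (deg-const (a ℤ.* a))))

    ∑F : ∑X n F ≡ (ν ℤ.* (+ 3 ℤ.* ν ℤ.- + 2 ℤ.- a ℤ.* a)) ℤ.* N
    ∑F = begin
      ∑X n F
        ≡⟨ ∑X-cong n (λ x → expand x ν a) ⟩
      ∑X n (λ x → 1ℤ ℤ.* fourth x ℤ.+ ((ℤ.- (a ℤ.* a)) ℤ.* square x ℤ.+ oddPart x))
        ≡⟨ ∑X-linear n 1ℤ fourth (λ x → (ℤ.- (a ℤ.* a)) ℤ.* square x ℤ.+ oddPart x) ⟩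
      1ℤ ℤ.* ∑X n fourth ℤ.+ ∑X n (λ x → (ℤ.- (a ℤ.* a)) ℤ.* square x ℤ.+ oddPart x)
        ≡⟨ cong (ℤ._+_ (1ℤ ℤ.* ∑X n fourth)) (∑X-linear n (ℤ.- (a ℤ.* a)) square oddPart) ⟩
      1ℤ ℤ.* ∑X n fourth ℤ.+ ((ℤ.- (a ℤ.* a)) ℤ.* ∑X n square ℤ.+ ∑X n oddPart)
        ≡⟨ cong₂ (λ s t → 1ℤ ℤ.* s ℤ.+ t) (∑-X⁴ n) (cong₂ (λ s t → (ℤ.- (a ℤ.* a)) ℤ.* s ℤ.+ t) (∑-X² n)
            (∑-odd {n} (λ w → oddPart (X w)) 𝟏
              (λ w → trans (cong oddPart (X-complement w)) (odd (X w) ν a)))) ⟩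
      1ℤ ℤ.* (m₄ ν ℤ.* N) ℤ.+ ((ℤ.- (a ℤ.* a)) ℤ.* (ν ℤ.* N) ℤ.+ 0ℤ)
        ≡⟨ collect ν a N ⟩
      (ν ℤ.* (+ 3 ℤ.* ν ℤ.- + 2 ℤ.- a ℤ.* a)) ℤ.* N ∎
      where
      open ≡-Reasoning
      -- The cubic and linear terms; they sum to 0 because complementing a word negates `X`.
      oddPart : ℤ → ℤ
      oddPart x = ν ℤ.* (x ℤ.* (x ℤ.* x ℤ.- a ℤ.* a))
      expand : ∀ x ν a → ((x ℤ.+ ν) ℤ.* x) ℤ.* (x ℤ.* x ℤ.- a ℤ.* a) ≡
        1ℤ ℤ.* ((x ℤ.* x) ℤ.* (x ℤ.* x)) ℤ.+ ((ℤ.- (a ℤ.* a)) ℤ.* (x ℤ.* x) ℤ.+ ν ℤ.* (x ℤ.* (x ℤ.* x ℤ.- a ℤ.* a)))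
      expand = ℤ-solve-∀
      odd : ∀ x ν a → ν ℤ.* (ℤ.- x ℤ.* (ℤ.- x ℤ.* ℤ.- x ℤ.- a ℤ.* a)) ≡ ℤ.- (ν ℤ.* (x ℤ.* (x ℤ.* x ℤ.- a ℤ.* a)))
      odd = ℤ-solve-∀
      collect : ∀ ν a N → 1ℤ ℤ.* ((+ 3 ℤ.* (ν ℤ.* ν) ℤ.- + 2 ℤ.* ν) ℤ.* N) ℤ.+ (ℤ.- (a ℤ.* a) ℤ.* (ν ℤ.* N) ℤ.+ 0ℤ)
        ≡ (ν ℤ.* (+ 3 ℤ.* ν ℤ.- + 2 ℤ.- a ℤ.* a)) ℤ.* N
      collect = ℤ-solve-∀

    ∑G′ : ∑X n G′ ≡
          (ν ℤ.* ((ν ℤ.- 1ℤ) ℤ.* ((ν ℤ.- + 2) ℤ.* (a ℤ.* a ℤ.- (+ 3 ℤ.* ν ℤ.- + 8))))) ℤ.* N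
    ∑G′ = begin
      ∑X n G′
        ≡⟨ ∑X-cong n (λ x → expand x ν a) ⟩
      ∑X n (λ x → 1ℤ ℤ.* sixth x ℤ.+ (c₄ ℤ.* fourth x ℤ.+ (c₂ ℤ.* square x ℤ.+ 0ℤ)))
        ≡⟨ ∑X-linear n 1ℤ sixth (λ x → c₄ ℤ.* fourth x ℤ.+ (c₂ ℤ.* square x ℤ.+ 0ℤ)) ⟩
      1ℤ ℤ.* ∑X n sixth ℤ.+ ∑X n (λ x → c₄ ℤ.* fourth x ℤ.+ (c₂ ℤ.* square x ℤ.+ 0ℤ))
        ≡⟨ cong (ℤ._+_ (1ℤ ℤ.* ∑X n sixth)) (trans
            (∑X-linear n c₄ fourth (λ x → c₂ ℤ.* square x ℤ.+ 0ℤ))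
            (cong (ℤ._+_ (c₄ ℤ.* ∑X n fourth)) (∑X-linear n c₂ square (λ _ → 0ℤ)))) ⟩
      1ℤ ℤ.* ∑X n sixth ℤ.+ (c₄ ℤ.* ∑X n fourth ℤ.+ (c₂ ℤ.* ∑X n square ℤ.+ ∑X n (λ _ → 0ℤ)))
        ≡⟨ cong₂ (λ s t → 1ℤ ℤ.* s ℤ.+ t) (∑-X⁶ n) (cong₂ (λ s t → c₄ ℤ.* s ℤ.+ t) (∑-X⁴ n)
            (cong₂ (λ s t → c₂ ℤ.* s ℤ.+ t) (∑-X² n) (∑X-const n 0ℤ))) ⟩
      1ℤ ℤ.* (m₆ ν ℤ.* N) ℤ.+ (c₄ ℤ.* (m₄ ν ℤ.* N) ℤ.+ (c₂ ℤ.* (ν ℤ.* N) ℤ.+ 0ℤ ℤ.* N))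
        ≡⟨ collect ν a N ⟩
      (ν ℤ.* ((ν ℤ.- 1ℤ) ℤ.* ((ν ℤ.- + 2) ℤ.* (a ℤ.* a ℤ.- (+ 3 ℤ.* ν ℤ.- + 8))))) ℤ.* N ∎
      where
      open ≡-Reasoning
      c₂ c₄ : ℤ
      c₂ = (ν ℤ.* ν) ℤ.* (a ℤ.* a)
      c₄ = ℤ.- (ν ℤ.* ν ℤ.+ a ℤ.* a)
      expand : ∀ x ν a → ((x ℤ.* x ℤ.- ν ℤ.* ν) ℤ.* (x ℤ.* x)) ℤ.* (x ℤ.* x ℤ.- a ℤ.* a) ≡
        1ℤ ℤ.* (((x ℤ.* x) ℤ.* (x ℤ.* x)) ℤ.* (x ℤ.* x)) ℤ.+ (ℤ.- (ν ℤ.* ν ℤ.+ a ℤ.* a) ℤ.* ((x ℤ.* x) ℤ.* (x ℤ.* x))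
          ℤ.+ (((ν ℤ.* ν) ℤ.* (a ℤ.* a)) ℤ.* (x ℤ.* x) ℤ.+ 0ℤ))
      expand = ℤ-solve-∀
      collect : ∀ ν a N →
        1ℤ ℤ.* ((+ 15 ℤ.* (ν ℤ.* (ν ℤ.* ν)) ℤ.- + 30 ℤ.* (ν ℤ.* ν) ℤ.+ + 16 ℤ.* ν) ℤ.* N) ℤ.+
          (ℤ.- (ν ℤ.* ν ℤ.+ a ℤ.* a) ℤ.* ((+ 3 ℤ.* (ν ℤ.* ν) ℤ.- + 2 ℤ.* ν) ℤ.* N)
            ℤ.+ (((ν ℤ.* ν) ℤ.* (a ℤ.* a)) ℤ.* (ν ℤ.* N) ℤ.+ 0ℤ ℤ.* N))
        ≡ (ν ℤ.* ((ν ℤ.- 1ℤ) ℤ.* ((ν ℤ.- + 2) ℤ.* (a ℤ.* a ℤ.- (+ 3 ℤ.* ν ℤ.- + 8))))) ℤ.* N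
      collect = ℤ-solve-∀

  -- The average of `G′` over all words is n (n - 1) (n - 2) (a² - 3n + 8), and it has to be 0.
  a²≡3n-8 : 3 ≤ n → a ℤ.* a ≡ + 3 ℤ.* + n ℤ.- + 8
  a²≡3n-8 3≤n with a ℤ.* a ℤ.≟ (+ 3 ℤ.* + n ℤ.- + 8)
  ... | yes e = e
  ... | no ne = contradiction ∑≡0 (*-≢0 (2^≢0 k) (λ e → *-≢0
                (*-≢0 ν≢0 (*-≢0 (ν≢ 1 (ℕ.≤-trans (ℕ.m≤m+n 2 1) 3≤n)) (*-≢0 (ν≢ 2 3≤n)
                  (λ e → ne (ℤ.i-j≡0⇒i≡j (a ℤ.* a) _ e))))) (2^≢0 n) (trans (sym ∑G′) e)))
    where
    ν≢ : ∀ j → j < n → ν ℤ.- + j ≢ 0ℤ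
    ν≢ j j<n e = ℕ.<-irrefl (sym (ℤ.+-injective (ℤ.i-j≡0⇒i≡j ν (+ j) e))) j<n
    ν≢0 : ν ≢ 0ℤ
    ν≢0 e = ℕ.<-irrefl (sym (ℤ.+-injective e)) (ℕ.≤-trans (s≤s z≤n) 3≤n)
    ∑≡0 : + (2 ^ k) ℤ.* ∑X n G′ ≡ 0ℤ
    ∑≡0 = trans (sym (sum-single deg-G′ (𝟎-codeword C)
              (λ {c} c∈C c≢𝟎 → G′-vanishes (X c) (F-vanishes (X c) (values c∈C c≢𝟎)))))
            (trans (cong (N ℤ.*_) (trans (cong G′ X-𝟎) G′-ν)) (ℤ.*-zeroʳ N))

  -- The identity for `F` at 𝟎, cleared of common factors. Divided by 6 it says that a Hamming ball
  -- of radius 3 in length n - 1 has 2^k / 2 words, as for the perfect Golay code of length 23. The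
  -- negative term is moved to the right so that the equation can be read in ℕ.
  sphere-equation : 3 ≤ n → + n ℤ.* (+ n ℤ.* + n ℤ.+ + 8) ≡ + 3 ℤ.* + (2 ^ k) ℤ.+ + 3 ℤ.* (+ n ℤ.* + n)
  sphere-equation 3≤n = ℤ.i-j≡0⇒i≡j _ _ (cancel (ν ℤ.* (ν ℤ.* ν ℤ.+ + 8) ℤ.- (+ 3 ℤ.* K ℤ.+ + 3 ℤ.* (ν ℤ.* ν))) (begin
      ((N ℤ.* ν) ℤ.* + 2) ℤ.* (ν ℤ.* (ν ℤ.* ν ℤ.+ + 8) ℤ.- (+ 3 ℤ.* K ℤ.+ + 3 ℤ.* (ν ℤ.* ν)))
        ≡⟨ rearrange N ν K ⟩
      N ℤ.* (((ν ℤ.+ ν) ℤ.* ν) ℤ.* (ν ℤ.* ν ℤ.- (+ 3 ℤ.* ν ℤ.- + 8)))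
        ℤ.- K ℤ.* ((ν ℤ.* (+ 3 ℤ.* ν ℤ.- + 2 ℤ.- (+ 3 ℤ.* ν ℤ.- + 8))) ℤ.* N)
        ≡⟨ cong (λ t → N ℤ.* (((ν ℤ.+ ν) ℤ.* ν) ℤ.* (ν ℤ.* ν ℤ.- t))
                 ℤ.- K ℤ.* ((ν ℤ.* (+ 3 ℤ.* ν ℤ.- + 2 ℤ.- t)) ℤ.* N)) (sym (a²≡3n-8 3≤n)) ⟩
      N ℤ.* F ν ℤ.- K ℤ.* ((ν ℤ.* (+ 3 ℤ.* ν ℤ.- + 2 ℤ.- a ℤ.* a)) ℤ.* N)
        ≡⟨ ℤ.i≡j⇒i-j≡0 (trans (cong (λ t → N ℤ.* F t) (sym X-𝟎))
             (trans (sum-single deg-F (𝟎-codeword C) (λ {c} c∈C c≢𝟎 → F-vanishes (X c) (values c∈C c≢𝟎)))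
               (cong (K ℤ.*_) ∑F))) ⟩
      0ℤ ∎))
    where
    open ≡-Reasoning
    K = + (2 ^ k)
    ν≢0 : ν ≢ 0ℤ
    ν≢0 e = ℕ.<-irrefl (sym (ℤ.+-injective e)) (ℕ.≤-trans (s≤s z≤n) 3≤n)
    cancel : ∀ x → ((N ℤ.* ν) ℤ.* + 2) ℤ.* x ≡ 0ℤ → x ≡ 0ℤ
    cancel x e with ℤ.i*j≡0⇒i≡0∨j≡0 ((N ℤ.* ν) ℤ.* + 2) e
    ... | inj₂ x≡0 = x≡0
    ... | inj₁ ≡0 = contradiction ≡0 (*-≢0 {N ℤ.* ν} (*-≢0 (2^≢0 n) ν≢0) (λ ()))
    rearrange : ∀ N ν K →
      ((N ℤ.* ν) ℤ.* + 2) ℤ.* (ν ℤ.* (ν ℤ.* ν ℤ.+ + 8) ℤ.- (+ 3 ℤ.* K ℤ.+ + 3 ℤ.* (ν ℤ.* ν)))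
      ≡ N ℤ.* (((ν ℤ.+ ν) ℤ.* ν) ℤ.* (ν ℤ.* ν ℤ.- (+ 3 ℤ.* ν ℤ.- + 8)))
        ℤ.- K ℤ.* ((ν ℤ.* (+ 3 ℤ.* ν ℤ.- + 2 ℤ.- (+ 3 ℤ.* ν ℤ.- + 8))) ℤ.* N)
    rearrange = ℤ-solve-∀

-- The equation n (n² − 3n + 8) = 3 · 2ᵏ

∣3*2^k⇒∣3⊎even : ∀ k {x} → x ∣ 3 * 2 ^ k → x ∣ 3 ⊎ 2 ∣ x
∣3*2^k⇒∣3⊎even zero    x∣ = inj₁ x∣
∣3*2^k⇒∣3⊎even (suc k) {x} (divides w e) with euclidsLemma w x prime[2] (subst (2 ∣_) e (divides (3 * 2 ^ k) (shift (2 ^ k))))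
  where
  shift : ∀ p → 3 * (2 * p) ≡ 3 * p * 2
  shift = solve-∀
... | inj₂ 2∣x = inj₂ 2∣x
... | inj₁ (divides w′ refl) = ∣3*2^k⇒∣3⊎even k (divides w′ (ℕ.*-cancelˡ-≡ _ _ 2 (trans (l (2 ^ k)) (trans e (r w′ x)))))
  where
  l : ∀ p → 2 * (3 * p) ≡ 3 * (2 * p)
  l = solve-∀
  r : ∀ w x → w * 2 * x ≡ 2 * (w * x)
  r = solve-∀

-- A dichotomy on the exponent of 2 in a divisor: at most `j`, or more.
∣3*2^k : ∀ k j {x} → x ∣ 3 * 2 ^ k → x ∣ 3 * 2 ^ j ⊎ 2 ^ suc j ∣ x
∣3*2^k k zero    x∣ = ∣3*2^k⇒∣3⊎even k x∣
∣3*2^k k (suc j) x∣ with ∣3*2^k⇒∣3⊎even k x∣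
... | inj₁ x∣3 = inj₁ (∣-trans x∣3 (m∣m*n (2 ^ suc j)))
∣3*2^k zero (suc j) x∣ | inj₂ 2∣x = contradiction (∣-trans 2∣x x∣) (toWitnessFalse {a? = 2 ∣? 3} _)
∣3*2^k (suc k) (suc j) x∣ | inj₂ (divides y refl)
  with ∣3*2^k k j (*-cancelˡ-∣ {y} 2 (subst₂ _∣_ (ℕ.*-comm y 2) (shift (2 ^ k)) x∣))
  where
  shift : ∀ p → 3 * (2 * p) ≡ 2 * (3 * p)
  shift = solve-∀
... | inj₁ y∣ = inj₁ (subst₂ _∣_ (ℕ.*-comm 2 y) (shift (2 ^ j)) (*-monoʳ-∣ 2 y∣))
  where
  shift : ∀ p → 2 * (3 * p) ≡ 3 * (2 * p)
  shift = solve-∀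
... | inj₂ ∣y = inj₂ (subst (2 ^ suc (suc j) ∣_) (ℕ.*-comm 2 y) (*-monoʳ-∣ 2 ∣y))

-- Here n times `q` is 3 · 2ᵏ, so each factor divides 24 or is a multiple of 16. As `q` is too large
-- to divide 24, it is a multiple of 16; then `n` is not, since `q` is 8 modulo `n`. The divisors of
-- 24 remain. The bound 9 excludes the genuine solution 8.
length-24 : ∀ k n → 9 ≤ n → n * (n * n + 8) ≡ 3 * 2 ^ k + 3 * (n * n) → n ≡ 24
length-24 k n 9≤n e = by-cases (∣3*2^k k 3 n∣) (∣3*2^k k 3 q∣)
  where
  r = n ∸ 3
  q = n * r + 8
  n≡ : n ≡ 3 + r
  n≡ = sym (ℕ.m+[n∸m]≡n (ℕ.≤-trans (ℕ.m≤m+n 3 6) 9≤n))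
  q+3n : q + 3 * n ≡ n * n + 8
  q+3n = trans (move n r) (cong (λ t → n * t + 8) (sym n≡))
    where
    move : ∀ n r → n * r + 8 + 3 * n ≡ n * (3 + r) + 8
    move = solve-∀
  nq : n * q ≡ 3 * 2 ^ k
  nq = ℕ.+-cancelʳ-≡ (3 * (n * n)) _ _ (trans (trans (move n q) (cong (n *_) q+3n)) e)
    where
    move : ∀ n q → n * q + 3 * (n * n) ≡ n * (q + 3 * n)
    move = solve-∀
  n∣ : n ∣ 3 * 2 ^ k
  n∣ = subst (n ∣_) nq (m∣m*n q)
  q∣ : q ∣ 3 * 2 ^ k
  q∣ = subst (q ∣_) nq (n∣m*n n)
  62≤q : 62 ≤ q
  62≤q = ℕ.+-monoˡ-≤ 8 (ℕ.*-mono-≤ 9≤n (ℕ.∸-monoˡ-≤ 3 9≤n))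
  table : ∀ (i : Fin 25) → toℕ i ∣ 24 → 9 ≤ toℕ i → 16 ∣ toℕ i * (toℕ i ∸ 3) + 8 → toℕ i ≡ 24
  table = toWitness {a? = Fin.all? (λ i → (toℕ i ∣? 24) →-dec ((9 ℕ.≤? toℕ i) →-dec
            ((16 ∣? toℕ i * (toℕ i ∸ 3) + 8) →-dec (toℕ i ℕ.≟ 24))))} _
  by-cases : n ∣ 24 ⊎ 16 ∣ n → q ∣ 24 ⊎ 16 ∣ q → n ≡ 24
  by-cases _ (inj₁ q∣24) = contradiction (ℕ.≤-trans 62≤q (∣⇒≤ q∣24)) (toWitnessFalse {a? = 62 ℕ.≤? 24} _)
  by-cases (inj₂ 16∣n) (inj₂ 16∣q) = contradiction (∣m+n∣m⇒∣n 16∣q (∣m⇒∣m*n r 16∣n))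
    (toWitnessFalse {a? = 16 ∣? 8} _)
  by-cases (inj₁ n∣24) (inj₂ 16∣q) = trans (sym i≡n) (table i (subst (_∣ 24) (sym i≡n) n∣24)
    (subst (9 ≤_) (sym i≡n) 9≤n) (subst (λ n → 16 ∣ n * (n ∸ 3) + 8) (sym i≡n) 16∣q))
    where
    n<25 : n < 25
    n<25 = s≤s (∣⇒≤ n∣24)
    i : Fin 25
    i = fromℕ< n<25
    i≡n : toℕ i ≡ n
    i≡n = Fin.toℕ-fromℕ< n<25

-- The length and the weights

some-1 : (v : Word n) → v ≢ 𝟎 → ∃ λ i → lookup v i ≡ 1ℙ
some-1 []       v≢𝟎 = contradiction refl v≢𝟎
some-1 (1ℙ ∷ v) v≢𝟎 = zero , refl
some-1 (0ℙ ∷ v) v≢𝟎 with i , e ← some-1 v (v≢𝟎 ∘ cong (0ℙ ∷_)) = suc i , e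

some-0 : (v : Word n) → v ≢ 𝟏 → ∃ λ i → lookup v i ≡ 0ℙ
some-0 []       v≢𝟏 = contradiction refl v≢𝟏
some-0 (0ℙ ∷ v) v≢𝟏 = zero , refl
some-0 (1ℙ ∷ v) v≢𝟏 with i , e ← some-0 v (v≢𝟏 ∘ cong (1ℙ ∷_)) = suc i , e

-- If `b` agrees at a first choice of `i` and `j`, it differs somewhere else, and that position
-- replaces whichever of the two has the same entry in `v`.
separate : (v b : Word n) → v ≢ 𝟎 → v ≢ 𝟏 → b ≢ 𝟎 → b ≢ 𝟏 →
           ∃₂ λ i j → lookup v i ≡ 1ℙ × lookup v j ≡ 0ℙ × lookup b i ≢ lookup b j
separate v b v≢𝟎 v≢𝟏 b≢𝟎 b≢𝟏 with some-1 v v≢𝟎 | some-0 v v≢𝟏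
... | i , vᵢ | j , vⱼ with lookup b i ℙₚ.≟ lookup b j
... | no  bᵢ≢bⱼ = i , j , vᵢ , vⱼ , bᵢ≢bⱼ
... | yes bᵢ≡bⱼ with other (lookup b j)
  where
  other : ∀ a → ∃ λ l → lookup b l ≢ a
  other 0ℙ with l , e ← some-1 b b≢𝟎 = l , λ e′ → contradiction (trans (sym e) e′) λ ()
  other 1ℙ with l , e ← some-0 b b≢𝟏 = l , λ e′ → contradiction (trans (sym e) e′) λ ()
... | l , bₗ≢bⱼ with lookup v l in vₗ
... | 1ℙ = l , j , vₗ , vⱼ , bₗ≢bⱼ
... | 0ℙ = i , l , vᵢ , vₗ , λ e → bₗ≢bⱼ (trans (sym e) bᵢ≡bⱼ)

remove : ∀ {A : Set} {x : A} {xs} → Unique xs → x ∈ᴸ xs →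
         ∃ λ ys → suc (length ys) ≡ length xs × x ∉ᴸ ys × (∀ {y} → y ∈ᴸ xs → y ≢ x → y ∈ᴸ ys)
remove {xs = x ∷ xs} (x∉ ∷ _) (here refl) =
  xs , refl , (λ x∈ → All.lookup x∉ x∈ refl) ,
  λ { (here refl) y≢x → contradiction refl y≢x ; (there p) _ → p }
remove {x = x} {xs = z ∷ xs} (z∉ ∷ u) (there x∈) with remove u x∈
... | ys , e , x∉ys , sub = z ∷ ys , cong suc e ,
  (λ { (here refl) → All.lookup z∉ x∈ refl ; (there p) → x∉ys p }) ,
  λ { (here refl) _ → here refl ; (there p) y≢x → there (sub p y≢x) }

-- Complementation is an involution, so on three weights it has a fixed point. This is n/2, hence
-- the only one, and the other two are exchanged.
symmetric-triple : ∀ {n} xs → Unique xs → length xs ≡ 3 → (∀ {u} → u ∈ᴸ xs → ∃ λ u′ → u′ ∈ᴸ xs × u + u′ ≡ n) →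
  ∃ λ h → ∃ λ p → ∃ λ q → h ∈ᴸ xs × h + h ≡ n × p + q ≡ n × (∀ {u} → u ∈ᴸ xs → u ≡ h ⊎ u ≡ p ⊎ u ≡ q)
symmetric-triple {n} (a ∷ b ∷ c ∷ []) ((a≢b ∷ a≢c ∷ []) ∷ (b≢c ∷ []) ∷ [] ∷ []) refl partner
  with partner (here refl)
... | _ , here refl , aa with partner (there (here refl))
...   | _ , here refl , ba = contradiction (sym (ℕ.+-cancelʳ-≡ a b a (trans ba (sym aa)))) a≢b
...   | _ , there (here refl) , bb = contradiction
          (ℕ.*-cancelˡ-≡ a b 2 (trans (cong (_+_ a) (ℕ.+-identityʳ a)) (trans aa (trans (sym bb) (cong (_+_ b) (sym (ℕ.+-identityʳ b))))))) a≢b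
...   | _ , there (there (here refl)) , bc = a , b , c , here refl , aa , bc ,
          λ { (here refl) → inj₁ refl ; (there (here refl)) → inj₂ (inj₁ refl) ; (there (there (here refl))) → inj₂ (inj₂ refl) }
symmetric-triple {n} (a ∷ b ∷ c ∷ []) ((a≢b ∷ a≢c ∷ []) ∷ (b≢c ∷ []) ∷ [] ∷ []) refl partner
    | _ , there (here refl) , ab with partner (there (there (here refl)))
...   | _ , here refl , ca = contradiction (ℕ.+-cancelˡ-≡ a b c (trans ab (trans (sym ca) (ℕ.+-comm c a)))) b≢c
...   | _ , there (here refl) , cb = contradiction (ℕ.+-cancelʳ-≡ b a c (trans ab (sym cb))) a≢c
...   | _ , there (there (here refl)) , cc = c , a , b , there (there (here refl)) , cc , ab ,
          λ { (here refl) → inj₂ (inj₁ refl) ; (there (here refl)) → inj₂ (inj₂ refl) ; (there (there (here refl))) → inj₁ refl }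
symmetric-triple {n} (a ∷ b ∷ c ∷ []) ((a≢b ∷ a≢c ∷ []) ∷ (b≢c ∷ []) ∷ [] ∷ []) refl partner
    | _ , there (there (here refl)) , ac with partner (there (here refl))
...   | _ , here refl , ba = contradiction (ℕ.+-cancelˡ-≡ a b c (trans (ℕ.+-comm a b) (trans ba (sym ac)))) b≢c
...   | _ , there (here refl) , bb = b , a , c , there (here refl) , bb , ac ,
          λ { (here refl) → inj₂ (inj₁ refl) ; (there (here refl)) → inj₁ refl ; (there (there (here refl))) → inj₂ (inj₂ refl) }
...   | _ , there (there (here refl)) , bc = contradiction (ℕ.+-cancelʳ-≡ c a b (trans ac (sym bc))) a≢b

-- The value 64 is 3n - 8 at n = 24.
eight-or-sixteen : ∀ p q → p + q ≡ 24 → (+ 24 ℤ.- + (2 * p)) ℤ.* (+ 24 ℤ.- + (2 * p)) ≡ + 64 →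
                   (p ≡ 8 × q ≡ 16) ⊎ (p ≡ 16 × q ≡ 8)
eight-or-sixteen p q p+q≡24 e with table i (trans (cong (λ p → (+ 24 ℤ.- + (2 * p)) ℤ.* (+ 24 ℤ.- + (2 * p))) i≡p) e)
  where
  table : ∀ (i : Fin 25) → (+ 24 ℤ.- + (2 * toℕ i)) ℤ.* (+ 24 ℤ.- + (2 * toℕ i)) ≡ + 64 → toℕ i ≡ 8 ⊎ toℕ i ≡ 16
  table = toWitness {a? = Fin.all? (λ i →
    ((+ 24 ℤ.- + (2 * toℕ i)) ℤ.* (+ 24 ℤ.- + (2 * toℕ i)) ℤ.≟ + 64) →-dec ((toℕ i ℕ.≟ 8) ⊎-dec (toℕ i ℕ.≟ 16)))} _
  p<25 : p < 25
  p<25 = s≤s (subst (p ≤_) p+q≡24 (ℕ.m≤m+n p q))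
  i : Fin 25
  i = fromℕ< p<25
  i≡p : toℕ i ≡ p
  i≡p = Fin.toℕ-fromℕ< p<25
... | inj₁ i≡8  = inj₁ (p≡8 , ℕ.+-cancelˡ-≡ 8 q 16 (subst (λ p → p + q ≡ 24) p≡8 p+q≡24))
  where p≡8 = trans (sym (Fin.toℕ-fromℕ< _)) i≡8
... | inj₂ i≡16 = inj₂ (p≡16 , ℕ.+-cancelˡ-≡ 16 q 8 (subst (λ p → p + q ≡ 24) p≡16 p+q≡24))
  where p≡16 = trans (sym (Fin.toℕ-fromℕ< _)) i≡16

golayWeights : List ℕ
golayWeights = 0 ∷ 8 ∷ 12 ∷ 16 ∷ 24 ∷ []

module _ {C : LinearCode n} {d : ℕ} (A : OA₇ C k) (𝟏∈C : 𝟏 ∈ C) (b : Word n) (b∈C⊥ : b ∈ C ⊥) (wt-b : wt b ≡ 8)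
         (minimal : HasMinimumDistance C d)
         (xs : List ℕ) (unique : Unique xs) (len : length xs ≡ 3)
         (listed : ∀ u → u ∈ᴸ xs ⇔ (Satisfiable (C ofWeight u) × 0 < u × u ≤ n ∸ 5)) where

  private
    8≤n : 8 ≤ n
    8≤n = subst (_≤ n) wt-b (wt≤ b)

    wt>0 : ∀ {c : Word n} → c ≢ 𝟎 → 0 < wt c
    wt>0 c≢𝟎 = ℕ.n≢0⇒n>0 (c≢𝟎 ∘ wt≡0⇒≡𝟎 _)

    list : ∀ {c} → c ∈ C → c ≢ 𝟎 → wt c ≤ n ∸ 5 → wt c ∈ᴸ xs
    list c∈C c≢𝟎 l = Equivalence.from (listed _) ((_ , c∈C , refl) , wt>0 c≢𝟎 , l)

    -- At length 8 the word `b` is 𝟏, so all weights are even and 2 is the only positive one up to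
    -- 3, whereas three weights are listed.
    n≢8 : n ≢ 8
    n≢8 refl = distinct xs unique len only-2
      where
      b≡𝟏 : b ≡ 𝟏
      b≡𝟏 = 𝟏-or b wt-b
      only-2 : ∀ {u} → u ∈ᴸ xs → u ≡ 2
      only-2 {u} u∈ with Equivalence.to (listed u) u∈
      ... | (c , c∈C , refl) , 0<u , u≤3 = even u 0<u u≤3 (trans (sym (∧𝟏 c)) (b∈C⊥′ c∈C))
        where
        b∈C⊥′ : ∀ {c} → c ∈ C → ⟨ c , 𝟏 ⟩ ≡ 0ℙ
        b∈C⊥′ = subst (_∈ C ⊥) b≡𝟏 b∈C⊥
        ∧𝟏 : ∀ {n} (c : Word n) → ⟨ c , 𝟏 ⟩ ≡ ℕ.parity (wt c)
        ∧𝟏 c = trans (⟨,⟩≡parity c 𝟏) (cong (ℕ.parity ∘ wt) (identity c))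
          where
          identity : ∀ {n} (c : Word n) → c ∧ 𝟏 ≡ c
          identity []      = refl
          identity (a ∷ c) = cong₂ _∷_ (ℙₚ.*-identityʳ a) (identity c)
        even : ∀ u → 0 < u → u ≤ 3 → ℕ.parity u ≡ 0ℙ → u ≡ 2
        even 2 _ _ _ = refl
        even (suc (suc (suc (suc _)))) _ (s≤s (s≤s (s≤s ()))) _
      distinct : ∀ xs → Unique xs → length xs ≡ 3 → (∀ {u} → u ∈ᴸ xs → u ≡ 2) → False
      distinct (x ∷ y ∷ _) ((x≢y ∷ _) ∷ _) _ h = x≢y (trans (h (here refl)) (sym (h (there (here refl)))))

  9≤n : 9 ≤ n
  9≤n = ℕ.≤∧≢⇒< 8≤n (n≢8 ∘ sym)

  private
    n≡5+ : n ≡ 5 + (n ∸ 5)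
    n≡5+ = sym (ℕ.m+[n∸m]≡n (ℕ.≤-trans (ℕ.m≤m+n 5 3) 8≤n))

    4≤n∸5 : 4 ≤ n ∸ 5
    4≤n∸5 = ℕ.∸-monoˡ-≤ 5 9≤n

    high : ∀ {c} → c ∈ C → wt c ≢ n → ¬ wt c ≤ n ∸ 5 → d ≤ wt (𝟏 ⊕ c) × wt (𝟏 ⊕ c) < 5
    high {c} c∈C c≢n ¬l = proj₂ minimal (⊕-codeword C 𝟏∈C c∈C) 𝟏⊕c≢𝟎 ,
      ℕ.+-cancelʳ-< (n ∸ 5) (wt (𝟏 ⊕ c)) 5 (begin-strict
        wt (𝟏 ⊕ c) + (n ∸ 5)  <⟨ ℕ.+-monoʳ-< (wt (𝟏 ⊕ c)) (ℕ.≰⇒> ¬l) ⟩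
        wt (𝟏 ⊕ c) + wt c     ≡⟨ wt-complement c ⟩
        n                     ≡⟨ n≡5+ ⟩
        5 + (n ∸ 5)           ∎)
      where
      open ℕ.≤-Reasoning
      𝟏⊕c≢𝟎 : 𝟏 ⊕ c ≢ 𝟎
      𝟏⊕c≢𝟎 e = c≢n (trans (cong wt (sym (⊕≡𝟎⇒≡ 𝟏 c e))) (wt-𝟏 n))

  private
    -- The degree budget is met exactly: `d₀` from the support of `v`, 2 from the other listed
    -- weights, and `5 ∸ d₀` from the possible unlisted weights below n, the complements of the
    -- weights from `d₀` to 4.
    minimum≥5 : ∀ v → v ∈ C → v ≢ 𝟎 → wt v ≡ d → ¬ 5 ≤ wt v → False
    minimum≥5 v v∈C v≢𝟎 wt≡d ¬5≤d
      with remove unique (list v∈C v≢𝟎 (ℕ.≤-trans (ℕ.≤-pred (ℕ.≰⇒> ¬5≤d)) 4≤n∸5))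
    ... | ys , len-ys , v∉ys , rest with separate v b v≢𝟎 v≢𝟏 b≢𝟎 b≢𝟏
      where
      4<n = ℕ.≤-trans (ℕ.m≤m+n 5 3) 8≤n
      v≢𝟏 : v ≢ 𝟏
      v≢𝟏 refl = ¬5≤d (subst (5 ≤_) (sym (wt-𝟏 n)) 4<n)
      b≢𝟎 : b ≢ 𝟎
      b≢𝟎 refl with () ← trans (sym wt-b) (wt-𝟎 n)
      b≢𝟏 : b ≢ 𝟏
      b≢𝟏 refl = n≢8 (trans (sym (wt-𝟏 n)) wt-b)
    ...   | i , j , vᵢ , vⱼ , bᵢ≢bⱼ =
      low-weight-absurd A v∈C b∈C⊥ {i} {j} vᵢ vⱼ bᵢ≢bⱼ us (ℕ.≤-reflexive degree) v∉us others
      where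
      d₀ = wt v
      d₀<5 : d₀ < 5
      d₀<5 = ℕ.≰⇒> ¬5≤d
      co : List ℕ
      co = mapᴸ (λ r → n ∸ (d₀ + r)) (upTo (5 ∸ d₀))
      us : List ℕ
      us = ys ++ co
      degree : d₀ + length us ≡ 7
      degree = begin
        d₀ + length (ys ++ co)          ≡⟨ cong (_+_ d₀) (length-++ ys) ⟩
        d₀ + (length ys + length co)    ≡⟨ cong₂ (λ s t → d₀ + (s + t)) (ℕ.suc-injective (trans len-ys len))
                                            (trans (length-map _ (upTo (5 ∸ d₀))) (length-upTo (5 ∸ d₀))) ⟩
        d₀ + (2 + (5 ∸ d₀))             ≡⟨ ℕ.+-suc d₀ (suc (5 ∸ d₀)) ⟩
        suc (d₀ + suc (5 ∸ d₀))         ≡⟨ cong suc (ℕ.+-suc d₀ (5 ∸ d₀)) ⟩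
        2 + (d₀ + (5 ∸ d₀))             ≡⟨ cong (_+_ 2) (ℕ.m+[n∸m]≡n (ℕ.<⇒≤ d₀<5)) ⟩
        7                               ∎
        where open ≡-Reasoning
      v∉us : d₀ ∉ᴸ us
      v∉us p with ∈-++⁻ ys p
      ... | inj₁ q = v∉ys q
      ... | inj₂ q with ∈-map⁻ _ q
      ...   | r , r∈ , e = ℕ.<-irrefl refl (ℕ.≤-trans 9≤n n≤8)
        where
        d+r<5 : d₀ + r < 5
        d+r<5 = subst (d₀ + r <_) (ℕ.m+[n∸m]≡n (ℕ.<⇒≤ d₀<5)) (ℕ.+-monoʳ-< d₀ (∈-upTo⁻ r∈))
        -- Two weights of at most 4 can be complementary only in length at most 8.
        n≤8 : n ≤ 8
        n≤8 = begin
          n                             ≡⟨ sym (ℕ.m+[n∸m]≡n (ℕ.≤-trans (ℕ.<⇒≤ d+r<5) (ℕ.≤-trans (ℕ.m≤m+n 5 4) 9≤n))) ⟩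
          (d₀ + r) + (n ∸ (d₀ + r))     ≡⟨ cong (_+_ (d₀ + r)) (sym e) ⟩
          (d₀ + r) + d₀                 ≤⟨ ℕ.+-mono-≤ (ℕ.≤-pred d+r<5) (ℕ.≤-pred d₀<5) ⟩
          8                             ∎
          where open ℕ.≤-Reasoning
      others : ∀ {c} → c ∈ C → wt c ≢ 0 → wt c ≢ n → wt c ≢ d₀ → wt c ∈ᴸ us
      others {c} c∈C c≢0 c≢n c≢d with wt c ℕ.≤? n ∸ 5
      ... | yes l = ∈-++⁺ˡ (rest (list c∈C (λ { refl → c≢0 (wt-𝟎 n) }) l) c≢d)
      ... | no ¬l with high c∈C c≢n ¬l
      ...   | d≤r′ , r<5 = ∈-++⁺ʳ ys (subst (_∈ᴸ co) same
                (∈-map⁺ (λ r → n ∸ (d₀ + r)) (∈-upTo⁺ (ℕ.∸-monoˡ-< r<5 d≤r))))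
        where
        d≤r = subst (_≤ wt (𝟏 ⊕ c)) (sym wt≡d) d≤r′
        same : n ∸ (d₀ + (wt (𝟏 ⊕ c) ∸ d₀)) ≡ wt c
        same = trans (cong (n ∸_) (ℕ.m+[n∸m]≡n d≤r))
          (trans (cong (_∸ wt (𝟏 ⊕ c)) (sym (wt-complement c))) (ℕ.m+n∸m≡n (wt (𝟏 ⊕ c)) (wt c)))

  5≤d : 5 ≤ d
  5≤d with 5 ℕ.≤? d
  ... | yes 5≤d = 5≤d
  ... | no ¬5≤d = let (v , v∈C , v≢𝟎 , wt≡d) = proj₁ minimal in
    ⊥-elim (minimum≥5 v v∈C v≢𝟎 wt≡d (¬5≤d ∘ subst (5 ≤_) wt≡d))

  private
    middle : ∀ {c} → c ∈ C → wt c ≢ 0 → wt c ≢ n → wt c ∈ᴸ xs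
    middle {c} c∈C c≢0 c≢n with wt c ℕ.≤? n ∸ 5
    ... | yes l = list c∈C (λ { refl → c≢0 (wt-𝟎 n) }) l
    ... | no ¬l = contradiction (ℕ.≤-trans 5≤d (proj₁ (high c∈C c≢n ¬l))) (ℕ.<⇒≱ (proj₂ (high c∈C c≢n ¬l)))

    -- With minimum distance at least 5 no weight lies strictly between n - 5 and n, so the list
    -- contains all weights strictly between 0 and n and is closed under complementation.
    partner : ∀ {u} → u ∈ᴸ xs → ∃ λ u′ → u′ ∈ᴸ xs × u + u′ ≡ n
    partner {u} u∈ with Equivalence.to (listed u) u∈
    ... | (c , c∈C , refl) , 0<u , u≤ = wt (𝟏 ⊕ c) , middle (⊕-codeword C 𝟏∈C c∈C) ≢0 ≢n ,
            trans (ℕ.+-comm (wt c) _) (wt-complement c)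
      where
      ≢n : wt (𝟏 ⊕ c) ≢ n
      ≢n e = ℕ.<-irrefl (sym (ℕ.+-cancelˡ-≡ n (wt c) 0
        (trans (cong (_+ wt c) (sym e)) (trans (wt-complement c) (sym (ℕ.+-identityʳ n)))))) 0<u
      ≢0 : wt (𝟏 ⊕ c) ≢ 0
      ≢0 e = ℕ.<-irrefl refl (ℕ.≤-trans (ℕ.≤-trans (s≤s u≤) (s≤s (ℕ.m≤n+m (n ∸ 5) 4)))
        (ℕ.≤-reflexive (trans (sym n≡5+) (trans (sym (wt-complement c)) (cong (_+ wt c) e)))))

  golay-weights : n ≡ 24 × (∀ {c} → c ∈ C → wt c ∈ᴸ golayWeights) × (∃ λ c → c ∈ C × wt c ≡ 12)
  golay-weights with symmetric-triple xs unique len partner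
  ... | h , p , q , h∈ , h+h , p+q , only = n≡24 , weights , proj₁ (proj₁ h-listed) , proj₁ (proj₂ (proj₁ h-listed)) ,
          trans (proj₂ (proj₂ (proj₁ h-listed))) h≡12
    where
    open import Data.Integer.Tactic.RingSolver using () renaming (solve-∀ to ℤ-solve-∀)
    h-listed = Equivalence.to (listed h) h∈
    a : ℤ
    a = + n ℤ.- + (2 * p)
    values : ∀ {c} → c ∈ C → c ≢ 𝟎 → (X c ≡ ℤ.- + n) ⊎ X c ≡ 0ℤ ⊎ X c ≡ a ⊎ X c ≡ ℤ.- a
    values {c} c∈C c≢𝟎 with wt c ℕ.≟ n
    ... | yes c≡n = inj₁ (trans (X≡ c) (trans (cong (λ t → + n ℤ.- + (2 * t)) c≡n) (trans (cong (ℤ._-_ (+ n)) (ℤ.pos-* 2 n)) (l (+ n)))))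
      where
      l : ∀ x → x ℤ.- + 2 ℤ.* x ≡ ℤ.- x
      l = ℤ-solve-∀
    ... | no c≢n with only (middle c∈C (λ e → c≢𝟎 (wt≡0⇒≡𝟎 c e)) c≢n)
    ...   | inj₁ c≡h = inj₂ (inj₁ (trans (X≡ c) (ℤ.i≡j⇒i-j≡0 (cong +_
              (trans (sym h+h) (trans (cong (_+_ h) (sym (ℕ.+-identityʳ h))) (cong (2 *_) (sym c≡h))))))))
    ...   | inj₂ (inj₁ c≡p) = inj₂ (inj₂ (inj₁ (trans (X≡ c) (cong (λ t → + n ℤ.- + (2 * t)) c≡p))))
    ...   | inj₂ (inj₂ c≡q) = inj₂ (inj₂ (inj₂ (trans (X≡ c) (trans (cong (λ t → + n ℤ.- + (2 * t)) c≡q) opposite))))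
      where
      opposite : + n ℤ.- + (2 * q) ≡ ℤ.- a
      opposite = subst (λ n → + n ℤ.- + (2 * q) ≡ ℤ.- (+ n ℤ.- + (2 * p))) p+q
        (trans (cong₂ (λ x y → x ℤ.- y) (ℤ.pos-+ p q) (ℤ.pos-* 2 q))
          (trans (l (+ p) (+ q)) (cong₂ (λ x y → ℤ.- (x ℤ.- y)) (sym (ℤ.pos-+ p q)) (sym (ℤ.pos-* 2 p)))))
        where
        l : ∀ p q → (p ℤ.+ q) ℤ.- + 2 ℤ.* q ≡ ℤ.- ((p ℤ.+ q) ℤ.- + 2 ℤ.* p)
        l = ℤ-solve-∀
    3≤n : 3 ≤ n
    3≤n = ℕ.≤-trans (ℕ.m≤m+n 3 6) 9≤n
    n≡24 : n ≡ 24
    n≡24 = length-24 k n 9≤n (ℤ.+-injective (begin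
      + (n * (n * n + 8))                       ≡⟨ ℤ.pos-* n (n * n + 8) ⟩
      + n ℤ.* (+ (n * n) ℤ.+ + 8)               ≡⟨ cong (λ t → + n ℤ.* (t ℤ.+ + 8)) (ℤ.pos-* n n) ⟩
      + n ℤ.* (+ n ℤ.* + n ℤ.+ + 8)             ≡⟨ sphere-equation A a values 3≤n ⟩
      + 3 ℤ.* + (2 ^ k) ℤ.+ + 3 ℤ.* (+ n ℤ.* + n)
        ≡⟨ cong₂ ℤ._+_ (sym (ℤ.pos-* 3 (2 ^ k)))
            (trans (cong (+ 3 ℤ.*_) (sym (ℤ.pos-* n n))) (sym (ℤ.pos-* 3 (n * n)))) ⟩
      + (3 * 2 ^ k + 3 * (n * n))               ∎))
      where open ≡-Reasoning
    h≡12 : h ≡ 12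
    h≡12 = ℕ.*-cancelˡ-≡ h 12 2 (trans (cong (_+_ h) (ℕ.+-identityʳ h)) (trans h+h n≡24))
    p,q : (p ≡ 8 × q ≡ 16) ⊎ (p ≡ 16 × q ≡ 8)
    p,q = eight-or-sixteen p q (trans p+q n≡24)
      (subst (λ n → (+ n ℤ.- + (2 * p)) ℤ.* (+ n ℤ.- + (2 * p)) ≡ + 3 ℤ.* + n ℤ.- + 8) n≡24
        (a²≡3n-8 A a values 3≤n))
    in-list : ∀ {u} → u ≡ h ⊎ u ≡ p ⊎ u ≡ q → (p ≡ 8 × q ≡ 16) ⊎ (p ≡ 16 × q ≡ 8) → u ∈ᴸ golayWeights
    in-list (inj₁ e) _ = there (there (here (trans e h≡12)))
    in-list (inj₂ (inj₁ e)) (inj₁ (p≡8 , _))  = there (here (trans e p≡8))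
    in-list (inj₂ (inj₁ e)) (inj₂ (p≡16 , _)) = there (there (there (here (trans e p≡16))))
    in-list (inj₂ (inj₂ e)) (inj₁ (_ , q≡16)) = there (there (there (here (trans e q≡16))))
    in-list (inj₂ (inj₂ e)) (inj₂ (_ , q≡8))  = there (here (trans e q≡8))
    weights : ∀ {c} → c ∈ C → wt c ∈ᴸ golayWeights
    weights {c} c∈C = by-cases (wt c ℕ.≟ 0) (wt c ℕ.≟ n)
      where
      by-cases : Dec (wt c ≡ 0) → Dec (wt c ≡ n) → wt c ∈ᴸ golayWeights
      by-cases (yes e)  _        = here e
      by-cases (no _)   (yes e)  = there (there (there (there (here (trans e n≡24)))))
      by-cases (no c≢0) (no c≢n) = in-list (only (middle c∈C c≢0 c≢n)) p,q

-- Columns of a matrix up to order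

cols : Vec (Word n) m → Vec (Vec 𝔽₂ m) n
cols []      = Data.Vec.Base.replicate _ []
cols (w ∷ W) = zipWith _∷_ w (cols W)

-- Permuting the coordinates of all rows at once permutes this list, so `↭` expresses equivalence of
-- matrices.
columns : Vec (Word n) m → List (Vec 𝔽₂ m)
columns W = toList (cols W)

linComb-cols : ∀ x (W : Vec (Word n) m) → linComb x W ≡ map ⟨ x ,_⟩ (cols W)
linComb-cols {n} [] [] = constant n
  where
  constant : ∀ n → 𝟎 {n} ≡ map ⟨ [] ,_⟩ (Data.Vec.Base.replicate n [])
  constant zero    = refl
  constant (suc n) = cong (0ℙ ∷_) (constant n)
linComb-cols (a ∷ x) (w ∷ W) = trans (cong (a · w ⊕_) (linComb-cols x W)) (push w (cols W))
  where
  push : ∀ {n m} {a} {x : Vec 𝔽₂ m} (w : Word n) V → a · w ⊕ map ⟨ x ,_⟩ V ≡ map ⟨ a ∷ x ,_⟩ (zipWith _∷_ w V)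
  push []      []      = refl
  push (b ∷ w) (l ∷ V) = cong (_ ∷_) (push w V)

map-tail-zip : (w : Word n) (V : Vec (Vec 𝔽₂ m) n) → mapᴸ tail (toList (zipWith _∷_ w V)) ≡ toList V
map-tail-zip []      []      = refl
map-tail-zip (a ∷ w) (l ∷ V) = cong (l ∷_) (map-tail-zip w V)

restore-heads : (V : Vec (Vec 𝔽₂ m) n) (ys : List (Vec 𝔽₂ (suc m))) → toList V ≡ mapᴸ tail ys →
                ∃ λ w → toList (zipWith _∷_ w V) ≡ ys
restore-heads []      []             e = [] , refl
restore-heads (l ∷ V) ((a ∷ y) ∷ ys) e with restore-heads V ys (∷-injectiveʳ e)
... | w , e′ = a ∷ w , cong₂ _∷_ (cong (a ∷_) (∷-injectiveˡ e)) e′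

module _ {A : Set} where

  total : (A → 𝔽₂) → List A → ℕ
  total f xs = sum (mapᴸ (bit ∘ f) xs)

  total-↭ : ∀ f {xs ys} → xs ↭ ys → total f xs ≡ total f ys
  total-↭ f p = sum-↭ (map⁺ (bit ∘ f) p)

  total-++ : ∀ f xs ys → total f (xs ++ ys) ≡ total f xs + total f ys
  total-++ f xs ys = trans (cong sum (map-++ (bit ∘ f) xs ys)) (sum-++ (mapᴸ (bit ∘ f) xs) _)

  total-replicate : ∀ f s x → total f (replicate s x) ≡ s * bit (f x)
  total-replicate f zero    x = refl
  total-replicate f (suc s) x = cong (_+_ (bit (f x))) (total-replicate f s x)

  wt-map : ∀ f (V : Vec A n) → wt (map f V) ≡ total f (toList V)
  wt-map f []      = refl
  wt-map f (x ∷ V) = trans (wt-∷ (f x) (map f V)) (cong (_+_ (bit (f x))) (wt-map f V))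

  expand : List (A × ℕ) → List A
  expand []            = []
  expand ((l , s) ∷ K) = replicate s l ++ expand K

  weigh : (A → 𝔽₂) → List (A × ℕ) → ℕ
  weigh f []            = 0
  weigh f ((l , s) ∷ K) = s * bit (f l) + weigh f K

  total-expand : ∀ f K → total f (expand K) ≡ weigh f K
  total-expand f []            = refl
  total-expand f ((l , s) ∷ K) = trans (total-++ f (replicate s l) (expand K))
    (cong₂ _+_ (total-replicate f s l) (total-expand f K))

  -- Empty classes are dropped, which keeps the lists of cuts short and the search small.
  cell : A → ℕ → List (A × ℕ) → List (A × ℕ)
  cell l zero    K = K
  cell l (suc s) K = (l , suc s) ∷ K

  expand-cell : ∀ l s K → expand (cell l s K) ≡ replicate s l ++ expand K
  expand-cell l zero    K = refl
  expand-cell l (suc s) K = refl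

  weigh-cell : ∀ f l s K → weigh f (cell l s K) ≡ s * bit (f l) + weigh f K
  weigh-cell f l zero    K = refl
  weigh-cell f l (suc s) K = refl

map-expand : ∀ {A B : Set} (f : A → B) K → mapᴸ f (expand K) ≡ expand (mapᴸ (map₁ f) K)
map-expand f []            = refl
map-expand f ((l , s) ∷ K) = trans (map-++ f (replicate s l) (expand K))
  (cong₂ _++_ (map-replicate f s l) (map-expand f K))

Classes : ℕ → Set
Classes m = List (Vec 𝔽₂ m × ℕ)

-- A new row has ones in r of the s columns of a class of size s.
split : Classes m → List ℕ → Classes (suc m)
split ((l , s) ∷ K) (r ∷ ρ) = cell (0ℙ ∷ l) (s ∸ r) (cell (1ℙ ∷ l) r (split K ρ))
split _             _       = []

expand-split : ∀ (l : Vec 𝔽₂ m) s K r ρ → expand (split ((l , s) ∷ K) (r ∷ ρ)) ≡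
               (replicate (s ∸ r) (0ℙ ∷ l) ++ replicate r (1ℙ ∷ l)) ++ expand (split K ρ)
expand-split l s K r ρ = trans (expand-cell (0ℙ ∷ l) (s ∸ r) _)
  (trans (cong (replicate (s ∸ r) (0ℙ ∷ l) ++_) (expand-cell (1ℙ ∷ l) r _))
    (sym (++-assoc (replicate (s ∸ r) (0ℙ ∷ l)) (replicate r (1ℙ ∷ l)) _)))

fits : Classes m → List ℕ → Bool
fits []            []      = true
fits ((l , s) ∷ K) (r ∷ ρ) = (r ℕ.≤ᵇ s) && fits K ρ
fits _             _       = false

map-tail-split : ∀ (K : Classes m) ρ → T (fits K ρ) → mapᴸ tail (expand (split K ρ)) ≡ expand K
map-tail-split []            []      _ = refl
map-tail-split ((l , s) ∷ K) (r ∷ ρ) t with Equivalence.to (T-∧ {r ℕ.≤ᵇ s}) t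
... | r≤s , t′ = begin
  mapᴸ tail (expand (split ((l , s) ∷ K) (r ∷ ρ)))
    ≡⟨ cong (mapᴸ tail) (expand-split l s K r ρ) ⟩
  mapᴸ tail ((replicate (s ∸ r) (0ℙ ∷ l) ++ replicate r (1ℙ ∷ l)) ++ expand (split K ρ))
    ≡⟨ map-++ tail (replicate (s ∸ r) (0ℙ ∷ l) ++ replicate r (1ℙ ∷ l)) _ ⟩
  mapᴸ tail (replicate (s ∸ r) (0ℙ ∷ l) ++ replicate r (1ℙ ∷ l)) ++ mapᴸ tail (expand (split K ρ))
    ≡⟨ cong₂ _++_ (trans (map-++ tail (replicate (s ∸ r) (0ℙ ∷ l)) _)
        (trans (cong₂ _++_ (map-replicate tail (s ∸ r) (0ℙ ∷ l)) (map-replicate tail r (1ℙ ∷ l)))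
          (trans (replicate-+ (s ∸ r) r) (cong (λ s → replicate s l) (ℕ.m∸n+n≡m (ℕ.≤ᵇ⇒≤ r s r≤s))))))
        (map-tail-split K ρ t′) ⟩
  replicate s l ++ expand K ∎
  where
  open ≡-Reasoning
  replicate-+ : ∀ a b → replicate a l ++ replicate b l ≡ replicate (a + b) l
  replicate-+ zero    b = refl
  replicate-+ (suc a) b = cong (l ∷_) (replicate-+ a b)

-- Columns of one class are interchangeable: the new entries are placed on the sorted list and
-- carried back along the rearrangement.
mark : (W : Vec (Word n) m) (K : Classes m) (σ : List ℕ) → T (fits K σ) → columns W ↭ expand K →
       ∃ λ w → columns (w ∷ W) ↭ expand (split K σ)
mark W K σ t p with ↭-map-inv tail (↭-trans (↭-reflexive (map-tail-split K σ t)) (↭-sym p))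
... | ys , e , q with restore-heads (cols W) ys e
...   | w , e′ = w , ↭-trans (↭-reflexive e′) (↭-sym q)

size : 𝔽₂ → ℕ → ℕ
size 0ℙ s = 0
size 1ℙ s = s

-- φ prescribes the entries of the new row in some of the classes.
cuts : (Vec 𝔽₂ m → Maybe 𝔽₂) → Vec 𝔽₂ m × ℕ → List ℕ
cuts φ (l , s) with φ l
... | just b  = size b s ∷ []
... | nothing = upTo (suc s)

Obeys : (Vec 𝔽₂ m → Maybe 𝔽₂) → Vec 𝔽₂ (suc m) → Set
Obeys φ y = ∀ b → φ (tail y) ≡ just b → head y ≡ b

cut-class : ∀ s (l : Vec 𝔽₂ m) ys → mapᴸ tail ys ≡ replicate s l →
            ∃ λ r → r ≤ s × ys ↭ replicate (s ∸ r) (0ℙ ∷ l) ++ replicate r (1ℙ ∷ l) ×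
                    (∀ b → All (λ y → head y ≡ b) ys → r ≡ size b s)
cut-class zero l [] e = 0 , z≤n , ↭-refl , λ { 0ℙ _ → refl ; 1ℙ _ → refl }
cut-class (suc s) l ((0ℙ ∷ y) ∷ ys) e with cut-class s l ys (∷-injectiveʳ e)
... | r , r≤s , p , h = r , ℕ.m≤n⇒m≤1+n r≤s ,
  subst₂ (λ y t → (0ℙ ∷ y) ∷ ys ↭ replicate t (0ℙ ∷ l) ++ replicate r (1ℙ ∷ l))
    (sym (∷-injectiveˡ e)) (sym (ℕ.+-∸-assoc 1 r≤s)) (↭-prep (0ℙ ∷ l) p) ,
  λ { 0ℙ (_ ∷ a) → h 0ℙ a ; 1ℙ (() ∷ _) }
cut-class (suc s) l ((1ℙ ∷ y) ∷ ys) e with cut-class s l ys (∷-injectiveʳ e)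
... | r , r≤s , p , h = suc r , s≤s r≤s ,
  subst (λ y → (1ℙ ∷ y) ∷ ys ↭ replicate (s ∸ r) (0ℙ ∷ l) ++ (1ℙ ∷ l) ∷ replicate r (1ℙ ∷ l))
    (sym (∷-injectiveˡ e))
    (↭-trans (↭-prep (1ℙ ∷ l) p) (↭-sym (↭-shift (1ℙ ∷ l) (replicate (s ∸ r) (0ℙ ∷ l)) (replicate r (1ℙ ∷ l))))) ,
  λ { 0ℙ (() ∷ _) ; 1ℙ (_ ∷ a) → cong suc (h 1ℙ a) }

-- The reduction of the search to counts: up to order, a new row matters only through its number of
-- ones in each class, and a prescribed entry fixes that number.
refine : ∀ φ (K : Classes m) ys → mapᴸ tail ys ≡ expand K → All (Obeys φ) ys →
         ∃ λ ρ → Pointwise _∈ᴸ_ ρ (mapᴸ (cuts φ) K) × ys ↭ expand (split K ρ)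
refine φ [] [] e o = [] , [] , ↭-refl
refine φ ((l , s) ∷ K) ys e o with unappend (replicate s l) ys e
  where
  unappend : ∀ {A B : Set} {f : A → B} xs {zs} ys → mapᴸ f ys ≡ xs ++ zs →
             ∃₂ λ as bs → ys ≡ as ++ bs × mapᴸ f as ≡ xs × mapᴸ f bs ≡ zs
  unappend []       ys       e = [] , ys , refl , refl , e
  unappend (x ∷ xs) (y ∷ ys) e with unappend xs ys (∷-injectiveʳ e)
  ... | as , bs , refl , eas , ebs = y ∷ as , bs , refl , cong₂ _∷_ (∷-injectiveˡ e) eas , ebs
... | as , bs , refl , eas , ebs with ++⁻ as o
...   | oas , obs with cut-class s l as eas | refine φ K bs ebs obs
...     | r , r≤s , p , h | ρ , v , q = r ∷ ρ , r∈ ∷ v ,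
  ↭-trans (++⁺ p q) (↭-reflexive (sym (expand-split l s K r ρ)))
  where
  tails : ∀ s as → mapᴸ tail as ≡ replicate s l → All (λ y → tail y ≡ l) as
  tails zero    []       e = []
  tails (suc s) (a ∷ as) e = ∷-injectiveˡ e ∷ tails s as (∷-injectiveʳ e)
  r∈ : r ∈ᴸ cuts φ (l , s)
  r∈ with φ l in φl
  ... | nothing = ∈-upTo⁺ (s≤s r≤s)
  ... | just b  = here (h b (All.zipWith (λ { (ob , t) → ob b (trans (cong φ t) φl) }) (oas , tails s as eas)))

every : List (List ℕ) → (List ℕ → Bool) → Bool
every []         p = p []
every (xs ∷ xss) p = all (λ x → every xss (p ∘ (x ∷_))) xs

every-sound : ∀ {ρ xss} p → T (every xss p) → Pointwise _∈ᴸ_ ρ xss → T (p ρ)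
every-sound p t []                             = t
every-sound {xss = xs ∷ xss} p t (x∈xs ∷ ρ∈xss) =
  every-sound _ (All.lookup (all⁺ (λ x → every xss (p ∘ (x ∷_))) xs t) x∈xs) ρ∈xss

-- Codewords with prescribed entries

either : 𝔽₂ → 𝔽₂ → 𝔽₂
either 0ℙ b = b
either 1ℙ b = 1ℙ

-- Position by position: a point of `D` lies in exactly one of the two words, a point of the mask
-- outside `D` in both or neither, any other point in neither.
masked-wt : (D μ v : Word n) → let M = zipWith either D μ in
            wt (M ∧ v) + wt ((M ∧ v) ⊕ D) ≤ wt D + 2 * wt (μ ∧ (𝟏 ⊕ D))
masked-wt []       []       []       = z≤n
masked-wt (0ℙ ∷ D) (0ℙ ∷ μ) (a ∷ v)  = masked-wt D μ v
masked-wt (0ℙ ∷ D) (1ℙ ∷ μ) (0ℙ ∷ v) =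
  ℕ.≤-trans (masked-wt D μ v) (ℕ.+-monoʳ-≤ (wt D) (ℕ.*-monoʳ-≤ 2 (ℕ.n≤1+n (wt (μ ∧ (𝟏 ⊕ D))))))
masked-wt (0ℙ ∷ D) (1ℙ ∷ μ) (1ℙ ∷ v) = subst₂ _≤_
  (cong suc (sym (ℕ.+-suc _ _))) (shift (wt D) (wt (μ ∧ (𝟏 ⊕ D)))) (s≤s (s≤s (masked-wt D μ v)))
  where
  shift : ∀ a b → 2 + (a + 2 * b) ≡ a + 2 * (1 + b)
  shift = solve-∀
masked-wt (1ℙ ∷ D) (0ℙ ∷ μ) (0ℙ ∷ v) =
  ℕ.≤-trans (ℕ.≤-reflexive (ℕ.+-suc _ _)) (s≤s (masked-wt D μ v))
masked-wt (1ℙ ∷ D) (0ℙ ∷ μ) (1ℙ ∷ v) = s≤s (masked-wt D μ v)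
masked-wt (1ℙ ∷ D) (1ℙ ∷ μ) (0ℙ ∷ v) =
  ℕ.≤-trans (ℕ.≤-reflexive (ℕ.+-suc _ _)) (s≤s (masked-wt D μ v))
masked-wt (1ℙ ∷ D) (1ℙ ∷ μ) (1ℙ ∷ v) = s≤s (masked-wt D μ v)

products-∧ : (M : Word n) (G : Vec (Word n) k) (v : Word n) → products (map (M ∧_) G) v ≡ products G (M ∧ v)
products-∧ M []      v = refl
products-∧ M (g ∷ G) v = cong₂ _∷_ (⟨,⟩-∧ M g v) (products-∧ M G v)

∧-distribˡ-⊕ : (M v w : Word n) → M ∧ (v ⊕ w) ≡ (M ∧ v) ⊕ (M ∧ w)
∧-distribˡ-⊕ []      []      []      = refl
∧-distribˡ-⊕ (a ∷ M) (b ∷ v) (c ∷ w) = cong₂ _∷_ (ℙₚ.*-distribˡ-+ a b c) (∧-distribˡ-⊕ M v w)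

linComb-∧ : ∀ x (M : Word n) (G : Vec (Word n) k) → linComb x (map (M ∧_) G) ≡ M ∧ linComb x G
linComb-∧ []      M []      = sym (∧-𝟎 M)
  where
  ∧-𝟎 : (M : Word n) → M ∧ 𝟎 ≡ 𝟎
  ∧-𝟎 []      = refl
  ∧-𝟎 (a ∷ M) = cong₂ _∷_ (ℙₚ.*-zeroʳ a) (∧-𝟎 M)
linComb-∧ (0ℙ ∷ x) M (g ∷ G) = trans (linComb-0∷ x _ _) (trans (linComb-∧ x M G) (cong (M ∧_) (sym (linComb-0∷ x g G))))
linComb-∧ (1ℙ ∷ x) M (g ∷ G) = trans (linComb-1∷ x _ _) (trans (cong ((M ∧ g) ⊕_) (linComb-∧ x M G))
  (trans (sym (∧-distribˡ-⊕ M g (linComb x G))) (cong (M ∧_) (sym (linComb-1∷ x g G)))))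

-- Cutting the classes by a codeword. The rows are k codewords above a marking, 𝟏 and a dodecad.

pad : ∀ k → Vec 𝔽₂ 3 → Vec 𝔽₂ (k + 3)
pad zero    v = v
pad (suc k) v = 0ℙ ∷ pad k v

marking : ∀ k → Vec 𝔽₂ (k + 3)
marking k = pad k (1ℙ ∷ 0ℙ ∷ 0ℙ ∷ [])

-- The dodecad or its complement.
side : 𝔽₂ → ∀ k → Vec 𝔽₂ (k + 3)
side a k = pad k (0ℙ ∷ a ∷ 1ℙ ∷ [])

-- The marking only labels columns and is no codeword, so combinations are known to lie in the code
-- only when its coefficient is 0.
usesMark : ∀ k → Vec 𝔽₂ (k + 3) → 𝔽₂
usesMark zero    (a ∷ _) = a
usesMark (suc k) (_ ∷ x) = usesMark k x

usesMark-side : ∀ a k → usesMark k (side a k) ≡ 0ℙ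
usesMark-side a zero    = refl
usesMark-side a (suc k) = usesMark-side a k

-- Sums of at most `j` earlier codewords, with or without the dodecad. Adding 𝟏 would give no new
-- test, as `golayWeights` is symmetric about 12; the bound on the summands keeps the tests few.
light : ℕ → ∀ k → List (Vec 𝔽₂ (k + 3))
light j       zero    = (0ℙ ∷ 0ℙ ∷ 0ℙ ∷ []) ∷ (0ℙ ∷ 0ℙ ∷ 1ℙ ∷ []) ∷ []
light zero    (suc k) = mapᴸ (0ℙ ∷_) (light zero k)
light (suc j) (suc k) = mapᴸ (0ℙ ∷_) (light (suc j) k) ++ mapᴸ (1ℙ ∷_) (light j k)

usesMark-light : ∀ j k → All (λ x → usesMark k x ≡ 0ℙ) (light j k)
usesMark-light j       zero    = refl ∷ refl ∷ []
usesMark-light zero    (suc k) = All-map⁺ (usesMark-light zero k)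
usesMark-light (suc j) (suc k) = All-++⁺ (All-map⁺ (usesMark-light (suc j) k)) (All-map⁺ (usesMark-light j k))

when : {A : Set} → 𝔽₂ → A → Maybe A
when 0ℙ a = nothing
when 1ℙ a = just a

-- Adding the complementary dodecad to a codeword preserves its entries on the chosen side; the
-- marked point on the other side tells the two codewords apart.
masked : 𝔽₂ → ∀ k → Vec 𝔽₂ (k + 3) → 𝔽₂
masked a k l = either ⟨ side a k , l ⟩ ⟨ marking k , l ⟩

forced : 𝔽₂ → ∀ k → Vec 𝔽₂ (suc (k + 3)) → Maybe 𝔽₂
forced a k (s ∷ l) = when (masked a k l) s

-- The weight of the new row plus a combination that is constant on each class: where the constant
-- is `1ℙ`, the columns left at 0 count.
cross : List (𝔽₂ × ℕ) → List ℕ → ℕ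
cross ((0ℙ , s) ∷ t) (r ∷ ρ) = r + cross t ρ
cross ((1ℙ , s) ∷ t) (r ∷ ρ) = (s ∸ r) + cross t ρ
cross _              _       = 0

row : Vec 𝔽₂ m → Classes (suc m) → List (𝔽₂ × ℕ)
row x = mapᴸ (map₁ (⟨ x ,_⟩ ∘ tail))

golay? : ℕ → Bool
golay? w = ⌊ w ∈? golayWeights ⌋

passes : List (List (𝔽₂ × ℕ)) → List ℕ → Bool
passes rows ρ = all (λ t → golay? (cross t ρ)) rows

only : List (List (𝔽₂ × ℕ)) → List ℕ → List ℕ → Bool
only rows ρ₀ ρ = not (passes rows ρ) || ⌊ ≡-decᴸ ℕ._≟_ ρ ρ₀ ⌋

-- A codeword agreeing on the masked positions with a word that cuts the classes by σ has to cut the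
-- resulting classes by ρ.
record Step : Set where
  constructor step
  field
    a   : 𝔽₂
    σ ρ : List ℕ

even? : 𝔽₂ → Bool
even? 0ℙ = true
even? 1ℙ = false

-- The parity says that the target is orthogonal to the dodecad, without which no codeword could
-- agree with it there. The search covers all cuts compatible with the mask.
forces : 𝔽₂ → ∀ k → Classes (suc (k + 3)) → List ℕ → Bool
forces a k K ρ = even? (ℕ.parity (weigh (λ l → ⟨ side a k , tail l ⟩ ℙ.* head l) K)) &&
                 every (mapᴸ (cuts (forced a k)) K) (only (mapᴸ (λ x → row x K) (light 3 k)) ρ)

check : Step → ∀ k → Classes (k + 3) → Bool
check (step a σ ρ) k K =
  fits K σ &&
  ((weigh ⟨ side a k ,_⟩ K ℕ.≡ᵇ 12) &&
  ((weigh (λ l → ⟨ marking k , l ⟩ ℙ.* (⟨ side a k , l ⟩ ℙ.⁻¹)) K ℕ.≤ᵇ 1) &&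
  forces a k (split K σ) ρ))

-- The second entry belongs to the auxiliary target, which is discarded once the new codeword is
-- found.
drop₂ : Vec 𝔽₂ (suc (suc m)) → Vec 𝔽₂ (suc m)
drop₂ (c ∷ s ∷ l) = c ∷ l

next : Step → Classes m → Classes (suc m)
next (step a σ ρ) K = mapᴸ (map₁ drop₂) (split (split K σ) ρ)

check-all : List Step → ∀ k → Classes (k + 3) → Bool
check-all []       k K = true
check-all (s ∷ ss) k K = check s k K && check-all ss (suc k) (next s K)

-- A record, so that comparing two such types does not run the check.
record Valid (ss : List Step) (k : ℕ) (K : Classes (k + 3)) : Set where
  constructor valid
  field
    checked : T (check-all ss k K)

result : List Step → ∀ k → Classes (k + 3) → ∃ λ k → Classes (k + 3)
result []       k K = k , K
result (s ∷ ss) k K = result ss (suc k) (next s K)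

weigh-split : ∀ (x : Vec 𝔽₂ m) (K : Classes (suc m)) ρ →
              weigh (⟨ 1ℙ ∷ x ,_⟩ ∘ drop₂) (split K ρ) ≡ cross (row x K) ρ
weigh-split x []                  ρ       = refl
weigh-split x (l ∷ K)             []      with ⟨ x , tail (proj₁ l) ⟩
... | 0ℙ = refl
... | 1ℙ = refl
weigh-split x (((s ∷ l) , t) ∷ K) (r ∷ ρ) =
  trans (weigh-cell f _ (t ∸ r) _) (trans (cong (_+_ ((t ∸ r) * bit (f (0ℙ ∷ s ∷ l)))) (weigh-cell f _ r _)) (split-cases ⟨ x , l ⟩ refl))
  where
  f = ⟨ 1ℙ ∷ x ,_⟩ ∘ drop₂
  split-cases : ∀ b → ⟨ x , l ⟩ ≡ b →
    (t ∸ r) * bit ⟨ x , l ⟩ + (r * bit (⟨ x , l ⟩ ℙ.⁻¹) + weigh f (split K ρ)) ≡ cross ((⟨ x , l ⟩ , t) ∷ row x K) (r ∷ ρ)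
  split-cases 0ℙ e rewrite e = cong₂ _+_ (ℕ.*-zeroʳ (t ∸ r)) (cong₂ _+_ (ℕ.*-identityʳ r) (weigh-split x K ρ))
  split-cases 1ℙ e rewrite e = cong₂ _+_ (ℕ.*-identityʳ (t ∸ r)) (cong₂ _+_ (ℕ.*-zeroʳ r) (weigh-split x K ρ))

zipWith-map-map : ∀ {A : Set} (f : 𝔽₂ → 𝔽₂ → 𝔽₂) (g h : A → 𝔽₂) (V : Vec A n) →
                  zipWith f (map g V) (map h V) ≡ map (λ x → f (g x) (h x)) V
zipWith-map-map f g h []      = refl
zipWith-map-map f g h (x ∷ V) = cong (_ ∷_) (zipWith-map-map f g h V)

obeys : ∀ a k (V : Vec (Vec 𝔽₂ (k + 3)) n) c S → map (masked a k) V ∧ c ≡ map (masked a k) V ∧ S →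
        All (Obeys (forced a k)) (toList (zipWith _∷_ c (zipWith _∷_ S V)))
obeys a k []      []      []      e = []
obeys a k (l ∷ V) (c ∷ w) (s ∷ S) e = here-obeys ∷ obeys a k V w S (cong tail e)
  where
  here-obeys : Obeys (forced a k) (c ∷ s ∷ l)
  here-obeys b f with masked a k l | cong head e
  here-obeys b refl | 1ℙ | c≡s = c≡s

-- Realising the steps inside a code with the Golay weights

module _ {C : LinearCode 24} (A : OA₇ C k) (weights : ∀ {c} → c ∈ C → wt c ∈ᴸ golayWeights) where

  open OA₇ A

  -- All weights are divisible by 4, hence so is twice the size of the overlap of two codewords.
  self-orthogonal : ∀ {u v} → u ∈ C → v ∈ C → ⟨ u , v ⟩ ≡ 0ℙ
  self-orthogonal {u} {v} u∈C v∈C = 4∣⇒⟨,⟩≡0ℙ u v (∣m∣n⇒∣m+n (∣m∣n⇒∣m+n (4∣wt u∈C) (4∣wt v∈C))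
    (∣n⇒∣m*n 3 (4∣wt (⊕-codeword C u∈C v∈C))))
    where
    4∣wt : ∀ {c} → c ∈ C → 4 ∣ wt c
    4∣wt c∈C = All.lookup (toWitness {a? = All.all? (4 ∣?_) golayWeights} _) (weights c∈C)

  -- A vector orthogonal to C and supported on the mask is 𝟎 or D, by its weight.
  prescribe : ∀ {D} μ S → D ∈ C → wt D ≡ 12 → wt (μ ∧ (𝟏 ⊕ D)) ≤ 1 → ⟨ D , S ⟩ ≡ 0ℙ →
              ∃ λ c → c ∈ C × zipWith either D μ ∧ c ≡ zipWith either D μ ∧ S
  prescribe {D} μ S D∈C wt-D wt-μ D⊥S with fredholm (map (zipWith either D μ ∧_) G) (zipWith either D μ ∧ S)
  ... | inj₁ (x , e) = linComb x G , linComb-codeword x , trans (sym (linComb-∧ x _ G)) e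
  -- Failure yields a dual word `v′` inside the mask that is not orthogonal to `S`, while `D` is. So
  -- `v′` and `v′ ⊕ D` are nonzero dual words, of total weight at least 16, against at most 12 + 2
  -- by `masked-wt`.
  ... | inj₂ (v , Gv , Sv) = ⊥-elim (ℕ.<-irrefl refl (ℕ.≤-trans
          (ℕ.≤-trans (s≤s (s≤s ℕ.≤-refl)) (ℕ.+-mono-≤ (dual≥8 v′∈ v′≢𝟎) (dual≥8 v′⊕D∈ v′⊕D≢𝟎)))
          (ℕ.≤-trans (masked-wt D μ v) (subst (λ t → t + 2 * wt (μ ∧ (𝟏 ⊕ D)) ≤ 15) (sym wt-D)
            (ℕ.+-monoʳ-≤ 12 (ℕ.≤-trans (ℕ.*-monoʳ-≤ 2 wt-μ) (ℕ.m≤m+n 2 1)))))))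
    where
    v′ = zipWith either D μ ∧ v
    v′∈ : v′ ∈ C ⊥
    v′∈ = dual v′ (trans (sym (products-∧ (zipWith either D μ) G v)) Gv)
    Sv′ : ⟨ S , v′ ⟩ ≡ 1ℙ
    Sv′ = trans (sym (⟨,⟩-∧ (zipWith either D μ) S v)) Sv
    v′≢𝟎 : v′ ≢ 𝟎
    v′≢𝟎 e with () ← trans (sym Sv′) (trans (cong ⟨ S ,_⟩ e) (⟨,⟩-𝟎ʳ S))
    v′⊕D∈ : v′ ⊕ D ∈ C ⊥
    v′⊕D∈ = ⊕-codeword (C ⊥) {v′} {D} v′∈ (λ c∈C → self-orthogonal c∈C D∈C)
    v′⊕D≢𝟎 : v′ ⊕ D ≢ 𝟎
    v′⊕D≢𝟎 e with () ← trans (sym Sv′) (trans (cong ⟨ S ,_⟩ (⊕≡𝟎⇒≡ v′ D e)) (trans (⟨,⟩-comm S D) D⊥S))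

  -- The list `K` is computed without reference to the code; reaching the same `K` from every code
  -- is what makes it unique.
  record Realised (k : ℕ) (K : Classes (k + 3)) : Set where
    field
      W        : Vec (Word 24) (k + 3)
      codeword : ∀ x → usesMark k x ≡ 0ℙ → linComb x W ∈ C
      sorted   : columns W ↭ expand K

  module _ {k K} (R : Realised k K) (s : Step) (ok : T (check s k K)) where

    open Realised R
    open Step s
    private
      V = cols W
      D = linComb (side a k) W
      D∈C : D ∈ C
      D∈C = codeword (side a k) (usesMark-side a k)
      μ = map ⟨ marking k ,_⟩ V
      K′ = split K σ

      weigh-W : ∀ f → wt (map f V) ≡ weigh f K
      weigh-W f = trans (wt-map f V) (trans (total-↭ f sorted) (total-expand f K))

      ok₁ = Equivalence.to (T-∧ {fits K σ}) ok
      ok₂ = Equivalence.to (T-∧ {weigh ⟨ side a k ,_⟩ K ℕ.≡ᵇ 12}) (proj₂ ok₁)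
      ok₃ = Equivalence.to (T-∧ {weigh (λ l → ⟨ marking k , l ⟩ ℙ.* (⟨ side a k , l ⟩ ℙ.⁻¹)) K ℕ.≤ᵇ 1}) (proj₂ ok₂)
      ok₄ = Equivalence.to (T-∧ {even? (ℕ.parity (weigh (λ l → ⟨ side a k , tail l ⟩ ℙ.* head l) K′))}) (proj₂ ok₃)

      -- The target need not be a codeword; only its entries on the mask are copied.
      S = proj₁ (mark W K σ (proj₁ ok₁) sorted)
      S-sorted : columns (S ∷ W) ↭ expand K′
      S-sorted = proj₂ (mark W K σ (proj₁ ok₁) sorted)

      D≡ : D ≡ map ⟨ side a k ,_⟩ V
      D≡ = linComb-cols (side a k) W

      wt-D : wt D ≡ 12
      wt-D = trans (cong wt D≡) (trans (weigh-W ⟨ side a k ,_⟩) (ℕ.≡ᵇ⇒≡ _ 12 (proj₁ ok₂)))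

      wt-μ : wt (μ ∧ (𝟏 ⊕ D)) ≤ 1
      wt-μ = subst (_≤ 1) (sym (trans (cong wt (trans (cong (λ D → μ ∧ (𝟏 ⊕ D)) D≡) (outside V)))
                                      (weigh-W _))) (ℕ.≤ᵇ⇒≤ _ 1 (proj₁ ok₃))
        where
        outside : ∀ {n} (V : Vec (Vec 𝔽₂ (k + 3)) n) → map ⟨ marking k ,_⟩ V ∧ (𝟏 ⊕ map ⟨ side a k ,_⟩ V) ≡
                  map (λ l → ⟨ marking k , l ⟩ ℙ.* (⟨ side a k , l ⟩ ℙ.⁻¹)) V
        outside []      = refl
        outside (l ∷ V) = cong (_ ∷_) (outside V)

      D⊥S : ⟨ D , S ⟩ ≡ 0ℙ
      D⊥S = trans (⟨,⟩≡parity D S) (trans (cong ℕ.parity (trans (cong wt (trans (cong (_∧ S) D≡) (pointwise V S)))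
        (trans (wt-map _ (cols (S ∷ W))) (trans (total-↭ _ S-sorted) (total-expand _ K′))))) (even (proj₁ ok₄)))
        where
        pointwise : ∀ {n} (V : Vec (Vec 𝔽₂ (k + 3)) n) S → map ⟨ side a k ,_⟩ V ∧ S ≡
                    map (λ l → ⟨ side a k , tail l ⟩ ℙ.* head l) (zipWith _∷_ S V)
        pointwise []      []      = refl
        pointwise (l ∷ V) (s ∷ S) = cong (_ ∷_) (pointwise V S)
        even : ∀ {p} → T (even? p) → p ≡ 0ℙ
        even {0ℙ} _ = refl

      found = prescribe μ S D∈C wt-D wt-μ D⊥S
      c = proj₁ found
      c∈C : c ∈ C
      c∈C = proj₁ (proj₂ found)

      c-obeys : All (Obeys (forced a k)) (columns (c ∷ S ∷ W))
      c-obeys = obeys a k V c S (subst (λ M → M ∧ c ≡ M ∧ S)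
        (trans (cong (λ D → zipWith either D μ) D≡) (zipWith-map-map either ⟨ side a k ,_⟩ ⟨ marking k ,_⟩ V))
        (proj₂ (proj₂ found)))

      sorting = ↭-map-inv tail (↭-trans (↭-reflexive (map-tail-zip c (cols (S ∷ W)))) S-sorted)
      refined = refine (forced a k) K′ (proj₁ sorting) (sym (proj₁ (proj₂ sorting)))
                  (All-resp-↭ (proj₂ (proj₂ sorting)) c-obeys)
      ρ′ = proj₁ refined

      cut-by-ρ′ : columns (c ∷ S ∷ W) ↭ expand (split K′ ρ′)
      cut-by-ρ′ = ↭-trans (proj₂ (proj₂ sorting)) (proj₂ (proj₂ refined))

      drop-S : mapᴸ drop₂ (columns (c ∷ S ∷ W)) ≡ columns (c ∷ W)
      drop-S = drop-second V c S
        where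
        drop-second : ∀ {n} (V : Vec (Vec 𝔽₂ (k + 3)) n) c S →
               mapᴸ drop₂ (toList (zipWith _∷_ c (zipWith _∷_ S V))) ≡ toList (zipWith _∷_ c V)
        drop-second []      []      []      = refl
        drop-second (l ∷ V) (a ∷ c) (b ∷ S) = cong ((a ∷ l) ∷_) (drop-second V c S)

      codeword′ : ∀ x → usesMark (suc k) x ≡ 0ℙ → linComb x (c ∷ W) ∈ C
      codeword′ (0ℙ ∷ x) u = subst (_∈ C) (sym (linComb-0∷ x c W)) (codeword x u)
      codeword′ (1ℙ ∷ x) u = subst (_∈ C) (sym (linComb-1∷ x c W)) (⊕-codeword C c∈C (codeword x u))

      cross-weight : ∀ x → wt (linComb (1ℙ ∷ x) (c ∷ W)) ≡ cross (row x K′) ρ′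
      cross-weight x = begin
        wt (linComb (1ℙ ∷ x) (c ∷ W))                              ≡⟨ cong wt (linComb-cols (1ℙ ∷ x) (c ∷ W)) ⟩
        wt (map ⟨ 1ℙ ∷ x ,_⟩ (cols (c ∷ W)))                       ≡⟨ wt-map ⟨ 1ℙ ∷ x ,_⟩ (cols (c ∷ W)) ⟩
        total ⟨ 1ℙ ∷ x ,_⟩ (columns (c ∷ W))                       ≡⟨ cong (total ⟨ 1ℙ ∷ x ,_⟩) (sym drop-S) ⟩
        total ⟨ 1ℙ ∷ x ,_⟩ (mapᴸ drop₂ (columns (c ∷ S ∷ W)))      ≡⟨ cong sum (sym (map-∘ (columns (c ∷ S ∷ W)))) ⟩
        total (⟨ 1ℙ ∷ x ,_⟩ ∘ drop₂) (columns (c ∷ S ∷ W))         ≡⟨ total-↭ _ cut-by-ρ′ ⟩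
        total (⟨ 1ℙ ∷ x ,_⟩ ∘ drop₂) (expand (split K′ ρ′))        ≡⟨ total-expand _ (split K′ ρ′) ⟩
        weigh (⟨ 1ℙ ∷ x ,_⟩ ∘ drop₂) (split K′ ρ′)                 ≡⟨ weigh-split x K′ ρ′ ⟩
        cross (row x K′) ρ′                                        ∎
        where open ≡-Reasoning

      rows = mapᴸ (λ x → row x K′) (light 3 k)

      ρ′-passes : T (passes rows ρ′)
      ρ′-passes = all⁻ (λ t → golay? (cross t ρ′)) (All-map⁺ (All.map
        (λ {x} u → fromWitness (subst (_∈ᴸ golayWeights) (cross-weight x) (weights (codeword′ (1ℙ ∷ x) u))))
        (usesMark-light 3 k)))

      -- The actual cut is among those searched and passes every weight test, because sums with
      -- earlier codewords are codewords; the check leaves only `ρ`.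
      ρ′≡ρ : ρ′ ≡ ρ
      ρ′≡ρ = decide (Equivalence.to (T-∨ {not (passes rows ρ′)}) (every-sound _ (proj₂ ok₄) (proj₁ (proj₂ refined))))
        where
        open import Data.Sum.Base using (_⊎_)
        not-T : ∀ b → T b → ¬ T (not b)
        not-T true _ ()
        decide : T (not (passes rows ρ′)) ⊎ T ⌊ ≡-decᴸ ℕ._≟_ ρ′ ρ ⌋ → ρ′ ≡ ρ
        decide (inj₁ t) = ⊥-elim (not-T _ ρ′-passes t)
        decide (inj₂ t) = toWitness t

    extend : Realised (suc k) (next s K)
    extend = record
      { W        = c ∷ W
      ; codeword = codeword′
      ; sorted   = ↭-trans (↭-reflexive (sym drop-S)) (↭-trans (map⁺ drop₂ cut-by-ρ′)
                     (↭-reflexive (trans (cong (λ ρ → mapᴸ drop₂ (expand (split K′ ρ))) ρ′≡ρ) (map-expand drop₂ (split K′ ρ)))))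
      }

  extend-all : ∀ {k K} → Realised k K → ∀ ss → Valid ss k K → let (k′ , K′) = result ss k K in Realised k′ K′
  extend-all R []       _  = R
  extend-all {k} {K} R (s ∷ ss) (valid ok) with Equivalence.to (T-∧ {check s k K}) ok
  ... | ok₁ , ok₂ = extend-all (extend R s ok₁) ss (valid ok₂)

-- Uniqueness of the Golay code

-- Twelve columns on each side of the dodecad, one of them marked.
start : Classes 3
start = (0ℙ ∷ 1ℙ ∷ 0ℙ ∷ [] , 11) ∷ (1ℙ ∷ 1ℙ ∷ 0ℙ ∷ [] , 1) ∷ (0ℙ ∷ 1ℙ ∷ 1ℙ ∷ [] , 11) ∷ (1ℙ ∷ 1ℙ ∷ 1ℙ ∷ [] , 1) ∷ []

-- Found by computer search: each step leaves a single way to cut the classes, and the last classes have size 1.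
script : List Step
script =
    step 1ℙ (2 ∷ 0 ∷ 0 ∷ 0 ∷ [])
           (0 ∷ 2 ∷ 0 ∷ 6 ∷ 0 ∷ [])
  ∷ step 1ℙ (0 ∷ 1 ∷ 1 ∷ 0 ∷ 0 ∷ 0 ∷ [])
           (0 ∷ 0 ∷ 1 ∷ 1 ∷ 3 ∷ 3 ∷ 0 ∷ [])
  ∷ step 0ℙ (0 ∷ 0 ∷ 0 ∷ 0 ∷ 0 ∷ 0 ∷ 1 ∷ 0 ∷ 1 ∷ [])
           (5 ∷ 1 ∷ 0 ∷ 0 ∷ 0 ∷ 0 ∷ 0 ∷ 1 ∷ 0 ∷ 1 ∷ [])
  ∷ step 0ℙ (0 ∷ 0 ∷ 0 ∷ 0 ∷ 0 ∷ 2 ∷ 0 ∷ 0 ∷ 0 ∷ 0 ∷ 0 ∷ [])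
           (2 ∷ 4 ∷ 0 ∷ 0 ∷ 0 ∷ 2 ∷ 0 ∷ 0 ∷ 0 ∷ 0 ∷ 0 ∷ [])
  ∷ step 1ℙ (2 ∷ 0 ∷ 0 ∷ 0 ∷ 0 ∷ 0 ∷ 0 ∷ 0 ∷ 0 ∷ 0 ∷ 0 ∷ 0 ∷ 0 ∷ [])
           (2 ∷ 0 ∷ 0 ∷ 0 ∷ 0 ∷ 0 ∷ 0 ∷ 0 ∷ 2 ∷ 2 ∷ 0 ∷ 2 ∷ 0 ∷ [])
  ∷ step 0ℙ (0 ∷ 0 ∷ 0 ∷ 0 ∷ 0 ∷ 0 ∷ 0 ∷ 0 ∷ 0 ∷ 0 ∷ 1 ∷ 0 ∷ 0 ∷ 0 ∷ 1 ∷ [])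
           (1 ∷ 2 ∷ 0 ∷ 2 ∷ 1 ∷ 0 ∷ 0 ∷ 0 ∷ 0 ∷ 0 ∷ 0 ∷ 1 ∷ 0 ∷ 0 ∷ 0 ∷ 1 ∷ [])
  ∷ step 0ℙ (0 ∷ 0 ∷ 0 ∷ 0 ∷ 0 ∷ 0 ∷ 0 ∷ 0 ∷ 0 ∷ 0 ∷ 1 ∷ 0 ∷ 1 ∷ 0 ∷ 1 ∷ 0 ∷ 0 ∷ 1 ∷ [])
           (0 ∷ 1 ∷ 2 ∷ 1 ∷ 1 ∷ 1 ∷ 1 ∷ 1 ∷ 0 ∷ 0 ∷ 1 ∷ 0 ∷ 1 ∷ 0 ∷ 1 ∷ 0 ∷ 0 ∷ 1 ∷ [])
  ∷ step 1ℙ (0 ∷ 1 ∷ 2 ∷ 0 ∷ 0 ∷ 0 ∷ 0 ∷ 0 ∷ 0 ∷ 1 ∷ 0 ∷ 0 ∷ 0 ∷ 0 ∷ 0 ∷ 0 ∷ 0 ∷ 0 ∷ 0 ∷ 0 ∷ [])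
           (0 ∷ 1 ∷ 2 ∷ 0 ∷ 0 ∷ 0 ∷ 0 ∷ 0 ∷ 0 ∷ 1 ∷ 0 ∷ 0 ∷ 0 ∷ 1 ∷ 0 ∷ 1 ∷ 0 ∷ 1 ∷ 1 ∷ 0 ∷ [])
  ∷ step 1ℙ (1 ∷ 0 ∷ 0 ∷ 0 ∷ 0 ∷ 0 ∷ 0 ∷ 1 ∷ 0 ∷ 0 ∷ 0 ∷ 0 ∷ 0 ∷ 0 ∷ 0 ∷ 0 ∷ 0 ∷ 0 ∷ 0 ∷ 0 ∷ 0 ∷ 0 ∷ [])
           (1 ∷ 0 ∷ 0 ∷ 0 ∷ 0 ∷ 0 ∷ 0 ∷ 1 ∷ 0 ∷ 0 ∷ 0 ∷ 1 ∷ 1 ∷ 0 ∷ 0 ∷ 1 ∷ 1 ∷ 1 ∷ 0 ∷ 0 ∷ 1 ∷ 0 ∷ [])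
  ∷ step 0ℙ (0 ∷ 0 ∷ 0 ∷ 0 ∷ 0 ∷ 0 ∷ 0 ∷ 0 ∷ 0 ∷ 0 ∷ 0 ∷ 1 ∷ 0 ∷ 0 ∷ 0 ∷ 0 ∷ 0 ∷ 0 ∷ 0 ∷ 1 ∷ 0 ∷ 0 ∷ 0 ∷ [])
           (1 ∷ 1 ∷ 1 ∷ 0 ∷ 0 ∷ 0 ∷ 1 ∷ 1 ∷ 0 ∷ 1 ∷ 0 ∷ 1 ∷ 0 ∷ 0 ∷ 0 ∷ 0 ∷ 0 ∷ 0 ∷ 0 ∷ 1 ∷ 0 ∷ 0 ∷ 0 ∷ [])
  ∷ []

-- Type-checking this runs the whole search by evaluation.
script-valid : Valid script 0 start
script-valid = valid tt

final : Classes 13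
final = proj₂ (result script 0 start)

-- Comparison with the Golay generator matrix

pick : (x : Vec 𝔽₂ m) (ys : List (Vec 𝔽₂ m)) → Maybe (∃ λ zs → x ∷ zs ↭ ys)
pick x [] = nothing
pick x (y ∷ ys) with x ≟ʷ y
... | yes refl = just (ys , ↭-refl)
... | no _ with pick x ys
...   | nothing       = nothing
...   | just (zs , p) = just (y ∷ zs , ↭-trans (↭-swap x y ↭-refl) (↭-prep y p))

rearrangement : (xs ys : List (Vec 𝔽₂ m)) → Maybe (xs ↭ ys)
rearrangement []       []      = just ↭-refl
rearrangement []       (_ ∷ _) = nothing
rearrangement (x ∷ xs) ys with pick x ys
... | nothing       = nothing
... | just (zs , p) with rearrangement xs zs
...   | nothing = nothing
...   | just q  = just (↭-trans (↭-prep x q) p)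

-- Row operations act on each column separately, so they are compatible with reordering the columns.
cols-map : ∀ (W : Vec (Word n) m) (As : Vec (Vec 𝔽₂ m) k) →
           cols (map (λ a → linComb a W) As) ≡ map (λ l → map ⟨_, l ⟩ As) (cols W)
cols-map W [] = constant (cols W)
  where
  constant : ∀ {n} (V : Vec (Vec 𝔽₂ m) n) → Data.Vec.Base.replicate n [] ≡ map (λ _ → []) V
  constant []      = refl
  constant (_ ∷ V) = cong ([] ∷_) (constant V)
cols-map W (a ∷ As) = trans (cong₂ (zipWith _∷_) (linComb-cols a W) (cols-map W As)) (zip (cols W))
  where
  zip : ∀ {n} (V : Vec (Vec 𝔽₂ _) n) →
        zipWith _∷_ (map ⟨ a ,_⟩ V) (map (λ l → map ⟨_, l ⟩ As) V) ≡ map (λ l → map ⟨_, l ⟩ (a ∷ As)) V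
  zip []      = refl
  zip (l ∷ V) = cong (_ ∷_) (zip V)

-- Every row of golayMatrix is this combination of the ten codewords, the marking (with coefficient 0), 𝟏 and the dodecad.
toGolay : Vec (Vec 𝔽₂ 13) 12
toGolay =
    (0ℙ ∷ 0ℙ ∷ 0ℙ ∷ 1ℙ ∷ 1ℙ ∷ 0ℙ ∷ 0ℙ ∷ 1ℙ ∷ 0ℙ ∷ 1ℙ ∷ 0ℙ ∷ 0ℙ ∷ 0ℙ ∷ [])
  ∷ (0ℙ ∷ 0ℙ ∷ 1ℙ ∷ 1ℙ ∷ 1ℙ ∷ 1ℙ ∷ 0ℙ ∷ 0ℙ ∷ 0ℙ ∷ 1ℙ ∷ 0ℙ ∷ 1ℙ ∷ 1ℙ ∷ [])
  ∷ (0ℙ ∷ 1ℙ ∷ 0ℙ ∷ 0ℙ ∷ 0ℙ ∷ 1ℙ ∷ 0ℙ ∷ 0ℙ ∷ 0ℙ ∷ 0ℙ ∷ 0ℙ ∷ 0ℙ ∷ 0ℙ ∷ [])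
  ∷ (0ℙ ∷ 1ℙ ∷ 0ℙ ∷ 1ℙ ∷ 1ℙ ∷ 1ℙ ∷ 0ℙ ∷ 1ℙ ∷ 0ℙ ∷ 1ℙ ∷ 0ℙ ∷ 0ℙ ∷ 1ℙ ∷ [])
  ∷ (0ℙ ∷ 1ℙ ∷ 1ℙ ∷ 1ℙ ∷ 1ℙ ∷ 0ℙ ∷ 0ℙ ∷ 0ℙ ∷ 1ℙ ∷ 1ℙ ∷ 0ℙ ∷ 1ℙ ∷ 1ℙ ∷ [])
  ∷ (0ℙ ∷ 1ℙ ∷ 1ℙ ∷ 1ℙ ∷ 1ℙ ∷ 0ℙ ∷ 0ℙ ∷ 0ℙ ∷ 1ℙ ∷ 0ℙ ∷ 0ℙ ∷ 1ℙ ∷ 1ℙ ∷ [])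
  ∷ (0ℙ ∷ 0ℙ ∷ 1ℙ ∷ 1ℙ ∷ 0ℙ ∷ 1ℙ ∷ 1ℙ ∷ 0ℙ ∷ 1ℙ ∷ 0ℙ ∷ 0ℙ ∷ 1ℙ ∷ 0ℙ ∷ [])
  ∷ (1ℙ ∷ 0ℙ ∷ 0ℙ ∷ 0ℙ ∷ 1ℙ ∷ 1ℙ ∷ 0ℙ ∷ 0ℙ ∷ 0ℙ ∷ 1ℙ ∷ 0ℙ ∷ 0ℙ ∷ 1ℙ ∷ [])
  ∷ (0ℙ ∷ 1ℙ ∷ 0ℙ ∷ 0ℙ ∷ 0ℙ ∷ 0ℙ ∷ 0ℙ ∷ 0ℙ ∷ 0ℙ ∷ 0ℙ ∷ 0ℙ ∷ 0ℙ ∷ 0ℙ ∷ [])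
  ∷ (1ℙ ∷ 0ℙ ∷ 0ℙ ∷ 1ℙ ∷ 0ℙ ∷ 0ℙ ∷ 0ℙ ∷ 0ℙ ∷ 1ℙ ∷ 0ℙ ∷ 0ℙ ∷ 1ℙ ∷ 0ℙ ∷ [])
  ∷ (0ℙ ∷ 0ℙ ∷ 1ℙ ∷ 0ℙ ∷ 0ℙ ∷ 0ℙ ∷ 1ℙ ∷ 1ℙ ∷ 0ℙ ∷ 1ℙ ∷ 0ℙ ∷ 0ℙ ∷ 1ℙ ∷ [])
  ∷ (0ℙ ∷ 1ℙ ∷ 1ℙ ∷ 1ℙ ∷ 0ℙ ∷ 1ℙ ∷ 0ℙ ∷ 1ℙ ∷ 0ℙ ∷ 0ℙ ∷ 0ℙ ∷ 0ℙ ∷ 0ℙ ∷ [])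
  ∷ []

to-golay : mapᴸ (λ l → map ⟨_, l ⟩ toGolay) (expand final) ↭ columns golayMatrix
to-golay = from-just (rearrangement (mapᴸ (λ l → map ⟨_, l ⟩ toGolay) (expand final)) (columns golayMatrix))

-- Self-duality of the Golay code

basis : Vec (Word 24) (12 + 12)
basis = tabulate {n = 12} (λ i → δ (i ↑ˡ 12)) ++ⱽ golayMatrix

-- The right half of golayMatrix is its own inverse.
basis-inverse : Vec (Vec 𝔽₂ (12 + 12)) 24
basis-inverse = tabulate {n = 12} (λ i → δ (i ↑ˡ 12)) ++ⱽ map (λ g → drop 12 g ++ⱽ drop 12 g) golayMatrix

orthogonal-to-basis : ∀ z → products basis z ≡ 𝟎 → z ≡ 𝟎
orthogonal-to-basis z e = trans (sym (tabulate∘lookup z)) (trans (tabulate-cong coordinate) (tabulate∘lookup 𝟎))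
  where
  units : ∀ i → linComb (lookup basis-inverse i) basis ≡ δ i
  units = toWitness {a? = Fin.all? (λ i → linComb (lookup basis-inverse i) basis ≟ʷ δ i)} _
  coordinate : ∀ i → lookup z i ≡ lookup 𝟎 i
  coordinate i = begin
    lookup z i                                              ≡⟨ sym (⟨,δ⟩ z i) ⟩
    ⟨ z , δ i ⟩                                             ≡⟨ ⟨,⟩-comm z (δ i) ⟩
    ⟨ δ i , z ⟩                                             ≡⟨ cong ⟨_, z ⟩ (sym (units i)) ⟩
    ⟨ linComb (lookup basis-inverse i) basis , z ⟩          ≡⟨ ⟨linComb,⟩ (lookup basis-inverse i) basis z ⟩
    ⟨ lookup basis-inverse i , products basis z ⟩           ≡⟨ cong ⟨ lookup basis-inverse i ,_⟩ e ⟩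
    ⟨ lookup basis-inverse i , 𝟎 ⟩                          ≡⟨ ⟨,⟩-𝟎ʳ (lookup basis-inverse i) ⟩
    0ℙ                                                      ≡⟨ sym (lookup-𝟎 i) ⟩
    lookup 𝟎 i                                              ∎
    where open ≡-Reasoning

-- The codeword `c` with the same first twelve entries as `u` differs from `u` by a word orthogonal
-- to the first twelve unit words and, as the rows are mutually orthogonal, to the rows; so the
-- difference is 𝟎.
golay-self-dual : ∀ u → products golayMatrix u ≡ 𝟎 → u ∈ 𝒢₂₄
golay-self-dual u e = x , ⊕≡𝟎⇒≡ c u (orthogonal-to-basis (c ⊕ u)
  (trans (mapⱽ-++ ⟨_, c ⊕ u ⟩ E golayMatrix) (cong₂ _++ⱽ_
    (trans (products-⊕ E c u) (trans (cong (_⊕ x) E-c) (⊕-self x)))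
    (trans (products-⊕ golayMatrix c u) (cong₂ _⊕_ G-c e)))))
  where
  E : Vec (Word 24) 12
  E = tabulate (λ i → δ (i ↑ˡ 12))
  x = products E u
  c = linComb x golayMatrix
  rows : ∀ i → products golayMatrix (δ (i ↑ˡ 12)) ≡ δ i
  rows = toWitness {a? = Fin.all? {n = 12} (λ i → products golayMatrix (δ (i ↑ˡ 12)) ≟ʷ δ i)} _
  orthogonal : All (λ g → products golayMatrix g ≡ 𝟎) (toList golayMatrix)
  orthogonal = toWitness {a? = All.all? (λ g → products golayMatrix g ≟ʷ 𝟎) (toList golayMatrix)} _
  E-c : products E c ≡ x
  E-c = trans (sym (tabulate-∘ ⟨_, c ⟩ (λ i → δ (i ↑ˡ 12)))) (trans (tabulate-cong (λ i → begin
    ⟨ δ (i ↑ˡ 12) , c ⟩                            ≡⟨ ⟨,⟩-comm (δ (i ↑ˡ 12)) c ⟩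
    ⟨ c , δ (i ↑ˡ 12) ⟩                            ≡⟨ ⟨linComb,⟩ x golayMatrix (δ (i ↑ˡ 12)) ⟩
    ⟨ x , products golayMatrix (δ (i ↑ˡ 12)) ⟩     ≡⟨ cong ⟨ x ,_⟩ (rows i) ⟩
    ⟨ x , δ i ⟩                                    ≡⟨ ⟨,δ⟩ x i ⟩
    lookup x i                                     ∎)) (tabulate∘lookup x))
    where open ≡-Reasoning
  products-𝟎 : ∀ {m} (G : Vec (Word 24) m) → All (λ g → products golayMatrix g ≡ 𝟎) (toList G) → products G c ≡ 𝟎
  products-𝟎 []      []       = refl
  products-𝟎 (g ∷ G) (o ∷ os) = cong₂ _∷_
    (trans (⟨,⟩-comm g c) (trans (⟨linComb,⟩ x golayMatrix g) (trans (cong ⟨ x ,_⟩ o) (⟨,⟩-𝟎ʳ x))))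
    (products-𝟎 G os)
  G-c : products golayMatrix c ≡ 𝟎
  G-c = products-𝟎 golayMatrix orthogonal

-- Coordinate permutations

↭⇒Permutation : ∀ {A : Set} (u v : Vec A n) → toList u ↭ toList v →
                ∃ λ (π : Permutation n n) → ∀ i → lookup u i ≡ lookup v (π ⟨$⟩ʳ i)
↭⇒Permutation {A = A} u v p =
  cast-id (sym (length-toList u)) ∘ₚ (onIndices (↭⇒↭ₛ p) ∘ₚ cast-id (length-toList v)) ,
  λ i → trans (lookup-toList u _ i) (trans (onIndices-lookup (setoid A) (↭⇒↭ₛ p) (cast _ i))
    (trans (cong (lookupᴸ (toList v)) (sym (Fin.cast-involutive (sym (length-toList v)) (length-toList v) _)))
      (sym (lookup-toList v _ _))))
  where
  lookup-toList : ∀ {n} (u : Vec A n) .(e : n ≡ length (toList u)) i → lookup u i ≡ lookupᴸ (toList u) (cast e i)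
  lookup-toList (x ∷ u) e zero    = refl
  lookup-toList (x ∷ u) e (suc i) = lookup-toList u (ℕ.suc-injective e) i

permute-injective : (π : Permutation n n) (v w : Word n) → permute π v ≡ permute π w → v ≡ w
permute-injective π v w e = trans (sym (tabulate∘lookup v)) (trans (tabulate-cong (λ i → begin
  lookup v i                           ≡⟨ cong (lookup v) (sym (inverseˡ π)) ⟩
  lookup v (π ⟨$⟩ˡ (π ⟨$⟩ʳ i))         ≡⟨ sym (lookup∘tabulate _ (π ⟨$⟩ʳ i)) ⟩
  lookup (permute π v) (π ⟨$⟩ʳ i)      ≡⟨ cong (λ u → lookup u (π ⟨$⟩ʳ i)) e ⟩
  lookup (permute π w) (π ⟨$⟩ʳ i)      ≡⟨ lookup∘tabulate _ (π ⟨$⟩ʳ i) ⟩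
  lookup w (π ⟨$⟩ˡ (π ⟨$⟩ʳ i))         ≡⟨ cong (lookup w) (inverseˡ π) ⟩
  lookup w i                           ∎)) (tabulate∘lookup w))
  where open ≡-Reasoning

⟨,⟩≡∑ : (v w : Word n) → ⟨ v , w ⟩ ≡ ∑ℙ (λ i → lookup v i ℙ.* lookup w i)
⟨,⟩≡∑ []      []      = refl
⟨,⟩≡∑ (a ∷ v) (b ∷ w) = cong (a ℙ.* b ℙ.+_) (⟨,⟩≡∑ v w)

⟨permute,⟩ : (π : Permutation n n) (v w : Word n) → ⟨ permute π v , permute π w ⟩ ≡ ⟨ v , w ⟩
⟨permute,⟩ π v w = begin
  ⟨ permute π v , permute π w ⟩                                       ≡⟨ ⟨,⟩≡∑ (permute π v) (permute π w) ⟩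
  ∑ℙ (λ j → lookup (permute π v) j ℙ.* lookup (permute π w) j)        ≡⟨ sum-cong-≋ (λ j → cong₂ ℙ._*_ (lookup∘tabulate (λ j → lookup v (π ⟨$⟩ˡ j)) j) (lookup∘tabulate (λ j → lookup w (π ⟨$⟩ˡ j)) j)) ⟩
  ∑ℙ (λ j → lookup v (π ⟨$⟩ˡ j) ℙ.* lookup w (π ⟨$⟩ˡ j))              ≡⟨ sym (sum-permute (λ i → lookup v i ℙ.* lookup w i) (inverse π)) ⟩
  ∑ℙ (λ i → lookup v i ℙ.* lookup w i)                                ≡⟨ sym (⟨,⟩≡∑ v w) ⟩
  ⟨ v , w ⟩                                                           ∎
  where open ≡-Reasoning

-- Combinations of `W` put the row space inside the permuted code. Conversely, a codeword is
-- orthogonal to `W`, so its image is orthogonal to `G` and lies in the row space by self-duality.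
equivalent : {C : LinearCode n} (G W : Vec (Word n) m) → columns W ↭ columns G → (∀ x → linComb x W ∈ C) →
             (∀ {u v} → u ∈ C → v ∈ C → ⟨ u , v ⟩ ≡ 0ℙ) → (∀ u → products G u ≡ 𝟎 → u ∈ rowSpace G) → C ≅ rowSpace G
equivalent {n} {C = C} G W rearranged W-codeword self-orthogonal self-dual = π , λ v → mk⇔ (into v) (out-of v)
  where
  permutation = ↭⇒Permutation (cols W) (cols G) rearranged
  π : Permutation n n
  π = proj₁ permutation
  matching : ∀ x → linComb x G ≡ permute π (linComb x W)
  matching x = trans (sym (tabulate∘lookup (linComb x G))) (tabulate-cong (λ j → begin
    lookup (linComb x G) j                            ≡⟨ cong (λ w → lookup w j) (linComb-cols x G) ⟩
    lookup (map ⟨ x ,_⟩ (cols G)) j                   ≡⟨ lookup-map j ⟨ x ,_⟩ (cols G) ⟩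
    ⟨ x , lookup (cols G) j ⟩                         ≡⟨ cong (λ j → ⟨ x , lookup (cols G) j ⟩) (sym (inverseʳ π)) ⟩
    ⟨ x , lookup (cols G) (π ⟨$⟩ʳ (π ⟨$⟩ˡ j)) ⟩       ≡⟨ cong ⟨ x ,_⟩ (sym (proj₂ permutation (π ⟨$⟩ˡ j))) ⟩
    ⟨ x , lookup (cols W) (π ⟨$⟩ˡ j) ⟩                ≡⟨ sym (lookup-map (π ⟨$⟩ˡ j) ⟨ x ,_⟩ (cols W)) ⟩
    lookup (map ⟨ x ,_⟩ (cols W)) (π ⟨$⟩ˡ j)          ≡⟨ cong (λ w → lookup w (π ⟨$⟩ˡ j)) (sym (linComb-cols x W)) ⟩
    lookup (linComb x W) (π ⟨$⟩ˡ j)                   ∎))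
    where open ≡-Reasoning
  out-of : ∀ v → permute π v ∈ rowSpace G → v ∈ C
  out-of v (x , e) = subst (_∈ C) (permute-injective π (linComb x W) v (trans (sym (matching x)) e)) (W-codeword x)
  into : ∀ v → v ∈ C → permute π v ∈ rowSpace G
  into v v∈C = self-dual (permute π v) (zero-products (products G (permute π v)) (λ x → begin
    ⟨ x , products G (permute π v) ⟩                  ≡⟨ sym (⟨linComb,⟩ x G (permute π v)) ⟩
    ⟨ linComb x G , permute π v ⟩                     ≡⟨ cong ⟨_, permute π v ⟩ (matching x) ⟩
    ⟨ permute π (linComb x W) , permute π v ⟩         ≡⟨ ⟨permute,⟩ π (linComb x W) v ⟩
    ⟨ linComb x W , v ⟩                               ≡⟨ self-orthogonal (W-codeword x) v∈C ⟩
    0ℙ                                                ∎))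
    where
    open ≡-Reasoning
    zero-products : ∀ {m} (p : Vec 𝔽₂ m) → (∀ x → ⟨ x , p ⟩ ≡ 0ℙ) → p ≡ 𝟎
    zero-products p h with p ≟ʷ 𝟎
    ... | yes p≡𝟎 = p≡𝟎
    ... | no  p≢𝟎 with x , e ← nonzero-product p p≢𝟎 with () ← trans (sym e) (trans (⟨,⟩-comm p x) (h x))

-- From the weights to the equivalence

module _ {C : LinearCode 24} (A : OA₇ C k) (𝟏∈C : 𝟏 ∈ C) (weights : ∀ {c} → c ∈ C → wt c ∈ᴸ golayWeights) where

  initial : ∀ {P} → P ∈ C → wt P ≡ 12 → Realised A weights 0 start
  -- The single class of 24 empty columns is cut by `P` without constraints, and the count is its
  -- weight 12.
  initial {P} P∈C wt-P with refine (λ _ → nothing) (([] , 24) ∷ []) (columns (P ∷ [])) (map-tail-zip P (cols {m = 0} []))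
                             (All.universal (λ _ _ ()) (columns (P ∷ [])))
  ... | r ∷ [] , (_ ∷ []) , p = record { W = proj₁ marked ∷ 𝟏 ∷ P ∷ [] ; codeword = codeword ; sorted = proj₂ marked }
    where
    P≡ : ∀ {n} (P : Word n) (V : Vec (Vec 𝔽₂ 0) n) → P ≡ map head (zipWith _∷_ P V)
    P≡ []      []      = refl
    P≡ (a ∷ P) (l ∷ V) = cong (a ∷_) (P≡ P V)
    r≡12 : r ≡ 12
    r≡12 = begin
      r                                          ≡⟨ sym (trans (cong₂ _+_ (ℕ.*-zeroʳ (24 ∸ r)) (trans (ℕ.+-identityʳ _) (ℕ.*-identityʳ r))) refl) ⟩
      (24 ∸ r) * 0 + (r * 1 + 0)                 ≡⟨ cong (_+_ ((24 ∸ r) * 0)) (sym (weigh-cell head (1ℙ ∷ []) r [])) ⟩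
      (24 ∸ r) * 0 + weigh head (cell (1ℙ ∷ []) r [])  ≡⟨ sym (weigh-cell head (0ℙ ∷ []) (24 ∸ r) _) ⟩
      weigh head (split (([] , 24) ∷ []) (r ∷ []))     ≡⟨ sym (total-expand head (split (([] , 24) ∷ []) (r ∷ []))) ⟩
      total head (expand (split (([] , 24) ∷ []) (r ∷ [])))  ≡⟨ sym (total-↭ head p) ⟩
      total head (columns (P ∷ []))              ≡⟨ sym (wt-map head (cols (P ∷ []))) ⟩
      wt (map head (cols (P ∷ [])))              ≡⟨ cong wt (sym (P≡ P (cols {m = 0} []))) ⟩
      wt P                                       ≡⟨ wt-P ⟩
      12                                         ∎
      where open ≡-Reasoning
    K₂ : Classes 2
    K₂ = (1ℙ ∷ 0ℙ ∷ [] , 12) ∷ (1ℙ ∷ 1ℙ ∷ [] , 12) ∷ []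
    ones : ∀ {n m} (V : Vec (Vec 𝔽₂ m) n) → toList (zipWith _∷_ 𝟏 V) ≡ mapᴸ (1ℙ ∷_) (toList V)
    ones []      = refl
    ones (l ∷ V) = cong ((1ℙ ∷ l) ∷_) (ones V)
    sorted₂ : columns (𝟏 ∷ P ∷ []) ↭ expand K₂
    sorted₂ = ↭-trans (↭-reflexive (ones (cols (P ∷ [])))) (map⁺ (1ℙ ∷_)
      (subst (λ r → columns (P ∷ []) ↭ expand (split (([] , 24) ∷ []) (r ∷ []))) r≡12 p))
    marked : ∃ λ w → columns (w ∷ 𝟏 ∷ P ∷ []) ↭ expand start
    -- One point on each side of the dodecad, chosen arbitrarily.
    marked = mark (𝟏 ∷ P ∷ []) K₂ (1 ∷ 1 ∷ []) _ sorted₂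
    codeword : ∀ x → usesMark 0 x ≡ 0ℙ → linComb x (proj₁ marked ∷ 𝟏 ∷ P ∷ []) ∈ C
    codeword (0ℙ ∷ b ∷ x) _ = subst (_∈ C) (sym (linComb-0∷ (b ∷ x) (proj₁ marked) (𝟏 ∷ P ∷ [])))
      (linComb-∈ C x (λ { (c ∷ []) → linComb-∈ C [] {[]} (λ { [] → 𝟎-codeword C }) P∈C c }) 𝟏∈C b)

  realised : ∀ {P} → P ∈ C → wt P ≡ 12 → Realised A weights 10 final
  realised P∈C wt-P = extend-all A weights (initial P∈C wt-P) script script-valid

  golay-equivalent : Realised A weights 10 final → C ≅ 𝒢₂₄
  golay-equivalent R = equivalent {C = C} golayMatrix (map (λ a → linComb a W) toGolay)
    (↭-trans (↭-reflexive (trans (cong toList (cols-map W toGolay)) (toList-map (λ l → map ⟨_, l ⟩ toGolay) (cols W))))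
      (↭-trans (map⁺ (λ l → map ⟨_, l ⟩ toGolay) sorted) to-golay))
    (codewords toGolay (toWitness {a? = All.all? (λ a → usesMark 10 a ℙₚ.≟ 0ℙ) (toList toGolay)} _))
    (self-orthogonal A weights) golay-self-dual
    where
    open Realised R
    codewords : ∀ {m} (As : Vec (Vec 𝔽₂ 13) m) → All (λ a → usesMark 10 a ≡ 0ℙ) (toList As) →
                ∀ x → linComb x (map (λ a → linComb a W) As) ∈ C
    codewords []       []       []      = 𝟎-codeword C
    codewords (a ∷ As) (u ∷ us) (b ∷ x) = linComb-∈ C x (codewords As us) (codeword a u) b

from-weights : {C : LinearCode n} → OA₇ C k → 𝟏 ∈ C →
               n ≡ 24 × (∀ {c} → c ∈ C → wt c ∈ᴸ golayWeights) × (∃ λ c → c ∈ C × wt c ≡ 12) → C ≅ 𝒢₂₄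
from-weights A 𝟏∈C (refl , weights , P , P∈C , wt-P) = golay-equivalent A 𝟏∈C weights (realised A 𝟏∈C weights P∈C wt-P)

theorem1p4 : ∀ {n k d d⊥ t : ℕ} (C : LinearCode n) →
    IsCode C k d →
    𝟏 ∈ C →
    HasMinimumDistance (C ⊥) d⊥ →
    0 < t →
    # (λ u → Satisfiable (C ofWeight u) × 0 < u × u ≤ n ∸ t) ≡ (d⊥ ∸ t) →
    (d⊥ , t) ≡ (8 , 5) →
    C ≅ 𝒢₂₄
theorem1p4 C isCode 𝟏∈C ((b , b∈C⊥ , _ , wt-b) , dual≥8) _ (xs , distinct , len , listed) refl =
  from-weights A 𝟏∈C (golay-weights A 𝟏∈C b b∈C⊥ wt-b minimumDistance xs distinct len listed)
  where
  open IsCode isCode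
  A : OA₇ C _
  A = record { G = proj₁ dimension ; indep = proj₁ (proj₂ dimension) ; span = proj₂ (proj₂ dimension) ; dual≥8 = dual≥8 }
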